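{- Let $M$ be a countable transitive model of ZFC and let $G$ be $\mathbb{P}$-generic over $M$. In $M[G]$, let $\mathcal{A}=\{a_\alpha:\alpha<\omega_1\}$ be the generic family. Then $\mathcal{A}$ is concentrated on $\{a_n: n<\omega\}$: every open set $U\subseteq 2^\omega$ (in $M[G]$) with $\{a_n:n<\omega\}\subseteq U$ contains all but countably many elements of $\mathcal{A}$.
   Context: Subsets of $\omega$ are identified with their characteristic functions in $2^\omega$. The Hechler poset $\mathbb{P}$ consists of pairs $(p,q)$ where: $p:F\to 2^{N}$ for some finite $F\subseteq\omega_1$ and some $N<\omega$ (write $\mathrm{dom}(p)=F$, $N_p=N$); $q$ is a partial function from a subset of $[F]^2$ (two-element subsets of $F$) into $N$; and if $q(\{\alpha,\beta\})=n$ then for every $i$ with $n\le i<N$, $p(\alpha)(i)=0$ or $p(\beta)(i)=0$. The order is $(p_1,q_1)\le(p_2,q_2)$ iff $\mathrm{dom}(p_1)\supseteq\mathrm{dom}(p_2)$, $p_1(\alpha)\supseteq p_2(\alpha)$ for all $\alpha\in\mathrm{dom}(p_2)$, and $q_1\supseteq q_2$. For $G$ generic, $x_\alpha=\bigcup\{p(\alpha): \exists q\ (p,q)\in G\}\in 2^\omega$ and $a_\alpha=\{n: x_\alpha(n)=1\}$ for $\alpha<\omega_1$; $\mathcal{A}$ is a maximal almost disjoint family in $M[G]$. -}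

module Defs where

open import Data.Bool using (Bool; if_then_else_)
open import Data.Empty using (⊥; ⊥-elim)
open import Data.Fin using (Fin)
open import Data.Nat using (ℕ; zero; suc)
open import Data.Product using (Σ; _×_; _,_)
open import Data.Sum using (_⊎_)
open import Data.Vec.Functional using (_∷_)
open import Function.Bundles using (_⇔_)
open import Level using (Level; _⊔_) renaming (zero to 0ℓ; suc to lsuc)
open import Relation.Nullary using (¬_; Dec; does)

infix 4 _≈_ _∈_ _∉_ _⊆_ _≤_ _⊨_[_]
infix 7 _∈̇_ _≈̇_
infix 6 ¬̇_ ∀̇_
infixr 5 _∧̇_

-- The ambient universe of sets: well-founded trees taken up to bisimilarity.
-- Under excluded middle, (V , ≈ , ∈) is a model of ZF.

data V : Set₁ where
  sup : (A : Set) → (A → V) → V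

-- The elements of x are the  el x i , for i : ix x, up to ≈.

ix : V → Set
ix (sup A f) = A

el : (x : V) → ix x → V
el (sup A f) = f

_≈_ : V → V → Set
sup A f ≈ sup B g = (∀ a → Σ B λ b → f a ≈ g b) × (∀ b → Σ A λ a → f a ≈ g b)

_∈_ : V → V → Set
x ∈ y = Σ (ix y) λ i → x ≈ el y i

_∉_ : V → V → Set
x ∉ y = ¬ (x ∈ y)

_⊆_ : V → V → Set
x ⊆ y = ∀ i → el x i ∈ y

∅ : V
∅ = sup ⊥ ⊥-elim

⁅_,_⁆ : V → V → V
⁅ x , y ⁆ = sup Bool λ b → if b then x else y

⟨_,_⟩ : V → V → V
⟨ x , y ⟩ = ⁅ ⁅ x , x ⁆ , ⁅ x , y ⁆ ⁆

⋃ : V → V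
⋃ x = sup (Σ (ix x) λ i → ix (el x i)) λ (i , j) → el (el x i) j

-- sep x P = { z ∈ x : P z }
sep : V → (V → Set) → V
sep x P = sup (Σ (ix x) λ i → P (el x i)) λ (i , _) → el x i

-- image F x = { F z : z ∈ x }
image : (V → V) → V → V
image F x = sup (ix x) λ i → F (el x i)

_∖_ : V → V → V
x ∖ y = sep x (_∉ y)

num : ℕ → V
num zero    = ∅
num (suc n) = ⋃ ⁅ num n , ⁅ num n , num n ⁆ ⁆

ω : V
ω = sup ℕ num

-- For Kuratowski pairs, ⟨ x , y ⟩ ∈ f implies x , y ∈ ⋃ (⋃ f), so nothing is
-- lost by bounding the arguments and values in dom and _′_.

dom : V → V
dom f = sep (⋃ (⋃ f)) λ x → Σ (ix (⋃ (⋃ f))) λ j → ⟨ x , el (⋃ (⋃ f)) j ⟩ ∈ f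

-- f ′ x is the value of the function f at x, and ∅ when x ∉ dom f.
infixl 9 _′_

_′_ : V → V → V
f ′ x = ⋃ (sep (⋃ (⋃ f)) λ y → ⟨ x , y ⟩ ∈ f)

-- (A ⟶ B) f : the set f is a function with domain A and values in the class B.
record _⟶_ {ℓ : Level} (A : V) (B : V → Set ℓ) (f : V) : Set (lsuc 0ℓ ⊔ ℓ) where
  field
    graph  : ∀ z → z ∈ f → Σ V λ x → Σ V λ y → x ∈ A × B y × z ≈ ⟨ x , y ⟩
    total  : ∀ x → x ∈ A → Σ V λ y → ⟨ x , y ⟩ ∈ f
    unique : ∀ x y y' → ⟨ x , y ⟩ ∈ f → ⟨ x , y' ⟩ ∈ f → y ≈ y'

record _IsInjection_⟶ω (f X : V) : Set₁ where
  field
    function  : (X ⟶ (_∈ ω)) f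
    injective : ∀ x x' y → ⟨ x , y ⟩ ∈ f → ⟨ x' , y ⟩ ∈ f → x ≈ x'

Countable : V → Set₁
Countable X = Σ V λ f → f IsInjection X ⟶ω

-- Countability relativised to the transitive set N.
CountableIn : V → V → Set₁
CountableIn N X = Σ V λ f → f ∈ N × f IsInjection X ⟶ω

Finite : V → Set₁
Finite X = Σ ℕ λ n → Σ (Fin n → V) λ xs → X ≈ sup (Fin n) xs

Transitive : V → Set₁
Transitive x = ∀ y z → y ∈ x → z ∈ y → z ∈ x

-- Since V is well-founded, a transitive set of transitive sets is
-- well-ordered by ∈.
Ordinal : V → Set₁
Ordinal α = Transitive α × (∀ β → β ∈ α → Transitive β)

-- First-order formulas of set theory with free variables in Fin n (de Bruijn
-- indices), and their satisfaction in (M , ∈).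

data Formula (n : ℕ) : Set where
  _∈̇_ _≈̇_ : Fin n → Fin n → Formula n
  ¬̇_      : Formula n → Formula n
  _∧̇_     : Formula n → Formula n → Formula n
  ∀̇_      : Formula (suc n) → Formula n

_⊨_[_] : ∀ {n} (M : V) → Formula n → (Fin n → ix M) → Set
M ⊨ x ∈̇ y [ ρ ]   = el M (ρ x) ∈ el M (ρ y)
M ⊨ x ≈̇ y [ ρ ]   = el M (ρ x) ≈ el M (ρ y)
M ⊨ ¬̇ φ [ ρ ]     = ¬ (M ⊨ φ [ ρ ])
M ⊨ φ ∧̇ ψ [ ρ ]   = M ⊨ φ [ ρ ] × M ⊨ ψ [ ρ ]
M ⊨ ∀̇ φ [ ρ ]     = ∀ x → M ⊨ φ [ x ∷ ρ ]

-- (M , ∈) ⊨ ZFC.  The quantifiers of each axiom range over the elements of M;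
-- the single axioms are written out, the schemes range over Formula.
module _ (M : V) where
  infix 4 _ε_ _≐_

  _ε_ _≐_ : ix M → ix M → Set
  x ε y = el M x ∈ el M y
  x ≐ y = el M x ≈ el M y

  record ZFC : Set where
    field
      extensionality : ∀ x y → (∀ z → z ε x ⇔ z ε y) → x ≐ y

      foundation : ∀ x → (Σ (ix M) λ y → y ε x) →
        Σ (ix M) λ y → y ε x × (∀ z → z ε y → ¬ (z ε x))

      pairing : ∀ x y → Σ (ix M) λ z → x ε z × y ε z

      union : ∀ x → Σ (ix M) λ u → ∀ y z → z ε y → y ε x → z ε u

      powerset : ∀ x → Σ (ix M) λ p → ∀ y → (∀ z → z ε y → z ε x) → y ε p

      infinity : Σ (ix M) λ w →
        (Σ (ix M) λ e → e ε w × (∀ z → ¬ (z ε e))) ×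
        (∀ x → x ε w → Σ (ix M) λ s → s ε w × (∀ z → z ε s ⇔ (z ε x ⊎ z ≐ x)))

      separation : ∀ {n} (φ : Formula (suc n)) (ρ : Fin n → ix M) →
        ∀ a → Σ (ix M) λ b → ∀ x → x ε b ⇔ (x ε a × M ⊨ φ [ x ∷ ρ ])

      replacement : ∀ {n} (φ : Formula (suc (suc n))) (ρ : Fin n → ix M) →
        ∀ a →
        (∀ x → x ε a → Σ (ix M) λ y →
          M ⊨ φ [ x ∷ y ∷ ρ ] × (∀ y' → M ⊨ φ [ x ∷ y' ∷ ρ ] → y' ≐ y)) →
        Σ (ix M) λ b → ∀ x → x ε a → Σ (ix M) λ y → y ε b × M ⊨ φ [ x ∷ y ∷ ρ ]

      choice : ∀ a →
        (∀ x → x ε a → Σ (ix M) λ z → z ε x) →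
        (∀ x y z → x ε a → y ε a → z ε x → z ε y → x ≐ y) →
        Σ (ix M) λ c → ∀ x → x ε a →
          Σ (ix M) λ z → (z ε x × z ε c) × (∀ z' → z' ε x → z' ε c → z' ≐ z)

record CountableTransitiveModel (M : V) : Set₁ where
  field
    transitive : Transitive M
    countable  : Countable M
    zfc        : ZFC M

-- κ = ω₁ in the sense of M.
record IsOmega₁ (M κ : V) : Set₁ where
  field
    inModel     : κ ∈ M
    ordinal     : Ordinal κ
    uncountable : ¬ CountableIn M κ
    least       : ∀ β → β ∈ κ → CountableIn M β

-- For natural numbers n and i, n ≤ i is n ⊆ i.
record IsCondition (κ c : V) : Set₁ where
  field
    p q F N     : V
    pair        : c ≈ ⟨ p , q ⟩
    F-finite    : Finite F
    F⊆κ         : F ⊆ κ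
    N∈ω         : N ∈ ω
    p-function  : (F ⟶ (N ⟶ (_∈ num 2))) p
    E           : V
    E⊆[F]²      : ∀ e → e ∈ E → Σ V λ α → Σ V λ β →
                    α ∈ F × β ∈ F × ¬ (α ≈ β) × e ≈ ⁅ α , β ⁆
    q-function  : (E ⟶ (_∈ N)) q
    disjoint    : ∀ α β n → ⟨ ⁅ α , β ⁆ , n ⟩ ∈ q → ∀ i → n ⊆ i → i ∈ N →
                    ⟨ i , num 0 ⟩ ∈ p ′ α ⊎ ⟨ i , num 0 ⟩ ∈ p ′ β

record _≤_ (c₁ c₂ : V) : Set₁ where
  field
    p₁ q₁ p₂ q₂ : V
    pair₁       : c₁ ≈ ⟨ p₁ , q₁ ⟩
    pair₂       : c₂ ≈ ⟨ p₂ , q₂ ⟩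
    dom-⊇       : dom p₂ ⊆ dom p₁
    p-⊇         : ∀ α → α ∈ dom p₂ → p₂ ′ α ⊆ p₁ ′ α
    q-⊇         : q₂ ⊆ q₁

-- Conditions are finite objects built from elements of κ ∈ M, so ℙ is the same
-- set whether it is computed in V or in M.
IsHechlerPoset : V → V → Set₁
IsHechlerPoset κ ℙ = ∀ c → c ∈ ℙ ⇔ IsCondition κ c

Dense : V → V → Set₁
Dense ℙ D = D ⊆ ℙ × (∀ c → c ∈ ℙ → Σ V λ d → d ∈ D × d ≤ c)

record Generic (M ℙ G : V) : Set₁ where
  field
    subset   : G ⊆ ℙ
    nonempty : Σ V λ c → c ∈ G
    upward   : ∀ c d → c ∈ G → d ∈ ℙ → c ≤ d → d ∈ G
    directed : ∀ c d → c ∈ G → d ∈ G → Σ V λ e → e ∈ G × e ≤ c × e ≤ d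
    meets    : ∀ D → D ∈ M → Dense ℙ D → Σ V λ c → c ∈ G × c ∈ D

-- τ is a ℙ-name: each element of τ is a pair ⟨ σ , c ⟩ of a ℙ-name σ and some
-- c ∈ ℙ.  As σ ∈ ⋃ (⋃ τ), σ is given by an index there; this keeps the
-- predicate in Set, so that the extension below is an element of V.
data IsName (ℙ τ : V) : Set where
  name : (σ : ix τ → ix (⋃ (⋃ τ))) (c : ix τ → ix ℙ) →
         (∀ i → el τ i ≈ ⟨ el (⋃ (⋃ τ)) (σ i) , el ℙ (c i) ⟩) →
         (∀ i → IsName ℙ (el (⋃ (⋃ τ)) (σ i))) →
         IsName ℙ τ

-- val G τ = { val G σ : ⟨ σ , c ⟩ ∈ τ for some c ∈ G }, by recursion on the
-- derivation that τ is a name (up to ≈ the derivation does not matter).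
val : (G : V) {ℙ τ : V} → IsName ℙ τ → V
val G {ℙ} {τ} (name σ c _ σ-name) =
  sup (Σ (ix τ) λ i → el ℙ (c i) ∈ G) λ (i , _) → val G (σ-name i)

-- M[G]
extension : (M ℙ G : V) → V
extension M ℙ G = sup (Σ (ix M) λ i → IsName ℙ (el M i)) λ (_ , τ) → val G τ

-- 𝕩 G α = ⋃ { p(α) : ∃ q. (p , q) ∈ G };  a p with α ∉ dom p contributes ∅.
𝕩 : V → V → V
𝕩 G α = ⋃ (image (_′ α) (dom G))

𝕒 : V → V → V
𝕒 G α = sep ω λ n → ⟨ n , num 1 ⟩ ∈ 𝕩 G α

-- Characteristic function of b ⊆ ω.  The index set has, for each n, exactly
-- one of the two kinds of proof of Dec (num n ∈ b).
χ : V → V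
χ b = sup (Σ ℕ λ n → Dec (num n ∈ b)) λ (n , d) →
  ⟨ num n , (if does d then num 1 else num 0) ⟩

-- { a_α : α ∈ I } as a subset of 2^ω, subsets of ω being identified with their
-- characteristic functions.
family : V → V → V
family G I = image (λ α → χ (𝕒 G α)) I

2^ω : V → Set₁
2^ω = ω ⟶ (_∈ num 2)

-- N ⊨ "U is an open subset of 2^ω".
record OpenIn (N U : V) : Set₁ where
  field
    inModel : U ∈ N
    points  : ∀ y → y ∈ U → 2^ω y
    open′   : ∀ y → y ∈ U → Σ V λ n → n ∈ ω ×
                (∀ z → z ∈ N → 2^ω z → (∀ i → i ∈ n → y ′ i ≈ z ′ i) → z ∈ U)

-- N ⊨ "X is concentrated on Q".
ConcentratedIn : V → V → V → Set₁
ConcentratedIn N X Q = ∀ U → OpenIn N U → Q ⊆ U → CountableIn N (X ∖ U)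

{-# OPTIONS --safe #-}

-- A condition c is bad for α when c forces a_α ∉ U.  It suffices to show that,
-- below some c₀ ∈ G, the set of those α < ω₁ for which there are bad conditions
-- is countable in M: an enumeration of it in M then yields a name for an
-- injection of { a_α : a_α ∉ U } into ω.
--
-- As U is open and contains all a_m, m < ω, the condition c₀ ∈ G can be chosen
-- so that for every m the conditions e which force [e(m)] ⊆ U are dense below c₀.
-- Suppose that uncountably many α < ω₁ have a bad condition c ≤ c₀.  Countable
-- unions of countable sets are countable in M, so we may bound the size of the
-- conditions; choose a finite r ⊆ ω₁ that is maximal among the sets contained in
-- the domains of uncountably many of them, and thin out further so that the
-- conditions look alike on r ∪ {α}.  Fix one of them, c for α.  Extend it by a row
-- at some new m < ω that copies the row and the links of α, and then to some e
-- that forces [e(m)] ⊆ U.  By maximality of r there is another one, c' for α',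
-- whose domain meets that of e only inside r.  Now e and c' have a common
-- extension in which the row of α' copies e(m): it forces a_α' ∈ U, but it
-- extends c', which is bad for α'.
--
-- The forcing theorem is needed only for equality of names.  Forced equality is
-- the largest "forcing bisimulation", a definition that needs no recursion in M.

module Submission where

open import Defs
open import Axiom.ExcludedMiddle using (ExcludedMiddle)
open import Data.Bool using (Bool; true; false; if_then_else_)
open import Data.Empty using (⊥; ⊥-elim)
open import Data.Fin using (Fin; zero; suc; toℕ; fromℕ<; _↑ˡ_; _↑ʳ_)
open import Data.Fin.Properties using (toℕ<n; toℕ-fromℕ<; injective⇒≤)
open import Data.List using (List; tabulate; lookup; length) renaming (_++_ to _++ˡ_)
open import Data.List.Relation.Unary.Any using (Any; here; there)
import Data.List.Relation.Unary.Any as Any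
import Data.List.Relation.Unary.Any.Properties as Anyₚ
open import Data.Nat using (ℕ; zero; suc; z≤n; s≤s) renaming (_+_ to _+ⁿ_; _≤_ to _≤ⁿ_; _<_ to _<ⁿ_)
import Data.Nat.Properties as ℕₚ
open import Data.Product using (Σ; _×_; _,_; proj₁; proj₂)
open import Data.Sum using (_⊎_; inj₁; inj₂; [_,_]; [_,_]′)
open import Data.Unit using (⊤; tt)
open import Data.Vec.Functional using (_∷_; []; _++_)
open import Data.Vec.Functional.Properties using (lookup-++ˡ; lookup-++ʳ)
open import Function.Base using (_∘′_)
open import Function.Bundles using (_⇔_; mk⇔; Equivalence)
open import Level using (Level; _⊔_; 0ℓ; Lift; lift; lower) renaming (suc to lsuc)
open import Relation.Binary.Definitions using (tri<; tri≈; tri>)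
open import Relation.Binary.PropositionalEquality using (_≡_; refl; sym; trans; cong; subst)
open import Relation.Nullary using (¬_; Dec; yes; no; does)
open import Relation.Nullary.Decidable using (True; toWitness; fromWitness; dec-true; dec-false)

open Equivalence


-- Sets up to bisimilarity

-- Agda cannot infer x and y from the unfolding types x ≈ y and x ∈ y, hence
-- these record versions.
infix 4 _≋_ _∊_

-- The obstacle is that whatever is handed to genericity or to an axiom of `M` must be an element of
-- `M`, while the combinatorics is easiest outside. Two devices separate the two. Smallness of a
-- class asks only for an enumeration in `M` of a superset, so the classes that get thinned out may
-- be arbitrary classes of `V`, and no Δ-system is sought inside `M`. And formulas with constants
-- evaluate to ordinary statements, so a set of `M` is obtained by writing down its definition once.
--
-- Badness is expressed negatively: no extension forces the name of a_α to equal an element of the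
-- name of U. Goodness of a condition then speaks only of the generic reals, and the openness of U
-- enters at one point, where a neighbourhood of a_k is played against a bad condition in G.
--
-- The amalgamation succeeds for the following reason. A link only limits the common elements of two
-- sets from some column on. In the columns that e adds, rows outside dom e other than α' are filled
-- with zeros, which satisfies their links; the links of α' into dom e end in the root and are
-- mirrored by links of m, which e already respects.

record _≋_ (x y : V) : Set where
  constructor ≋-in
  field ≋-out : x ≈ y

record _∊_ (x y : V) : Set where
  constructor ∊-in
  field ∊-out : x ∈ y

open _≋_ public
open _∊_ public

opaque

  ≈-refl : ∀ x → x ≈ x
  ≈-refl (sup A f) = (λ a → a , ≈-refl (f a)) , (λ a → a , ≈-refl (f a))

  ≈-sym : ∀ x y → x ≈ y → y ≈ x
  ≈-sym (sup A f) (sup B g) (l , r) =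
    (λ b → let a , p = r b in a , ≈-sym (f a) (g b) p) ,
    (λ a → let b , p = l a in b , ≈-sym (f a) (g b) p)

  ≈-trans : ∀ x y z → x ≈ y → y ≈ z → x ≈ z
  ≈-trans (sup A f) (sup B g) (sup C h) (l , r) (l' , r') =
    (λ a → let b , p = l a ; c , q = l' b in c , ≈-trans (f a) (g b) (h c) p q) ,
    (λ c → let b , q = r' c ; a , p = r b in a , ≈-trans (f a) (g b) (h c) p q)

  ≋-refl : ∀ {x} → x ≋ x
  ≋-refl {x} = ≋-in (≈-refl x)

  ≋-sym : ∀ {x y} → x ≋ y → y ≋ x
  ≋-sym {x} {y} (≋-in p) = ≋-in (≈-sym x y p)

  ≋-trans : ∀ {x y z} → x ≋ y → y ≋ z → x ≋ z
  ≋-trans {x} {y} {z} (≋-in p) (≋-in q) = ≋-in (≈-trans x y z p q)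

  ≡⇒≋ : ∀ {x y} → x ≡ y → x ≋ y
  ≡⇒≋ refl = ≋-refl

  el∊ : ∀ x i → el x i ∊ x
  el∊ x i = ∊-in (i , ≈-refl (el x i))

  index : ∀ {x y} → x ∊ y → Σ (ix y) λ i → x ≋ el y i
  index (∊-in (i , p)) = i , ≋-in p

  ∊-index : ∀ {x y} (i : ix y) → x ≋ el y i → x ∊ y
  ∊-index i (≋-in p) = ∊-in (i , p)

  ∊-respˡ : ∀ {x x' y} → x ≋ x' → x ∊ y → x' ∊ y
  ∊-respˡ p q = let i , r = index q in ∊-index i (≋-trans (≋-sym p) r)

private
  elsʳ : ∀ x y → x ≈ y → ∀ i → Σ (ix y) λ j → el x i ≈ el y j
  elsʳ (sup A f) (sup B g) (l , r) = l

opaque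

  ∊-respʳ : ∀ {x y y'} → y ≋ y' → x ∊ y → x ∊ y'
  ∊-respʳ {x} {y} {y'} (≋-in p) q =
    let i , r = index q ; j , s = elsʳ y y' p i in ∊-index j (≋-trans r (≋-in s))

  ∊-resp : ∀ {x x' y y'} → x ≋ x' → y ≋ y' → x ∊ y → x' ∊ y'
  ∊-resp p q r = ∊-respˡ p (∊-respʳ q r)

  ≋-ext : ∀ {x y} → (∀ z → z ∊ x → z ∊ y) → (∀ z → z ∊ y → z ∊ x) → x ≋ y
  ≋-ext {x@(sup A f)} {y@(sup B g)} l r = ≋-in
    ( (λ a → let b , p = index (l (f a) (el∊ x a)) in b , ≋-out p)
    , (λ b → let a , p = index (r (g b) (el∊ y b)) in a , ≋-out (≋-sym p)))

  -- Structural recursion only reaches the subtrees of a tree, not the sets bisimilar to them. So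
  -- the recursion runs on `x`, while the set for which `P` is proved is any `y ≋ x`.
  ∊-induction : ∀ {ℓ} (P : V → Set ℓ) → (∀ x → (∀ y → y ∊ x → P y) → P x) → ∀ x → P x
  ∊-induction P step x = below x x ≋-refl
    where
    below : ∀ x y → y ≋ x → P y
    below x@(sup A f) y y≋x = step y λ z z∊y →
      let i , p = index (∊-respʳ y≋x z∊y) in below (f i) z p

  ∊-irrefl : ∀ x → ¬ (x ∊ x)
  ∊-irrefl = ∊-induction (λ x → ¬ (x ∊ x)) λ x ih x∊x → ih x x∊x x∊x

-- Pairs and unions

opaque

  ∅-empty : ∀ {x} → ¬ (x ∊ ∅)
  ∅-empty (∊-in (() , _))

  ∊⁅⁆⁻ : ∀ {x y z} → z ∊ ⁅ x , y ⁆ → z ≋ x ⊎ z ≋ y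
  ∊⁅⁆⁻ (∊-in (true , p))  = inj₁ (≋-in p)
  ∊⁅⁆⁻ (∊-in (false , p)) = inj₂ (≋-in p)

  ∊⁅⁆ˡ : ∀ {x y z} → z ≋ x → z ∊ ⁅ x , y ⁆
  ∊⁅⁆ˡ = ∊-index true

  ∊⁅⁆ʳ : ∀ {x y z} → z ≋ y → z ∊ ⁅ x , y ⁆
  ∊⁅⁆ʳ = ∊-index false

  ⁅⁆-cong : ∀ {x x' y y'} → x ≋ x' → y ≋ y' → ⁅ x , y ⁆ ≋ ⁅ x' , y' ⁆
  ⁅⁆-cong p q = ≋-ext
    (λ z r → [ (λ s → ∊⁅⁆ˡ (≋-trans s p)) , (λ s → ∊⁅⁆ʳ (≋-trans s q)) ]′ (∊⁅⁆⁻ r))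
    (λ z r → [ (λ s → ∊⁅⁆ˡ (≋-trans s (≋-sym p))) , (λ s → ∊⁅⁆ʳ (≋-trans s (≋-sym q))) ]′ (∊⁅⁆⁻ r))

  ⁅⁆-comm : ∀ {x y} → ⁅ x , y ⁆ ≋ ⁅ y , x ⁆
  ⁅⁆-comm = ≋-ext
    (λ z r → [ ∊⁅⁆ʳ , ∊⁅⁆ˡ ]′ (∊⁅⁆⁻ r))
    (λ z r → [ ∊⁅⁆ʳ , ∊⁅⁆ˡ ]′ (∊⁅⁆⁻ r))

  ⁅⁆-injective : ∀ {a b c d} → ⁅ a , b ⁆ ≋ ⁅ c , d ⁆ → (a ≋ c × b ≋ d) ⊎ (a ≋ d × b ≋ c)
  ⁅⁆-injective {a} {b} {c} {d} p with ∊⁅⁆⁻ (∊-respʳ p (∊⁅⁆ˡ ≋-refl)) | ∊⁅⁆⁻ (∊-respʳ p (∊⁅⁆ʳ ≋-refl))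
  ... | inj₁ a≋c | inj₂ b≋d = inj₁ (a≋c , b≋d)
  ... | inj₂ a≋d | inj₁ b≋c = inj₂ (a≋d , b≋c)
  ... | inj₁ a≋c | inj₁ b≋c = inj₁ (a≋c ,
    [ (λ d≋a → ≋-trans b≋c (≋-trans (≋-sym a≋c) (≋-sym d≋a))) , ≋-sym ]′
      (∊⁅⁆⁻ (∊-respʳ (≋-sym p) (∊⁅⁆ʳ ≋-refl))))
  ... | inj₂ a≋d | inj₂ b≋d = inj₂ (a≋d ,
    [ (λ c≋a → ≋-trans b≋d (≋-trans (≋-sym a≋d) (≋-sym c≋a))) , ≋-sym ]′
      (∊⁅⁆⁻ (∊-respʳ (≋-sym p) (∊⁅⁆ˡ ≋-refl))))

  ⟨⟩-cong : ∀ {x x' y y'} → x ≋ x' → y ≋ y' → ⟨ x , y ⟩ ≋ ⟨ x' , y' ⟩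
  ⟨⟩-cong p q = ⁅⁆-cong (⁅⁆-cong p p) (⁅⁆-cong p q)

  ⟨⟩-injective : ∀ {a b c d} → ⟨ a , b ⟩ ≋ ⟨ c , d ⟩ → a ≋ c × b ≋ d
  ⟨⟩-injective p with ⁅⁆-injective p
  ... | inj₁ (s , t) with proj₁ (same s)
    where same : ∀ {a c} → ⁅ a , a ⁆ ≋ ⁅ c , c ⁆ → a ≋ c × a ≋ c
          same s = [ (λ z → z) , (λ z → z) ]′ (⁅⁆-injective s)
  ...   | a≋c with ⁅⁆-injective t
  ...     | inj₁ (_ , b≋d) = a≋c , b≋d
  ...     | inj₂ (a≋d , b≋c) = a≋c , ≋-trans b≋c (≋-trans (≋-sym a≋c) a≋d)
  ⟨⟩-injective p | inj₂ (s , t) with ⁅⁆-injective s | ⁅⁆-injective t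
  ... | inj₁ (a≋c , a≋d) | inj₁ (_ , b≋c) = a≋c , ≋-trans b≋c (≋-trans (≋-sym a≋c) a≋d)
  ... | inj₁ (a≋c , a≋d) | inj₂ (_ , b≋c) = a≋c , ≋-trans b≋c (≋-trans (≋-sym a≋c) a≋d)
  ... | inj₂ (a≋d , a≋c) | inj₁ (_ , b≋c) = a≋c , ≋-trans b≋c (≋-trans (≋-sym a≋c) a≋d)
  ... | inj₂ (a≋d , a≋c) | inj₂ (_ , b≋c) = a≋c , ≋-trans b≋c (≋-trans (≋-sym a≋c) a≋d)

  ∊⋃⁻ : ∀ {x z} → z ∊ ⋃ x → Σ V λ y → y ∊ x × z ∊ y
  ∊⋃⁻ {x} (∊-in ((i , j) , p)) = el x i , el∊ x i , ∊-in (j , p)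

  ∊⋃⁺ : ∀ {x y z} → y ∊ x → z ∊ y → z ∊ ⋃ x
  ∊⋃⁺ y∊x z∊y = let i , p = index y∊x ; j , q = index (∊-respʳ p z∊y) in ∊-index (i , j) q

-- An opaque copy of ⋃: the argument of ⋃ cannot be inferred, as ⋃ unfolds.
opaque

  Union : V → V
  Union x = ⋃ x

  Union≋⋃ : ∀ {x} → Union x ≋ ⋃ x
  Union≋⋃ = ≋-refl

  ∊Union⁻ : ∀ {x z} → z ∊ Union x → Σ V λ y → y ∊ x × z ∊ y
  ∊Union⁻ {x} = ∊⋃⁻ {x}

  ∊Union⁺ : ∀ {x y z} → y ∊ x → z ∊ y → z ∊ Union x
  ∊Union⁺ = ∊⋃⁺

  Union-cong : ∀ {x y} → x ≋ y → Union x ≋ Union y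
  Union-cong p = ≋-ext
    (λ z r → let w , s , t = ∊Union⁻ r in ∊Union⁺ (∊-respʳ p s) t)
    (λ z r → let w , s , t = ∊Union⁻ r in ∊Union⁺ (∊-respʳ (≋-sym p) s) t)

infixl 6 _∪_
_∪_ : V → V → V
x ∪ y = Union ⁅ x , y ⁆

opaque

  ∊∪ˡ : ∀ {x y z} → z ∊ x → z ∊ x ∪ y
  ∊∪ˡ = ∊Union⁺ (∊⁅⁆ˡ ≋-refl)

  ∊∪ʳ : ∀ {x y z} → z ∊ y → z ∊ x ∪ y
  ∊∪ʳ = ∊Union⁺ (∊⁅⁆ʳ ≋-refl)

  ∊∪⁻ : ∀ {x y z} → z ∊ x ∪ y → z ∊ x ⊎ z ∊ y
  ∊∪⁻ p with ∊Union⁻ p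
  ... | w , q , r = [ (λ s → inj₁ (∊-respʳ s r)) , (λ s → inj₂ (∊-respʳ s r)) ]′ (∊⁅⁆⁻ q)

S : V → V
S x = x ∪ ⁅ x , x ⁆

opaque

  S-cong : ∀ {x y} → x ≋ y → S x ≋ S y
  S-cong p = Union-cong (⁅⁆-cong p (⁅⁆-cong p p))

  ∊⁅⁆₁ : ∀ {x z} → z ∊ ⁅ x , x ⁆ → z ≋ x
  ∊⁅⁆₁ p = [ (λ q → q) , (λ q → q) ]′ (∊⁅⁆⁻ p)

  ∊⋃⋃ˡ : ∀ {x y f} → ⟨ x , y ⟩ ∊ f → x ∊ ⋃ (⋃ f)
  ∊⋃⋃ˡ {f = f} p = ∊⋃⁺ {⋃ f} (∊⋃⁺ {f} p (∊⁅⁆ˡ ≋-refl)) (∊⁅⁆ˡ ≋-refl)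

  ∊⋃⋃ʳ : ∀ {x y f} → ⟨ x , y ⟩ ∊ f → y ∊ ⋃ (⋃ f)
  ∊⋃⋃ʳ {f = f} p = ∊⋃⁺ {⋃ f} (∊⋃⁺ {f} p (∊⁅⁆ʳ ≋-refl)) (∊⁅⁆ʳ ≋-refl)

  ∊Union²ʳ : ∀ {x y f} → ⟨ x , y ⟩ ∊ f → y ∊ Union (Union f)
  ∊Union²ʳ p = ∊Union⁺ (∊Union⁺ p (∊⁅⁆ʳ ≋-refl)) (∊⁅⁆ʳ ≋-refl)

opaque

  -- Besides being the set whose union is `f ′ x`, a fibre of one fixed set in `M` will serve as the
  -- name of each generic real.
  fibre : V → V → V
  fibre f x = sep (⋃ (⋃ f)) λ y → ⟨ x , y ⟩ ∈ f

  ∊fibre⁺ : ∀ {f x y} → ⟨ x , y ⟩ ∊ f → y ∊ fibre f x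
  ∊fibre⁺ {f} p = let i , q = index (∊⋃⋃ʳ p) in
    ∊-index {y = fibre f _} (i , ∊-out {y = f} (∊-respˡ (⟨⟩-cong ≋-refl q) p)) q

  ∊fibre⁻ : ∀ {f x y} → y ∊ fibre f x → ⟨ x , y ⟩ ∊ f
  ∊fibre⁻ {f} (∊-in ((i , q) , p)) = ∊-respˡ (⟨⟩-cong ≋-refl (≋-sym (≋-in p))) (∊-in {y = f} q)

  fibre-cong : ∀ {f f' x x'} → f ≋ f' → x ≋ x' → fibre f x ≋ fibre f' x'
  fibre-cong p q = ≋-ext
    (λ z r → ∊fibre⁺ (∊-resp (⟨⟩-cong q ≋-refl) p (∊fibre⁻ r)))
    (λ z r → ∊fibre⁺ (∊-resp (⟨⟩-cong (≋-sym q) ≋-refl) (≋-sym p) (∊fibre⁻ r)))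

SingleValued : V → Set₁
SingleValued f = ∀ x y y' → ⟨ x , y ⟩ ∊ f → ⟨ x , y' ⟩ ∊ f → y ≋ y'

opaque
  unfolding fibre

  ∊′⁻ : ∀ {f x z} → z ∊ f ′ x → Σ V λ y → ⟨ x , y ⟩ ∊ f × z ∊ y
  ∊′⁻ {f} {x} r = let w , s , t = ∊⋃⁻ r in w , ∊fibre⁻ {f} {x} s , t

  ∊′⁺ : ∀ {f x y z} → ⟨ x , y ⟩ ∊ f → z ∊ y → z ∊ f ′ x
  ∊′⁺ {f} p = ∊⋃⁺ (∊fibre⁺ {f} p)

  ′-value : ∀ {f x y} → SingleValued f → ⟨ x , y ⟩ ∊ f → f ′ x ≋ y
  ′-value {f} {x} {y} sv p = ≋-ext
    (λ z r → let w , s , t = ∊′⁻ {f} {x} r in ∊-respʳ (sv x w y s p) t)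
    (λ z r → ∊′⁺ p r)

  ′-cong : ∀ {f f' x x'} → f ≋ f' → x ≋ x' → f ′ x ≋ f' ′ x'
  ′-cong {f} {f'} {x} {x'} p q = ≋-ext
    (λ z r → let w , s , t = ∊′⁻ {f} {x} r in ∊′⁺ (∊-resp (⟨⟩-cong q ≋-refl) p s) t)
    (λ z r → let w , s , t = ∊′⁻ {f'} {x'} r in ∊′⁺ (∊-resp (⟨⟩-cong (≋-sym q) ≋-refl) (≋-sym p) s) t)

  ∊dom⁺ : ∀ {f x y} → ⟨ x , y ⟩ ∊ f → x ∊ dom f
  ∊dom⁺ {f} p = let i , q = index (∊⋃⋃ˡ p) ; j , r = index (∊⋃⋃ʳ p) in
    ∊-index {y = dom f} (i , j , ∊-out {y = f} (∊-respˡ (⟨⟩-cong q r) p)) q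

  ∊dom⁻ : ∀ {f x} → x ∊ dom f → Σ V λ y → ⟨ x , y ⟩ ∊ f
  ∊dom⁻ {f} (∊-in ((i , j , q) , p)) =
    el (⋃ (⋃ f)) j , ∊-respˡ (⟨⟩-cong (≋-sym (≋-in p)) ≋-refl) (∊-in {y = f} q)

-- Natural numbers

opaque

  num-suc : ∀ n → num (suc n) ≋ S (num n)
  num-suc n = ≋-sym (Union≋⋃ {⁅ num n , ⁅ num n , num n ⁆ ⁆})

  ∊num : ∀ {k n} → k <ⁿ n → num k ∊ num n
  ∊num {k} {suc n} (s≤s k≤n) with ℕₚ.m≤n⇒m<n∨m≡n k≤n
  ... | inj₁ k<n = ∊-respʳ (≋-sym (num-suc n)) (∊∪ˡ (∊num k<n))
  ... | inj₂ refl = ∊-respʳ (≋-sym (num-suc n)) (∊∪ʳ (∊⁅⁆ˡ ≋-refl))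

  ∊num⁻ : ∀ {n z} → z ∊ num n → Σ ℕ λ k → k <ⁿ n × z ≋ num k
  ∊num⁻ {zero} p = ⊥-elim (∅-empty p)
  ∊num⁻ {suc n} p with ∊∪⁻ (∊-respʳ (num-suc n) p)
  ... | inj₁ q = let k , k<n , r = ∊num⁻ q in k , ℕₚ.m<n⇒m<1+n k<n , r
  ... | inj₂ q = n , ℕₚ.≤-refl , ∊⁅⁆₁ q

  num-injective : ∀ {m n} → num m ≋ num n → m ≡ n
  num-injective {m} {n} p with ℕₚ.<-cmp m n
  ... | tri< m<n _ _ = ⊥-elim (∊-irrefl _ (∊-respʳ (≋-sym p) (∊num m<n)))
  ... | tri≈ _ m≡n _ = m≡n
  ... | tri> _ _ n<m = ⊥-elim (∊-irrefl _ (∊-respʳ p (∊num n<m)))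

  num∊num : ∀ {k n} → num k ∊ num n → k <ⁿ n
  num∊num p with ∊num⁻ p
  ... | j , j<n , q = subst (_<ⁿ _) (sym (num-injective q)) j<n

  -- As an element of `S x`, the set `x` is an element of a numeral and so a numeral itself;
  -- injectivity then reduces to that of `num`.
  S-injective-num : ∀ {x n} → S x ≋ S (num n) → x ≋ num n
  S-injective-num {x} {n} p with ∊num⁻ {suc n} (∊-respʳ (≋-trans p (≋-sym (num-suc n))) (∊∪ʳ {x} (∊⁅⁆ˡ ≋-refl)))
  ... | k , _ , x≋k with num-injective {suc k} {suc n} (≋-trans (num-suc k) (≋-trans (S-cong (≋-sym x≋k)) (≋-trans p (≋-sym (num-suc n)))))
  ...   | refl = x≋k

  num∊ω : ∀ n → num n ∊ ω
  num∊ω n = ∊-index n ≋-refl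

  ∊ω⁻ : ∀ {x} → x ∊ ω → Σ ℕ λ n → x ≋ num n
  ∊ω⁻ = index


infixr 3 _⇔∘_
_⇔∘_ : ∀ {a b c} {A : Set a} {B : Set b} {C : Set c} → A ⇔ B → B ⇔ C → A ⇔ C
p ⇔∘ q = mk⇔ (λ x → to q (to p x)) (λ z → from p (from q z))

module Classical (em : ExcludedMiddle (lsuc 0ℓ)) where

  dec : (P : Set₁) → Dec P
  dec P = em

  dec₀ : (P : Set) → Dec P
  dec₀ P with dec (Lift (lsuc 0ℓ) P)
  ... | yes (lift p) = yes p
  ... | no ¬p = no λ p → ¬p (lift p)

  stable : (P : Set₁) → ¬ ¬ P → P
  stable P ¬¬p with dec P
  ... | yes p = p
  ... | no ¬p = ⊥-elim (¬¬p ¬p)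

  stable₀ : (P : Set) → ¬ ¬ P → P
  stable₀ P ¬¬p with dec₀ P
  ... | yes p = p
  ... | no ¬p = ⊥-elim (¬¬p ¬p)

-- First-order definability over the model

module Model (em : ExcludedMiddle (lsuc 0ℓ)) (M : V) (M-transitive : Transitive M) (zfc : ZFC M) where

  open Classical em
  open ZFC zfc

  opaque

    M-trans : ∀ {x y} → y ∊ M → x ∊ y → x ∊ M
    M-trans {x} {y} (∊-in p) (∊-in q) = ∊-in (M-transitive y x p q)

    el∊M : ∀ i → el M i ∊ M
    el∊M = el∊ M

  infixr 5 _∨̇_ _⇒̇_
  infix 6 ∃̇_
  _∨̇_ _⇒̇_ : ∀ {m} → Formula m → Formula m → Formula m
  φ ∨̇ ψ = ¬̇ (¬̇ φ ∧̇ ¬̇ ψ)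
  φ ⇒̇ ψ = ¬̇ (φ ∧̇ ¬̇ ψ)

  ∃̇_ : ∀ {m} → Formula (suc m) → Formula m
  ∃̇ φ = ¬̇ (∀̇ (¬̇ φ))

  module _ {m} (E : Fin m → ix M) where

    opaque

      ⊨∨ : ∀ φ ψ → (M ⊨ φ [ E ] ⊎ M ⊨ ψ [ E ]) ⇔ M ⊨ φ ∨̇ ψ [ E ]
      ⊨∨ φ ψ = mk⇔ (λ p (q , r) → [ q , r ]′ p) λ p →
        stable₀ _ λ ¬p → p ((λ q → ¬p (inj₁ q)) , (λ q → ¬p (inj₂ q)))

      ⊨⇒ : ∀ φ ψ → (M ⊨ φ [ E ] → M ⊨ ψ [ E ]) ⇔ M ⊨ φ ⇒̇ ψ [ E ]
      ⊨⇒ φ ψ = mk⇔ (λ p (q , r) → r (p q)) λ p q → stable₀ _ λ ¬r → p (q , ¬r)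

      ⊨∃ : ∀ φ → (Σ (ix M) λ x → M ⊨ φ [ x ∷ E ]) ⇔ M ⊨ ∃̇ φ [ E ]
      ⊨∃ φ = mk⇔ (λ (x , p) q → q x p) λ p → stable₀ _ λ ¬q → p (λ x q → ¬q (x , q))

  opaque

    -- The axiom only provides a superset, which separation cuts down. The set obtained has the
    -- right elements among those of `M`; by transitivity it has no others, so it is the pair
    -- computed in `V`.
    ⁅⁆∊M : ∀ {x y} → x ∊ M → y ∊ M → ⁅ x , y ⁆ ∊ M
    ⁅⁆∊M {x} {y} x∊M y∊M =
      let i , x≋i = index x∊M ; j , y≋j = index y∊M
          k , i∈k , j∈k = pairing i j
          E = i ∷ j ∷ []
          φ = (zero ≈̇ suc zero) ∨̇ (zero ≈̇ suc (suc zero))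
          b , b-spec = separation {2} φ E k
      in ∊-index b (≋-ext
        (λ z z∊ → [ (λ p → ∊-respˡ (≋-trans (≋-sym x≋i) (≋-sym p)) (∊-in (from (b-spec i)
                       (i∈k , to (⊨∨ (i ∷ E) (zero ≈̇ suc zero) (zero ≈̇ suc (suc zero))) (inj₁ (≈-refl (el M i)))))))
                  , (λ p → ∊-respˡ (≋-trans (≋-sym y≋j) (≋-sym p)) (∊-in (from (b-spec j)
                       (j∈k , to (⊨∨ (j ∷ E) (zero ≈̇ suc zero) (zero ≈̇ suc (suc zero))) (inj₂ (≈-refl (el M j)))))))
                  ]′ (∊⁅⁆⁻ z∊))
        (λ z z∊b → let l , z≋l = index (M-trans (el∊M b) z∊b) in
          [ (λ p → ∊⁅⁆ˡ (≋-trans z≋l (≋-trans (≋-in p) (≋-sym x≋i))))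
          , (λ p → ∊⁅⁆ʳ (≋-trans z≋l (≋-trans (≋-in p) (≋-sym y≋j)))) ]′
          (from (⊨∨ (l ∷ E) (zero ≈̇ suc zero) (zero ≈̇ suc (suc zero)))
            (proj₂ (to (b-spec l) (∊-out (∊-respˡ z≋l z∊b)))))))

    Union∊M : ∀ {x} → x ∊ M → Union x ∊ M
    Union∊M {x} x∊M =
      let i , x≋i = index x∊M
          u , u-spec = union i
          E = i ∷ []
          φ = ∃̇ ((zero ∈̇ suc (suc zero)) ∧̇ (suc zero ∈̇ zero))
          b , b-spec = separation {1} φ E u
      in ∊-index b (≋-ext
        (λ z z∊ → let y , y∊x , z∊y = ∊Union⁻ z∊
                      j , y≋j = index (M-trans x∊M y∊x)
                      k , z≋k = index (M-trans (M-trans x∊M y∊x) z∊y)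
                      k∈j = ∊-out (∊-resp z≋k y≋j z∊y)
                      j∈i = ∊-out (∊-resp y≋j x≋i y∊x)
                  in ∊-respˡ (≋-sym z≋k) (∊-in (from (b-spec k)
                       (u-spec j k k∈j j∈i , λ n → n j (j∈i , k∈j)))))
        (λ z z∊b → let l , z≋l = index (M-trans (el∊M b) z∊b)
                       y , y∈i , l∈y = from (⊨∃ (l ∷ E) ((zero ∈̇ suc (suc zero)) ∧̇ (suc zero ∈̇ zero)))
                                         (proj₂ (to (b-spec l) (∊-out (∊-respˡ z≋l z∊b))))
                   in ∊Union⁺ (∊-respʳ (≋-sym x≋i) (∊-in y∈i)) (∊-respˡ (≋-sym z≋l) (∊-in l∈y))))

    ⟨⟩∊M : ∀ {x y} → x ∊ M → y ∊ M → ⟨ x , y ⟩ ∊ M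
    ⟨⟩∊M p q = ⁅⁆∊M (⁅⁆∊M p p) (⁅⁆∊M p q)

    ⟨⟩∊M⁻ : ∀ {x y} → ⟨ x , y ⟩ ∊ M → x ∊ M × y ∊ M
    ⟨⟩∊M⁻ p = let q = M-trans p (∊⁅⁆ʳ ≋-refl) in M-trans q (∊⁅⁆ˡ ≋-refl) , M-trans q (∊⁅⁆ʳ ≋-refl)

  -- Formulas with terms for pairs and unions and with constants from M

  infix 8 _∈ᶠ_ _≈ᶠ_
  infix 7 ¬ᶠ_
  infixr 6 _∧ᶠ_
  infixr 5 _∨ᶠ_
  infixr 4 _⇒ᶠ_

  data Tm (n : ℕ) : Set₁ where
    var  : Fin n → Tm n
    con  : (v : V) → v ∊ M → Tm n
    ⁅_,_⁆ᵗ : Tm n → Tm n → Tm n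
    ⋃ᵗ   : Tm n → Tm n

  ⟨_,_⟩ᵗ : ∀ {n} → Tm n → Tm n → Tm n
  ⟨ s , t ⟩ᵗ = ⁅ ⁅ s , s ⁆ᵗ , ⁅ s , t ⁆ᵗ ⁆ᵗ

  data Fm (n : ℕ) : Set₁ where
    _∈ᶠ_ _≈ᶠ_      : Tm n → Tm n → Fm n
    ¬ᶠ_            : Fm n → Fm n
    _∧ᶠ_ _∨ᶠ_ _⇒ᶠ_ : Fm n → Fm n → Fm n
    ∀ᶠ ∃ᶠ          : Fm (suc n) → Fm n
    ∀ᶠ∈ ∃ᶠ∈        : Tm n → Fm (suc n) → Fm n

  ⟦_⟧ᵗ : ∀ {n} → Tm n → (Fin n → V) → V
  ⟦ var i ⟧ᵗ e = e i
  ⟦ con v _ ⟧ᵗ e = v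
  ⟦ ⁅ s , t ⁆ᵗ ⟧ᵗ e = ⁅ ⟦ s ⟧ᵗ e , ⟦ t ⟧ᵗ e ⁆
  ⟦ ⋃ᵗ t ⟧ᵗ e = Union (⟦ t ⟧ᵗ e)

  -- Quantifiers range over `V` and raise the universe level, atoms do not. Computing the level from
  -- the formula lets `⟦_⟧` be the plain Agda statement, without lifting.
  level : ∀ {n} → Fm n → Level
  level (_ ∈ᶠ _) = 0ℓ
  level (_ ≈ᶠ _) = 0ℓ
  level (¬ᶠ φ) = level φ
  level (φ ∧ᶠ ψ) = level φ ⊔ level ψ
  level (φ ∨ᶠ ψ) = level φ ⊔ level ψ
  level (φ ⇒ᶠ ψ) = level φ ⊔ level ψ
  level (∀ᶠ φ) = lsuc 0ℓ ⊔ level φ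
  level (∃ᶠ φ) = lsuc 0ℓ ⊔ level φ
  level (∀ᶠ∈ _ φ) = lsuc 0ℓ ⊔ level φ
  level (∃ᶠ∈ _ φ) = lsuc 0ℓ ⊔ level φ

  ⟦_⟧ : ∀ {n} (φ : Fm n) → (Fin n → V) → Set (level φ)
  ⟦ s ∈ᶠ t ⟧ e = ⟦ s ⟧ᵗ e ∊ ⟦ t ⟧ᵗ e
  ⟦ s ≈ᶠ t ⟧ e = ⟦ s ⟧ᵗ e ≋ ⟦ t ⟧ᵗ e
  ⟦ ¬ᶠ φ ⟧ e = ¬ ⟦ φ ⟧ e
  ⟦ φ ∧ᶠ ψ ⟧ e = ⟦ φ ⟧ e × ⟦ ψ ⟧ e
  ⟦ φ ∨ᶠ ψ ⟧ e = ⟦ φ ⟧ e ⊎ ⟦ ψ ⟧ e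
  ⟦ φ ⇒ᶠ ψ ⟧ e = ⟦ φ ⟧ e → ⟦ ψ ⟧ e
  ⟦ ∀ᶠ φ ⟧ e = ∀ x → x ∊ M → ⟦ φ ⟧ (x ∷ e)
  ⟦ ∃ᶠ φ ⟧ e = Σ V λ x → x ∊ M × ⟦ φ ⟧ (x ∷ e)
  ⟦ ∀ᶠ∈ t φ ⟧ e = ∀ x → x ∊ ⟦ t ⟧ᵗ e → ⟦ φ ⟧ (x ∷ e)
  ⟦ ∃ᶠ∈ t φ ⟧ e = Σ V λ x → x ∊ ⟦ t ⟧ᵗ e × ⟦ φ ⟧ (x ∷ e)

  infix 4 _⇔ᶠ_
  _⇔ᶠ_ : ∀ {n} → Fm n → Fm n → Fm n
  φ ⇔ᶠ ψ = (φ ⇒ᶠ ψ) ∧ᶠ (ψ ⇒ᶠ φ)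

  -- Occurrences of constants, and the values there.

  Constᵗ : ∀ {n} → Tm n → Set
  Constᵗ (var _) = ⊥
  Constᵗ (con _ _) = ⊤
  Constᵗ ⁅ s , t ⁆ᵗ = Constᵗ s ⊎ Constᵗ t
  Constᵗ (⋃ᵗ t) = Constᵗ t

  Const : ∀ {n} → Fm n → Set
  Const (s ∈ᶠ t) = Constᵗ s ⊎ Constᵗ t
  Const (s ≈ᶠ t) = Constᵗ s ⊎ Constᵗ t
  Const (¬ᶠ φ) = Const φ
  Const (φ ∧ᶠ ψ) = Const φ ⊎ Const ψ
  Const (φ ∨ᶠ ψ) = Const φ ⊎ Const ψ
  Const (φ ⇒ᶠ ψ) = Const φ ⊎ Const ψ
  Const (∀ᶠ φ) = Const φ
  Const (∃ᶠ φ) = Const φ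
  Const (∀ᶠ∈ t φ) = Constᵗ t ⊎ Const φ
  Const (∃ᶠ∈ t φ) = Constᵗ t ⊎ Const φ

  valueᵗ : ∀ {n} (t : Tm n) → Constᵗ t → ix M
  valueᵗ (con v v∊M) tt = proj₁ (index v∊M)
  valueᵗ ⁅ s , t ⁆ᵗ = [ valueᵗ s , valueᵗ t ]′
  valueᵗ (⋃ᵗ t) = valueᵗ t

  value : ∀ {n} (φ : Fm n) → Const φ → ix M
  value (s ∈ᶠ t) = [ valueᵗ s , valueᵗ t ]′
  value (s ≈ᶠ t) = [ valueᵗ s , valueᵗ t ]′
  value (¬ᶠ φ) = value φ
  value (φ ∧ᶠ ψ) = [ value φ , value ψ ]′
  value (φ ∨ᶠ ψ) = [ value φ , value ψ ]′
  value (φ ⇒ᶠ ψ) = [ value φ , value ψ ]′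
  value (∀ᶠ φ) = value φ
  value (∃ᶠ φ) = value φ
  value (∀ᶠ∈ t φ) = [ valueᵗ t , value φ ]′
  value (∃ᶠ∈ t φ) = [ valueᵗ t , value φ ]′

  -- `Formula` has no constants, but the schemes allow finitely many parameters. Numbering the
  -- occurrences of constants turns them into such parameters.
  Listing : {C : Set} → (C → ix M) → Set
  Listing {C} v = Σ ℕ λ k → Σ (C → Fin k) λ pos → Σ (Fin k → ix M) λ ρ → ∀ c → ρ (pos c) ≡ v c

  list-⊎ : {C D : Set} {v : C → ix M} {w : D → ix M} → Listing v → Listing w → Listing [ v , w ]′
  list-⊎ (k , pos , ρ , ok) (k' , pos' , ρ' , ok') =
    k +ⁿ k' , [ (λ c → pos c ↑ˡ k') , (λ d → k ↑ʳ pos' d) ]′ , ρ ++ ρ' ,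
    [ (λ c → trans (lookup-++ˡ ρ ρ' (pos c)) (ok c)) , (λ d → trans (lookup-++ʳ ρ ρ' (pos' d)) (ok' d)) ]

  listᵗ : ∀ {n} (t : Tm n) → Listing (valueᵗ t)
  listᵗ (var _) = 0 , (λ ()) , (λ ()) , λ ()
  listᵗ (con v v∊M) = 1 , (λ _ → zero) , (λ _ → proj₁ (index v∊M)) , λ _ → refl
  listᵗ ⁅ s , t ⁆ᵗ = list-⊎ (listᵗ s) (listᵗ t)
  listᵗ (⋃ᵗ t) = listᵗ t

  listᶠ : ∀ {n} (φ : Fm n) → Listing (value φ)
  listᶠ (s ∈ᶠ t) = list-⊎ (listᵗ s) (listᵗ t)
  listᶠ (s ≈ᶠ t) = list-⊎ (listᵗ s) (listᵗ t)
  listᶠ (¬ᶠ φ) = listᶠ φ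
  listᶠ (φ ∧ᶠ ψ) = list-⊎ (listᶠ φ) (listᶠ ψ)
  listᶠ (φ ∨ᶠ ψ) = list-⊎ (listᶠ φ) (listᶠ ψ)
  listᶠ (φ ⇒ᶠ ψ) = list-⊎ (listᶠ φ) (listᶠ ψ)
  listᶠ (∀ᶠ φ) = listᶠ φ
  listᶠ (∃ᶠ φ) = listᶠ φ
  listᶠ (∀ᶠ∈ t φ) = list-⊎ (listᵗ t) (listᶠ φ)
  listᶠ (∃ᶠ∈ t φ) = list-⊎ (listᵗ t) (listᶠ φ)

  infix 4 _≋[_]_
  _≋[_]_ : ∀ {n m} → (Fin n → V) → (Fin n → Fin m) → (Fin m → ix M) → Set
  e ≋[ f ] E = ∀ j → e j ≋ el M (E (f j))

  liftᵛ : ∀ {n m} → (Fin n → Fin m) → Fin (suc n) → Fin (suc m)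
  liftᵛ f = zero ∷ (suc ∘′ f)

  opaque

    ≋-lift : ∀ {n m} {e : Fin n → V} {f : Fin n → Fin m} {E x i} →
             x ≋ el M i → e ≋[ f ] E → (x ∷ e) ≋[ liftᵛ f ] (i ∷ E)
    ≋-lift p q zero = p
    ≋-lift p q (suc j) = q j

    ⟦⟧ᵗ∊M : ∀ {n} {e : Fin n → V} (t : Tm n) → (∀ j → e j ∊ M) → ⟦ t ⟧ᵗ e ∊ M
    ⟦⟧ᵗ∊M (var j) p = p j
    ⟦⟧ᵗ∊M (con v v∊M) p = v∊M
    ⟦⟧ᵗ∊M ⁅ s , t ⁆ᵗ p = ⁅⁆∊M (⟦⟧ᵗ∊M s p) (⟦⟧ᵗ∊M t p)
    ⟦⟧ᵗ∊M (⋃ᵗ t) p = Union∊M (⟦⟧ᵗ∊M t p)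

  Agree : ∀ {m} {C : Set} → (C → ix M) → (C → Fin m) → (Fin m → ix M) → Set
  Agree v g E = ∀ c → el M (v c) ≋ el M (E (g c))

  opaque

    -- `Formula` has no compound terms either, so "variable `v` is the value of `t`" is compiled
    -- into a formula, with existential quantifiers for the values of subterms. These witnesses
    -- exist because `M` is closed under pairs and unions.
    is : ∀ {n m} (t : Tm n) (f : Fin n → Fin m) (g : Constᵗ t → Fin m) (v : Fin m) →
         Σ (Formula m) λ φ → ∀ {e E} → e ≋[ f ] E → Agree (valueᵗ t) g E →
           (el M (E v) ≋ ⟦ t ⟧ᵗ e) ⇔ M ⊨ φ [ E ]
    is (var j) f g v = (v ≈̇ f j) , λ e≋ _ →
      mk⇔ (λ p → ≋-out (≋-trans p (e≋ j))) (λ p → ≋-trans (≋-in p) (≋-sym (e≋ j)))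
    is (con x x∊M) f g v = (v ≈̇ g tt) , λ _ ag →
      let x≋ = ≋-trans (proj₂ (index x∊M)) (ag tt) in
      mk⇔ (λ p → ≋-out (≋-trans p x≋)) (λ p → ≋-trans (≋-in p) (≋-sym x≋))
    is {n} {m} ⁅ s , t ⁆ᵗ f g v
      with is s (suc ∘′ suc ∘′ f) (suc ∘′ suc ∘′ g ∘′ inj₁) (suc zero)
         | is t (suc ∘′ suc ∘′ f) (suc ∘′ suc ∘′ g ∘′ inj₂) zero
    ... | φ , φ-ok | ψ , ψ-ok = ∃̇ ∃̇ θ , correct
      where
      δ θ : Formula (suc (suc m))
      δ = ∀̇ (zero ∈̇ suc (suc (suc v)) ⇒̇ (zero ≈̇ suc (suc zero) ∨̇ zero ≈̇ suc zero))
      θ = φ ∧̇ ψ ∧̇ (suc zero ∈̇ suc (suc v)) ∧̇ (zero ∈̇ suc (suc v)) ∧̇ δ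
      correct : ∀ {e E} → e ≋[ f ] E → Agree (valueᵗ ⁅ s , t ⁆ᵗ) g E →
                (el M (E v) ≋ ⁅ ⟦ s ⟧ᵗ e , ⟦ t ⟧ᵗ e ⁆) ⇔ M ⊨ ∃̇ ∃̇ θ [ E ]
      correct {e} {E} e≋ ag =
        mk⇔ (λ p → let i , s≋i = index (⟦⟧ᵗ∊M s (λ j → ∊-index _ (e≋ j))) ; j , t≋j = index (⟦⟧ᵗ∊M t (λ j → ∊-index _ (e≋ j))) in i , j ,
                to (φ-ok {e} {j ∷ i ∷ E} e≋ (λ c → ag (inj₁ c))) (≋-sym s≋i) ,
                to (ψ-ok {e} {j ∷ i ∷ E} e≋ (λ c → ag (inj₂ c))) (≋-sym t≋j) ,
                ∊-out (∊-respʳ (≋-sym p) (∊⁅⁆ˡ (≋-sym s≋i))) ,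
                ∊-out (∊-respʳ (≋-sym p) (∊⁅⁆ʳ (≋-sym t≋j))) ,
                λ k → to (⊨⇒ (k ∷ j ∷ i ∷ E) (zero ∈̇ suc (suc (suc v))) (zero ≈̇ suc (suc zero) ∨̇ zero ≈̇ suc zero)) λ q →
                  to (⊨∨ (k ∷ j ∷ i ∷ E) (zero ≈̇ suc (suc zero)) (zero ≈̇ suc zero))
                  ([ (λ r → inj₁ (≋-out (≋-trans r s≋i))) , (λ r → inj₂ (≋-out (≋-trans r t≋j))) ]′
                  (∊⁅⁆⁻ (∊-respʳ p (∊-in q)))))
            (λ (i , j , p , q , r , r' , d) →
              let i≋s = from (φ-ok {e} {j ∷ i ∷ E} e≋ (λ c → ag (inj₁ c))) p
                  j≋t = from (ψ-ok {e} {j ∷ i ∷ E} e≋ (λ c → ag (inj₂ c))) q in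
              ≋-ext
              (λ z z∊ → let k , z≋k = index (M-trans (el∊M (E v)) z∊) in
                [ (λ a → ∊⁅⁆ˡ (≋-trans z≋k (≋-trans (≋-in a) i≋s)))
                , (λ a → ∊⁅⁆ʳ (≋-trans z≋k (≋-trans (≋-in a) j≋t))) ]′
                (from (⊨∨ (k ∷ j ∷ i ∷ E) (zero ≈̇ suc (suc zero)) (zero ≈̇ suc zero))
                  (from (⊨⇒ (k ∷ j ∷ i ∷ E) (zero ∈̇ suc (suc (suc v))) (zero ≈̇ suc (suc zero) ∨̇ zero ≈̇ suc zero))
                    (d k) (∊-out (∊-respˡ z≋k z∊)))))
              (λ z z∊ → [ (λ a → ∊-respˡ (≋-trans i≋s (≋-sym a)) (∊-in r))
                        , (λ a → ∊-respˡ (≋-trans j≋t (≋-sym a)) (∊-in r')) ]′ (∊⁅⁆⁻ z∊)))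
        ⇔∘ mk⇔ (λ (i , j , p) → i , to (⊨∃ (i ∷ E) θ) (j , p))
                (λ (i , p) → i , from (⊨∃ (i ∷ E) θ) p)
        ⇔∘ ⊨∃ E (∃̇ θ)
    is {n} {m} (⋃ᵗ t) f g v with is t (suc ∘′ f) (suc ∘′ g) zero
    ... | φ , φ-ok = ∃̇ (φ ∧̇ δ₁ ∧̇ δ₂) , correct
      where
      β : Formula (suc (suc (suc m)))
      β = zero ∈̇ suc (suc zero) ∧̇ suc zero ∈̇ zero
      δ₁ δ₂ : Formula (suc m)
      δ₁ = ∀̇ (zero ∈̇ suc (suc v) ⇒̇ ∃̇ β)
      δ₂ = ∀̇ (∃̇ β ⇒̇ zero ∈̇ suc (suc v))
      correct : ∀ {e E} → e ≋[ f ] E → Agree (valueᵗ (⋃ᵗ t)) g E →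
                (el M (E v) ≋ Union (⟦ t ⟧ᵗ e)) ⇔ M ⊨ ∃̇ (φ ∧̇ δ₁ ∧̇ δ₂) [ E ]
      correct {e} {E} e≋ ag =
        mk⇔ (λ p → let i , t≋i = index (⟦⟧ᵗ∊M t (λ j → ∊-index _ (e≋ j))) in i ,
                to (φ-ok {e} {i ∷ E} e≋ ag) (≋-sym t≋i) ,
                (λ k → to (⊨⇒ (k ∷ i ∷ E) (zero ∈̇ suc (suc v)) (∃̇ β)) λ q →
                  let y , y∊ , k∊y = ∊Union⁻ (∊-respʳ p (∊-in q))
                      l , y≋l = index (M-trans (⟦⟧ᵗ∊M t (λ j → ∊-index _ (e≋ j))) y∊)
                  in to (⊨∃ (k ∷ i ∷ E) β) (l , ∊-out (∊-resp y≋l t≋i y∊) , ∊-out (∊-respʳ y≋l k∊y))) ,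
                (λ k → to (⊨⇒ (k ∷ i ∷ E) (∃̇ β) (zero ∈̇ suc (suc v))) λ q →
                  let l , l∈i , k∈l = from (⊨∃ (k ∷ i ∷ E) β) q
                  in ∊-out (∊-respʳ (≋-sym p) (∊Union⁺ (∊-respʳ (≋-sym t≋i) (∊-in l∈i)) (∊-in k∈l)))))
            (λ (i , p , d₁ , d₂) →
              let i≋t = from (φ-ok {e} {i ∷ E} e≋ ag) p in
              ≋-ext
              (λ z z∊ → let k , z≋k = index (M-trans (el∊M (E v)) z∊)
                            l , l∈i , k∈l = from (⊨∃ (k ∷ i ∷ E) β)
                              (from (⊨⇒ (k ∷ i ∷ E) (zero ∈̇ suc (suc v)) (∃̇ β)) (d₁ k) (∊-out (∊-respˡ z≋k z∊)))
                        in ∊-respˡ (≋-sym z≋k) (∊Union⁺ (∊-respʳ i≋t (∊-in l∈i)) (∊-in k∈l)))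
              (λ z z∊ → let y , y∊ , z∊y = ∊Union⁻ z∊
                            l , y≋l = index (M-trans (⟦⟧ᵗ∊M t (λ j → ∊-index _ (e≋ j))) y∊)
                            k , z≋k = index (M-trans (M-trans (⟦⟧ᵗ∊M t (λ j → ∊-index _ (e≋ j))) y∊) z∊y)
                        in ∊-respˡ (≋-sym z≋k) (∊-in (from (⊨⇒ (k ∷ i ∷ E) (∃̇ β) (zero ∈̇ suc (suc v))) (d₂ k)
                             (to (⊨∃ (k ∷ i ∷ E) β) (l , ∊-out (∊-resp y≋l (≋-sym i≋t) y∊) , ∊-out (∊-resp z≋k y≋l z∊y)))))))
        ⇔∘ ⊨∃ E (φ ∧̇ δ₁ ∧̇ δ₂)

    -- Bounded quantifiers of `Fm` range over elements taken in `V`, those of `Formula` over `M`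
    -- only. They agree since the bound denotes an element of the transitive set `M`.
    translate : ∀ {n} (φ : Fm n) {m} (f : Fin n → Fin m) (g : Const φ → Fin m) →
      Σ (Formula m) λ ψ → ∀ {e E} → e ≋[ f ] E → Agree (value φ) g E → ⟦ φ ⟧ e ⇔ M ⊨ ψ [ E ]
    translate (s ∈ᶠ t) f g
      with is s (suc ∘′ suc ∘′ f) (suc ∘′ suc ∘′ g ∘′ inj₁) (suc zero)
         | is t (suc ∘′ suc ∘′ f) (suc ∘′ suc ∘′ g ∘′ inj₂) zero
    ... | φ , φ-ok | ψ , ψ-ok = ∃̇ ∃̇ (φ ∧̇ ψ ∧̇ suc zero ∈̇ zero) , λ {e} {E} e≋ ag →
        mk⇔ (λ p → let i , s≋i = index (⟦⟧ᵗ∊M s (λ j → ∊-index _ (e≋ j))) ; j , t≋j = index (⟦⟧ᵗ∊M t (λ j → ∊-index _ (e≋ j))) in i , j ,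
                to (φ-ok {e} {j ∷ i ∷ E} e≋ (λ c → ag (inj₁ c))) (≋-sym s≋i) ,
                to (ψ-ok {e} {j ∷ i ∷ E} e≋ (λ c → ag (inj₂ c))) (≋-sym t≋j) ,
                ∊-out (∊-resp s≋i t≋j p))
            (λ (i , j , p , q , r) → ∊-resp (from (φ-ok {e} {j ∷ i ∷ E} e≋ (λ c → ag (inj₁ c))) p)
                                            (from (ψ-ok {e} {j ∷ i ∷ E} e≋ (λ c → ag (inj₂ c))) q) (∊-in r))
        ⇔∘ mk⇔ (λ (i , j , p) → i , to (⊨∃ (i ∷ E) (φ ∧̇ ψ ∧̇ suc zero ∈̇ zero)) (j , p))
                (λ (i , p) → i , from (⊨∃ (i ∷ E) (φ ∧̇ ψ ∧̇ suc zero ∈̇ zero)) p)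
        ⇔∘ ⊨∃ E (∃̇ (φ ∧̇ ψ ∧̇ suc zero ∈̇ zero))
    translate (s ≈ᶠ t) f g
      with is s (suc ∘′ f) (suc ∘′ g ∘′ inj₁) zero
         | is t (suc ∘′ f) (suc ∘′ g ∘′ inj₂) zero
    ... | φ , φ-ok | ψ , ψ-ok = ∃̇ (φ ∧̇ ψ) , λ {e} {E} e≋ ag →
        mk⇔ (λ p → let i , s≋i = index (⟦⟧ᵗ∊M s (λ j → ∊-index _ (e≋ j))) in i ,
                to (φ-ok {e} {i ∷ E} e≋ (λ c → ag (inj₁ c))) (≋-sym s≋i) ,
                to (ψ-ok {e} {i ∷ E} e≋ (λ c → ag (inj₂ c))) (≋-trans (≋-sym s≋i) p))
            (λ (i , p , q) → ≋-trans (≋-sym (from (φ-ok {e} {i ∷ E} e≋ (λ c → ag (inj₁ c))) p))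
                                     (from (ψ-ok {e} {i ∷ E} e≋ (λ c → ag (inj₂ c))) q))
        ⇔∘ ⊨∃ E (φ ∧̇ ψ)
    translate (¬ᶠ φ) f g with translate φ f g
    ... | ψ , ok = ¬̇ ψ , λ e≋ ag →
      mk⇔ (λ p q → p (from (ok e≋ ag) q)) (λ p q → p (to (ok e≋ ag) q))
    translate (φ₁ ∧ᶠ φ₂) f g with translate φ₁ f (g ∘′ inj₁) | translate φ₂ f (g ∘′ inj₂)
    ... | ψ₁ , ok₁ | ψ₂ , ok₂ = ψ₁ ∧̇ ψ₂ , λ e≋ ag →
      mk⇔ (λ (p , q) → to (ok₁ e≋ (λ c → ag (inj₁ c))) p , to (ok₂ e≋ (λ c → ag (inj₂ c))) q)
          (λ (p , q) → from (ok₁ e≋ (λ c → ag (inj₁ c))) p , from (ok₂ e≋ (λ c → ag (inj₂ c))) q)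
    translate (φ₁ ∨ᶠ φ₂) f g with translate φ₁ f (g ∘′ inj₁) | translate φ₂ f (g ∘′ inj₂)
    ... | ψ₁ , ok₁ | ψ₂ , ok₂ = ψ₁ ∨̇ ψ₂ , λ {e} {E} e≋ ag →
      mk⇔ [ (λ p → inj₁ (to (ok₁ e≋ (λ c → ag (inj₁ c))) p)) , (λ p → inj₂ (to (ok₂ e≋ (λ c → ag (inj₂ c))) p)) ]′
          [ (λ p → inj₁ (from (ok₁ e≋ (λ c → ag (inj₁ c))) p)) , (λ p → inj₂ (from (ok₂ e≋ (λ c → ag (inj₂ c))) p)) ]′
      ⇔∘ ⊨∨ E ψ₁ ψ₂
    translate (φ₁ ⇒ᶠ φ₂) f g with translate φ₁ f (g ∘′ inj₁) | translate φ₂ f (g ∘′ inj₂)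
    ... | ψ₁ , ok₁ | ψ₂ , ok₂ = ψ₁ ⇒̇ ψ₂ , λ {e} {E} e≋ ag →
      mk⇔ (λ p q → to (ok₂ e≋ (λ c → ag (inj₂ c))) (p (from (ok₁ e≋ (λ c → ag (inj₁ c))) q)))
          (λ p q → from (ok₂ e≋ (λ c → ag (inj₂ c))) (p (to (ok₁ e≋ (λ c → ag (inj₁ c))) q)))
      ⇔∘ ⊨⇒ E ψ₁ ψ₂
    translate (∀ᶠ φ) f g with translate φ (liftᵛ f) (suc ∘′ g)
    ... | ψ , ok = ∀̇ ψ , λ e≋ ag →
      mk⇔ (λ p i → to (ok (≋-lift ≋-refl e≋) ag) (p (el M i) (el∊M i)))
          (λ p x x∊M → let i , x≋i = index x∊M in from (ok (≋-lift x≋i e≋) ag) (p i))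
    translate (∃ᶠ φ) f g with translate φ (liftᵛ f) (suc ∘′ g)
    ... | ψ , ok = ∃̇ ψ , λ {e} {E} e≋ ag →
      mk⇔ (λ (x , x∊M , p) → let i , x≋i = index x∊M in i , to (ok {x ∷ e} {i ∷ E} (≋-lift x≋i e≋) ag) p)
          (λ (i , p) → el M i , el∊M i , from (ok {el M i ∷ e} {i ∷ E} (≋-lift ≋-refl e≋) ag) p)
      ⇔∘ ⊨∃ E ψ
    translate (∀ᶠ∈ t φ) f g
      with is t (suc ∘′ suc ∘′ f) (suc ∘′ suc ∘′ g ∘′ inj₁) zero | translate φ (liftᵛ f) (suc ∘′ g ∘′ inj₂)
    ... | τ , τ-ok | ψ , ok = ∀̇ (∃̇ (τ ∧̇ suc zero ∈̇ zero) ⇒̇ ψ) , λ {e} {E} e≋ ag →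
      mk⇔ (λ p i → to (⊨⇒ (i ∷ E) (∃̇ (τ ∧̇ suc zero ∈̇ zero)) ψ) λ q →
            let j , q₁ , q₂ = from (⊨∃ (i ∷ E) (τ ∧̇ suc zero ∈̇ zero)) q
                j≋t = from (τ-ok {e} {j ∷ i ∷ E} e≋ (λ c → ag (inj₁ c))) q₁
            in to (ok {el M i ∷ e} {i ∷ E} (≋-lift ≋-refl e≋) (λ c → ag (inj₂ c))) (p (el M i) (∊-respʳ j≋t (∊-in q₂))))
          (λ p x x∊t → let j , t≋j = index (⟦⟧ᵗ∊M t (λ j → ∊-index _ (e≋ j)))
                           i , x≋i = index (M-trans (⟦⟧ᵗ∊M t (λ j → ∊-index _ (e≋ j))) x∊t)
            in from (ok {x ∷ e} {i ∷ E} (≋-lift x≋i e≋) (λ c → ag (inj₂ c)))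
               (from (⊨⇒ (i ∷ E) (∃̇ (τ ∧̇ suc zero ∈̇ zero)) ψ) (p i)
                 (to (⊨∃ (i ∷ E) (τ ∧̇ suc zero ∈̇ zero))
                   (j , to (τ-ok {e} {j ∷ i ∷ E} e≋ (λ c → ag (inj₁ c))) (≋-sym t≋j) , ∊-out (∊-resp x≋i t≋j x∊t)))))
    translate (∃ᶠ∈ t φ) f g
      with is t (suc ∘′ suc ∘′ f) (suc ∘′ suc ∘′ g ∘′ inj₁) zero | translate φ (liftᵛ f) (suc ∘′ g ∘′ inj₂)
    ... | τ , τ-ok | ψ , ok = ∃̇ (∃̇ (τ ∧̇ suc zero ∈̇ zero) ∧̇ ψ) , λ {e} {E} e≋ ag →
      mk⇔ (λ (x , x∊t , p) →
            let j , t≋j = index (⟦⟧ᵗ∊M t (λ j → ∊-index _ (e≋ j)))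
                i , x≋i = index (M-trans (⟦⟧ᵗ∊M t (λ j → ∊-index _ (e≋ j))) x∊t)
            in i , to (⊨∃ (i ∷ E) (τ ∧̇ suc zero ∈̇ zero))
                      (j , to (τ-ok {e} {j ∷ i ∷ E} e≋ (λ c → ag (inj₁ c))) (≋-sym t≋j) , ∊-out (∊-resp x≋i t≋j x∊t)) ,
                   to (ok {x ∷ e} {i ∷ E} (≋-lift x≋i e≋) (λ c → ag (inj₂ c))) p)
          (λ (i , q , p) →
            let j , q₁ , q₂ = from (⊨∃ (i ∷ E) (τ ∧̇ suc zero ∈̇ zero)) q
                j≋t = from (τ-ok {e} {j ∷ i ∷ E} e≋ (λ c → ag (inj₁ c))) q₁
            in el M i , ∊-respʳ j≋t (∊-in q₂) ,
               from (ok {el M i ∷ e} {i ∷ E} (≋-lift ≋-refl e≋) (λ c → ag (inj₂ c))) p)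
      ⇔∘ ⊨∃ E (∃̇ (τ ∧̇ suc zero ∈̇ zero) ∧̇ ψ)

  -- Comprehension and replacement in M

  opaque

    separate : ∀ {a} → a ∊ M → (φ : Fm 1) → Σ V λ b → b ∊ M ×
      (∀ {x} → x ∊ b → x ∊ a × ⟦ φ ⟧ (x ∷ [])) × (∀ {x} → x ∊ a → ⟦ φ ⟧ (x ∷ []) → x ∊ b)
    separate {a} a∊M φ =
      let k , pos , ρ , ok = listᶠ φ
          ψ , ψ-ok = translate φ (λ _ → zero) (suc ∘′ pos)
          i , a≋i = index a∊M
          b , b-spec = separation {k} ψ ρ i
          agree = λ c → ≡⇒≋ (cong (el M) (sym (ok c)))
      in el M b , el∊M b ,
         (λ {x} x∊b → let j , x≋j = index (M-trans (el∊M b) x∊b)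
                          p , q = to (b-spec j) (∊-out (∊-respˡ x≋j x∊b))
                      in ∊-resp (≋-sym x≋j) (≋-sym a≋i) (∊-in p) ,
                         from (ψ-ok {x ∷ []} {j ∷ ρ} (λ { zero → x≋j }) agree) q) ,
         (λ {x} x∊a p → let j , x≋j = index (M-trans a∊M x∊a)
                        in ∊-respˡ (≋-sym x≋j) (∊-in (from (b-spec j)
                             (∊-out (∊-resp x≋j a≋i x∊a) , to (ψ-ok {x ∷ []} {j ∷ ρ} (λ { zero → x≋j }) agree) p))))

    -- The scheme wants `φ` total on its domain and returns a superset of the image. So `a` is first
    -- cut down to the arguments that have a value, and the image is cut out of the result. The
    -- translations `ψʳ`, `ψ` and `ψ⁺` arrange the variables for the domain, for the scheme and for
    -- the image.
    replace : ∀ {a} → a ∊ M → (φ : Fm 2) →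
      (∀ x y y' → x ∊ a → y ∊ M → y' ∊ M → ⟦ φ ⟧ (x ∷ y ∷ []) → ⟦ φ ⟧ (x ∷ y' ∷ []) → y ≋ y') →
      Σ V λ b → b ∊ M ×
      (∀ {y} → y ∊ b → Σ V λ x → x ∊ a × ⟦ φ ⟧ (x ∷ y ∷ [])) ×
      (∀ {x y} → x ∊ a → y ∊ M → ⟦ φ ⟧ (x ∷ y ∷ []) → y ∊ b)
    replace {a} a∊M φ functional
      with k , pos , ρ , ok ← listᶠ φ
      with ψ , ψ-ok ← translate φ {suc (suc k)} (zero ∷ suc zero ∷ []) (suc ∘′ suc ∘′ pos)
      with ψʳ , ψʳ-ok ← translate φ {suc (suc k)} (suc zero ∷ zero ∷ []) (suc ∘′ suc ∘′ pos)
      with ψ⁺ , ψ⁺-ok ← translate φ {suc (suc (suc k))} (zero ∷ suc zero ∷ []) (suc ∘′ suc ∘′ suc ∘′ pos)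
      with i , a≋i ← index a∊M
      with d , d-spec ← separation {k} (∃̇ ψʳ) ρ i = result
      where
      agree : ∀ c → el M (value φ c) ≋ el M (ρ (pos c))
      agree c = ≡⇒≋ (cong (el M) (sym (ok c)))
      sat : ∀ {x y l j} → x ≋ el M l → y ≋ el M j → ⟦ φ ⟧ (x ∷ y ∷ []) ⇔ M ⊨ ψ [ l ∷ j ∷ ρ ]
      sat {x} {y} {l} {j} p q = ψ-ok {x ∷ y ∷ []} {l ∷ j ∷ ρ} (λ { zero → p ; (suc zero) → q }) agree
      satʳ : ∀ {x y l j} → x ≋ el M l → y ≋ el M j → ⟦ φ ⟧ (x ∷ y ∷ []) ⇔ M ⊨ ψʳ [ j ∷ l ∷ ρ ]
      satʳ {x} {y} {l} {j} p q = ψʳ-ok {x ∷ y ∷ []} {j ∷ l ∷ ρ} (λ { zero → p ; (suc zero) → q }) agree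
      sat⁺ : ∀ {x y l j} → x ≋ el M l → y ≋ el M j → ⟦ φ ⟧ (x ∷ y ∷ []) ⇔ M ⊨ ψ⁺ [ l ∷ j ∷ i ∷ ρ ]
      sat⁺ {x} {y} {l} {j} p q = ψ⁺-ok {x ∷ y ∷ []} {l ∷ j ∷ i ∷ ρ} (λ { zero → p ; (suc zero) → q }) agree
      total : ∀ x → el M x ∈ el M d → Σ (ix M) λ y →
        M ⊨ ψ [ x ∷ y ∷ ρ ] × (∀ y' → M ⊨ ψ [ x ∷ y' ∷ ρ ] → el M y' ≈ el M y)
      total x x∈d with y , p ← from (⊨∃ (x ∷ ρ) ψʳ) (proj₂ (to (d-spec x) x∈d)) =
        y , to (sat ≋-refl ≋-refl) (from (satʳ ≋-refl ≋-refl) p) , λ y' q → ≋-out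
          (functional _ _ _ (∊-respʳ (≋-sym a≋i) (∊-in (proj₁ (to (d-spec x) x∈d)))) (el∊M y') (el∊M y)
            (from (sat ≋-refl ≋-refl) q) (from (satʳ ≋-refl ≋-refl) p))
      θ : Formula (suc (suc (suc k)))
      θ = zero ∈̇ suc (suc zero) ∧̇ ψ⁺
      result : Σ V λ b → b ∊ M ×
        (∀ {y} → y ∊ b → Σ V λ x → x ∊ a × ⟦ φ ⟧ (x ∷ y ∷ [])) ×
        (∀ {x y} → x ∊ a → y ∊ M → ⟦ φ ⟧ (x ∷ y ∷ []) → y ∊ b)
      result with b , b-spec ← replacement {k} ψ ρ d total
        with c , c-spec ← separation {suc k} (∃̇ θ) (i ∷ ρ) b = el M c , el∊M c , elim , intro
        where
        elim : ∀ {y} → y ∊ el M c → Σ V λ x → x ∊ a × ⟦ φ ⟧ (x ∷ y ∷ [])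
        elim {y} y∊c with j , y≋j ← index (M-trans (el∊M c) y∊c)
          with x , x∈i , p ← from (⊨∃ (j ∷ i ∷ ρ) θ) (proj₂ (to (c-spec j) (∊-out (∊-respˡ y≋j y∊c)))) =
          el M x , ∊-respʳ (≋-sym a≋i) (∊-in x∈i) , from (sat⁺ ≋-refl y≋j) p
        intro : ∀ {x y} → x ∊ a → y ∊ M → ⟦ φ ⟧ (x ∷ y ∷ []) → y ∊ el M c
        intro {x} {y} x∊a y∊M p
          with l , x≋l ← index (M-trans a∊M x∊a)
          with j , y≋j ← index y∊M
          with j' , j'∈b , q ← b-spec l (from (d-spec l)
                 (∊-out (∊-resp x≋l a≋i x∊a) , to (⊨∃ (l ∷ ρ) ψʳ) (j , to (satʳ x≋l y≋j) p))) =
          ∊-respˡ (≋-sym y≋j) (∊-in (from (c-spec j) (∊-out {y = el M b} (∊-respˡ j'≋j (∊-in j'∈b)) ,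
            to (⊨∃ (j ∷ i ∷ ρ) θ) (l , ∊-out (∊-resp x≋l a≋i x∊a) , to (sat⁺ x≋l y≋j) p))))
          where
          j'≋j : el M j' ≋ el M j
          j'≋j = functional _ _ _ (∊-respˡ x≋l x∊a) (el∊M j') (el∊M j) (from (sat ≋-refl ≋-refl) q)
            (from (sat ≋-refl ≋-refl) (to (sat x≋l y≋j) p))


-- Products and graphs

infixr 7 _⊗_

opaque

  _⊗_ : V → V → V
  a ⊗ b = sup (ix a × ix b) λ (i , j) → ⟨ el a i , el b j ⟩

  ∊⊗⁺ : ∀ {a b x y} → x ∊ a → y ∊ b → ⟨ x , y ⟩ ∊ a ⊗ b
  ∊⊗⁺ p q = let i , r = index p ; j , s = index q in ∊-index (i , j) (⟨⟩-cong r s)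

  ∊⊗⁻ : ∀ {a b z} → z ∊ a ⊗ b → Σ V λ x → Σ V λ y → x ∊ a × y ∊ b × z ≋ ⟨ x , y ⟩
  ∊⊗⁻ {a} {b} (∊-in ((i , j) , p)) = el a i , el b j , el∊ a i , el∊ b j , ≋-in p

opaque

  ∊⊗⁻ˡ : ∀ {a b x y} → ⟨ x , y ⟩ ∊ a ⊗ b → x ∊ a
  ∊⊗⁻ˡ p = let _ , _ , q , _ , r = ∊⊗⁻ p in ∊-respˡ (≋-sym (proj₁ (⟨⟩-injective r))) q

  ∊⊗⁻ʳ : ∀ {a b x y} → ⟨ x , y ⟩ ∊ a ⊗ b → y ∊ b
  ∊⊗⁻ʳ p = let _ , _ , _ , q , r = ∊⊗⁻ p in ∊-respˡ (≋-sym (proj₂ (⟨⟩-injective r))) q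

opaque

  graph : (ℕ → V) → V
  graph u = sup ℕ λ n → ⟨ num n , u n ⟩

  ∊graph : ∀ {u} n → ⟨ num n , u n ⟩ ∊ graph u
  ∊graph n = ∊-index n ≋-refl

  graph-index : ∀ {u z} → z ∊ graph u → Σ ℕ λ n → z ≋ ⟨ num n , u n ⟩
  graph-index = index

  ∊graph⁻ : ∀ {u n y} → ⟨ num n , y ⟩ ∊ graph u → y ≋ u n
  ∊graph⁻ {u} p with index p
  ... | k , q with num-injective (proj₁ (⟨⟩-injective q))
  ...   | refl = proj₂ (⟨⟩-injective q)

  fibres : V → V → V
  fibres f a = image (λ x → ⟨ x , fibre f x ⟩) a

  ∊fibres⁺ : ∀ {f a x} → x ∊ a → ⟨ x , fibre f x ⟩ ∊ fibres f a
  ∊fibres⁺ p = let i , q = index p in ∊-index i (⟨⟩-cong q (fibre-cong ≋-refl q))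

  ∊fibres : ∀ {f a z} → z ∊ fibres f a → Σ V λ x → x ∊ a × z ≋ ⟨ x , fibre f x ⟩
  ∊fibres {f} {a} p = let i , q = index p in el a i , el∊ a i , q

  ∊fibres⁻ : ∀ {f a x y} → ⟨ x , y ⟩ ∊ fibres f a → x ∊ a × y ≋ fibre f x
  ∊fibres⁻ {f} {a} p with index p
  ... | i , q = ∊-index i (proj₁ (⟨⟩-injective q)) ,
                ≋-trans (proj₂ (⟨⟩-injective q)) (fibre-cong ≋-refl (≋-sym (proj₁ (⟨⟩-injective q))))

-- Inductive sets and an enumeration of pairs of naturals

opaque

  num∊inductive : ∀ {b} → ∅ ∊ b → (∀ x → x ∊ b → S x ∊ b) → ∀ n → num n ∊ b
  num∊inductive p q zero = p
  num∊inductive p q (suc n) = ∊-respˡ (≋-sym (num-suc n)) (q (num n) (num∊inductive p q n))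

-- A walk along the antidiagonals. Each pair is obtained from its predecessor by successors alone,
-- so the enumeration is a recursion that `M` can carry out without arithmetic.
unpair : ℕ → ℕ × ℕ
unpair zero = 0 , 0
unpair (suc n) with unpair n
... | a , zero = 0 , suc a
... | a , suc b = suc a , b

opaque

  unpair-surjective : ∀ a b → Σ ℕ λ n → unpair n ≡ (a , b)
  unpair-surjective a b = reach (a +ⁿ b) a b refl
    where
    -- Recursion on the antidiagonal `s` and then on the place `a` on it: the predecessor of
    -- `(0 , suc b)` is the end `(b , 0)` of the previous antidiagonal.
    reach : ∀ s a b → a +ⁿ b ≡ s → Σ ℕ λ n → unpair n ≡ (a , b)
    reach s zero zero _ = 0 , refl
    reach (suc s) zero (suc b) refl with reach s b zero (ℕₚ.+-identityʳ b)
    ... | n , p = suc n , q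
      where q : unpair (suc n) ≡ (zero , suc b)
            q rewrite p = refl
    reach s (suc a) b eq with reach s a (suc b) (trans (ℕₚ.+-suc a b) eq)
    ... | n , p = suc n , q
      where q : unpair (suc n) ≡ (suc a , b)
            q rewrite p = refl

-- Sets that belong to the model

module Constructions (em : ExcludedMiddle (lsuc 0ℓ)) (M : V) (M-transitive : Transitive M) (zfc : ZFC M) where

  open Classical em
  open Model em M M-transitive zfc
  open ZFC zfc

  x₀ : ∀ {n} → Tm (suc n)
  x₀ = var zero
  x₁ : ∀ {n} → Tm (suc (suc n))
  x₁ = var (suc zero)
  x₂ : ∀ {n} → Tm (suc (suc (suc n)))
  x₂ = var (suc (suc zero))
  x₃ : ∀ {n} → Tm (suc (suc (suc (suc n))))
  x₃ = var (suc (suc (suc zero)))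
  x₄ : ∀ {n} → Tm (suc (suc (suc (suc (suc n)))))
  x₄ = var (suc (suc (suc (suc zero))))
  x₅ : ∀ {n} → Tm (suc (suc (suc (suc (suc (suc n))))))
  x₅ = var (suc (suc (suc (suc (suc zero)))))
  x₆ : ∀ {n} → Tm (suc (suc (suc (suc (suc (suc (suc n)))))))
  x₆ = var (suc (suc (suc (suc (suc (suc zero))))))

  x₇ : ∀ {n} → Tm (suc (suc (suc (suc (suc (suc (suc (suc n))))))))
  x₇ = var (suc (suc (suc (suc (suc (suc (suc zero)))))))
  x₉ : ∀ {n} → Tm (suc (suc (suc (suc (suc (suc (suc (suc (suc (suc n))))))))))
  x₉ = var (suc (suc (suc (suc (suc (suc (suc (suc (suc zero)))))))))

  infixl 9 _∪ᵗ_
  _∪ᵗ_ : ∀ {n} → Tm n → Tm n → Tm n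
  s ∪ᵗ t = ⋃ᵗ ⁅ s , t ⁆ᵗ

  Sᵗ : ∀ {n} → Tm n → Tm n
  Sᵗ t = t ∪ᵗ ⁅ t , t ⁆ᵗ

  opaque

    ∊M-resp : ∀ {x y} → x ≋ y → y ∊ M → x ∊ M
    ∊M-resp p = ∊-respˡ (≋-sym p)

    ∅∊M : ∅ ∊ M
    ∅∊M = let w , (e , _ , empty) , _ = infinity in
      ∊-index e (≋-ext (λ z p → ⊥-elim (∅-empty p))
        (λ z p → let i , z≋i = index (M-trans (el∊M e) p) in ⊥-elim (empty i (∊-out (∊-respˡ z≋i p)))))

    ∪∊M : ∀ {x y} → x ∊ M → y ∊ M → x ∪ y ∊ M
    ∪∊M p q = Union∊M (⁅⁆∊M p q)

    S∊M : ∀ {x} → x ∊ M → S x ∊ M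
    S∊M p = ∪∊M p (⁅⁆∊M p p)

    num∊M : ∀ n → num n ∊ M
    num∊M zero = ∅∊M
    num∊M (suc n) = ∊M-resp (num-suc n) (S∊M (num∊M n))

  module _ (w : ix M) (e : ix M) (e∈w : el M e ∈ el M w) (e-empty : ∀ z → ¬ (el M z ∈ el M e))
           (w-succ : ∀ x → el M x ∈ el M w → Σ (ix M) λ s → el M s ∈ el M w ×
             (∀ z → el M z ∈ el M s ⇔ (el M z ∈ el M x ⊎ el M z ≈ el M x))) where

    opaque

      ∅∊w : ∅ ∊ el M w
      ∅∊w = ∊-respˡ (≋-ext (λ z p → let i , z≋i = index (M-trans (el∊M e) p) in ⊥-elim (e-empty i (∊-out (∊-respˡ z≋i p))))
                           (λ z p → ⊥-elim (∅-empty p))) (∊-in {el M e} {el M w} e∈w)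

      S∊w : ∀ x → x ∊ el M w → S x ∊ el M w
      S∊w x x∊w with i , x≋i ← index (M-trans (el∊M w) x∊w)
        with s , s∈w , s-spec ← w-succ i (∊-out (∊-respˡ x≋i x∊w)) =
        ∊-respˡ (≋-ext
          (λ z z∊s → let j , z≋j = index (M-trans (el∊M s) z∊s) in
            [ (λ p → ∊∪ˡ (∊-resp (≋-sym z≋j) (≋-sym x≋i) (∊-in p)))
            , (λ p → ∊∪ʳ (∊⁅⁆ˡ (≋-trans z≋j (≋-trans (≋-in p) (≋-sym x≋i))))) ]′
            (to (s-spec j) (∊-out (∊-respˡ z≋j z∊s))))
          (λ z z∊ → let j , z≋j = index (M-trans (S∊M (M-trans (el∊M w) x∊w)) z∊) in
            ∊-respˡ (≋-sym z≋j) (∊-in (from (s-spec j)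
              ([ (λ p → inj₁ (∊-out (∊-resp z≋j x≋i p)))
               , (λ p → inj₂ (≋-out (≋-trans (≋-sym z≋j) (≋-trans (∊⁅⁆₁ p) x≋i)))) ]′ (∊∪⁻ z∊))))))
          (∊-in {el M s} {el M w} s∈w)

      -- `b` is the part of `w` common to all inductive sets of `M`. The elements of `b` that are
      -- empty or successors of elements of `b` form an inductive set `d` of `M`, so they are all of
      -- `b`; ∈-induction in `V` then shows each of them to be a numeral.
      ω∊M-from : ω ∊ M
      ω∊M-from
        with b , b∊M , b⁻ , b⁺ ← separate (el∊M w)
               (∀ᶠ (con ∅ ∅∊M ∈ᶠ x₀ ∧ᶠ ∀ᶠ∈ x₀ (Sᵗ x₀ ∈ᶠ x₁) ⇒ᶠ x₁ ∈ᶠ x₀))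
        with d , d∊M , d⁻ , d⁺ ← separate b∊M (x₀ ≈ᶠ con ∅ ∅∊M ∨ᶠ ∃ᶠ∈ (con b b∊M) (x₁ ≈ᶠ Sᵗ x₀)) =
        ∊M-resp (≋-ext (λ x x∊ω → let n , x≋n = ∊ω⁻ x∊ω in ∊-respˡ (≋-sym x≋n) (num∊inductive ∅∊b S∊b n)) finite) b∊M
        where
        ∅∊b : ∅ ∊ b
        ∅∊b = b⁺ ∅∊w (λ y _ (p , _) → p)
        S∊b : ∀ x → x ∊ b → S x ∊ b
        S∊b x x∊b = b⁺ (S∊w x (proj₁ (b⁻ x∊b))) (λ y y∊M (p , q) → q x (proj₂ (b⁻ x∊b) y y∊M (p , q)))
        shape : ∀ {x} → x ∊ b → x ≋ ∅ ⊎ Σ V λ y → y ∊ b × x ≋ S y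
        shape x∊b = proj₂ (d⁻ (proj₂ (b⁻ x∊b) d d∊M
          (d⁺ ∅∊b (inj₁ ≋-refl) , λ y y∊d → d⁺ (S∊b y (proj₁ (d⁻ y∊d))) (inj₂ (y , proj₁ (d⁻ y∊d) , ≋-refl)))))
        finite : ∀ x → x ∊ b → x ∊ ω
        finite = ∊-induction (λ x → x ∊ b → x ∊ ω) λ x ih x∊b →
          [ ∊-index 0
          , (λ (y , y∊b , x≋Sy) → let n , y≋n = ∊ω⁻ (ih y (∊-respʳ (≋-sym x≋Sy) (∊∪ʳ (∊⁅⁆ˡ ≋-refl))) y∊b) in
              ∊-index (suc n) (≋-trans x≋Sy (≋-trans (S-cong y≋n) (≋-sym (num-suc n))))) ]′ (shape x∊b)

  opaque

    ω∊M : ω ∊ M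
    ω∊M = let w , (e , e∈w , e-empty) , w-succ = infinity in ω∊M-from w e e∈w e-empty w-succ

  record PowerSet (a : V) : Set₁ where
    field
      set     : V
      set∊M   : set ∊ M
      subsets : ∀ {y} → y ∊ M → (∀ z → z ∊ y → z ∊ a) → y ∊ set

  opaque

    power : ∀ {a} → a ∊ M → PowerSet a
    power {a} a∊M =
      let i , a≋i = index a∊M ; p , p-spec = powerset i in record
        { set = el M p ; set∊M = el∊M p
        ; subsets = λ {y} y∊M y⊆a → let j , y≋j = index y∊M in
            ∊-respˡ (≋-sym y≋j) (∊-in (p-spec j λ z z∈j →
              ∊-out (∊-respʳ a≋i (y⊆a (el M z) (∊-respʳ (≋-sym y≋j) (∊-in z∈j)))))) }

    -- A Kuratowski pair is a set of subsets of `a ∪ b`, so two power sets bound the product.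
    -- `power` promises only the subsets that lie in `M`, which covers all the sets concerned.
    ⊗∊M : ∀ {a b} → a ∊ M → b ∊ M → a ⊗ b ∊ M
    ⊗∊M {a} {b} a∊M b∊M with
        record { set = P ; set∊M = P∊M ; subsets = P-sub } ← power (∪∊M a∊M b∊M)
      with record { set = Q ; set∊M = Q∊M ; subsets = Q-sub } ← power P∊M
      with c , c∊M , c⁻ , c⁺ ← separate Q∊M (∃ᶠ∈ (con a a∊M) (∃ᶠ∈ (con b b∊M) (x₂ ≈ᶠ ⟨ x₁ , x₀ ⟩ᵗ)))
      = ∊M-resp (≋-ext
           (λ z z∊ → let x , y , x∊a , y∊b , z≋ = ∊⊗⁻ z∊ in
             c⁺ (Q-sub (∊M-resp z≋ (⟨⟩∊M (M-trans a∊M x∊a) (M-trans b∊M y∊b)))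
                  (λ w w∊ → [ (λ r → ∊-respˡ (≋-sym r) (⁅⁆∊P (∊∪ˡ x∊a) (∊∪ˡ x∊a)))
                            , (λ r → ∊-respˡ (≋-sym r) (⁅⁆∊P (∊∪ˡ x∊a) (∊∪ʳ y∊b))) ]′ (∊⁅⁆⁻ (∊-respʳ z≋ w∊))))
                (x , x∊a , y , y∊b , z≋))
           (λ z z∊ → let _ , x , x∊a , y , y∊b , z≋ = c⁻ z∊ in ∊-respˡ (≋-sym z≋) (∊⊗⁺ x∊a y∊b))) c∊M
      where
      ⁅⁆∊P : ∀ {x y} → x ∊ a ∪ b → y ∊ a ∪ b → ⁅ x , y ⁆ ∊ P
      ⁅⁆∊P p q = P-sub (⁅⁆∊M (M-trans (∪∊M a∊M b∊M) p) (M-trans (∪∊M a∊M b∊M) q))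
        (λ z z∊ → [ (λ r → ∊-respˡ (≋-sym r) p) , (λ r → ∊-respˡ (≋-sym r) q) ]′ (∊⁅⁆⁻ z∊))

    fibre∊M : ∀ {f} → f ∊ M → ∀ {x} → x ∊ M → fibre f x ∊ M
    fibre∊M {f} f∊M {x} x∊M
      with b , b∊M , b⁻ , b⁺ ← separate (Union∊M (Union∊M f∊M)) (⟨ con x x∊M , x₀ ⟩ᵗ ∈ᶠ con f f∊M)
      = ∊M-resp (≋-ext (λ z z∊ → b⁺ (∊Union²ʳ (∊fibre⁻ z∊)) (∊fibre⁻ z∊)) (λ z z∊ → ∊fibre⁺ (proj₂ (b⁻ z∊)))) b∊M

    fibres∊M : ∀ {f a} → f ∊ M → a ∊ M → fibres f a ∊ M
    fibres∊M {f} {a} f∊M a∊M = collect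
      where
      -- A formula can compare `y` and the fibre on elements of `M` only; by transitivity those are
      -- all their elements.
      is-fibre : ∀ {x y} → (∀ z → z ∊ M → (z ∊ y → ⟨ x , z ⟩ ∊ f) × (⟨ x , z ⟩ ∊ f → z ∊ y)) → y ∊ M → y ≋ fibre f x
      is-fibre p y∊M = ≋-ext (λ z z∊ → ∊fibre⁺ (proj₁ (p z (M-trans y∊M z∊)) z∊))
        (λ z z∊ → proj₂ (p z (proj₂ (⟨⟩∊M⁻ (M-trans f∊M (∊fibre⁻ z∊))))) (∊fibre⁻ z∊))
      collect : fibres f a ∊ M
      collect with b , b∊M , b⁻ , b⁺ ← replace a∊M
            (∃ᶠ (x₂ ≈ᶠ ⟨ x₁ , x₀ ⟩ᵗ ∧ᶠ ∀ᶠ (x₀ ∈ᶠ x₁ ⇔ᶠ ⟨ x₂ , x₀ ⟩ᵗ ∈ᶠ con f f∊M)))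
            (λ x y y' _ _ _ (u , u∊M , p , q) (u' , u'∊M , p' , q') →
              ≋-trans p (≋-trans (⟨⟩-cong ≋-refl (≋-trans (is-fibre q u∊M) (≋-sym (is-fibre q' u'∊M)))) (≋-sym p')))
        = ∊M-resp (≋-ext
          (λ z z∊ → let x , x∊a , z≋ = ∊fibres z∊
                        x∊M = M-trans a∊M x∊a
                    in ∊-respˡ (≋-sym z≋) (b⁺ x∊a (⟨⟩∊M x∊M (fibre∊M f∊M x∊M))
                         (fibre f x , fibre∊M f∊M x∊M , ≋-refl , λ w _ → ∊fibre⁻ , ∊fibre⁺)))
          (λ z z∊ → let x , x∊a , y , y∊M , z≋ , p = b⁻ z∊ in
             ∊-respˡ (≋-trans (⟨⟩-cong ≋-refl (≋-sym (is-fibre p y∊M))) (≋-sym z≋)) (∊fibres⁺ x∊a))) b∊M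


-- Recursion along the natural numbers inside the model

module Recursion (em : ExcludedMiddle (lsuc 0ℓ)) (M : V) (M-transitive : Transitive M) (zfc : ZFC M) where

  open Classical em
  open Model em M M-transitive zfc
  open Constructions em M M-transitive zfc

  module _ (u : ℕ → V) (u∊M : ∀ n → u n ∊ M) where

    approximation : ℕ → V
    approximation zero = ⁅ ⟨ ∅ , u 0 ⟩ , ⟨ ∅ , u 0 ⟩ ⁆
    approximation (suc k) = approximation k ∪ ⁅ ⟨ num (suc k) , u (suc k) ⟩ , ⟨ num (suc k) , u (suc k) ⟩ ⁆

    opaque

      approximation∊M : ∀ k → approximation k ∊ M
      approximation∊M zero = ⁅⁆∊M (⟨⟩∊M ∅∊M (u∊M 0)) (⟨⟩∊M ∅∊M (u∊M 0))
      approximation∊M (suc k) = ∪∊M (approximation∊M k)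
        (⁅⁆∊M (⟨⟩∊M (num∊M (suc k)) (u∊M (suc k))) (⟨⟩∊M (num∊M (suc k)) (u∊M (suc k))))

      ∊approximation : ∀ k → ⟨ num k , u k ⟩ ∊ approximation k
      ∊approximation zero = ∊⁅⁆ˡ ≋-refl
      ∊approximation (suc k) = ∊∪ʳ (∊⁅⁆ˡ ≋-refl)

      ∊approximation⁻ : ∀ k {z} → z ∊ approximation k → z ≋ ⟨ ∅ , u 0 ⟩ ⊎
        Σ ℕ λ j → ⟨ num j , u j ⟩ ∊ approximation k × z ≋ ⟨ num (suc j) , u (suc j) ⟩
      ∊approximation⁻ zero p = inj₁ (∊⁅⁆₁ p)
      ∊approximation⁻ (suc k) p with ∊∪⁻ p
      ... | inj₂ q = inj₂ (k , ∊∪ˡ (∊approximation k) , ∊⁅⁆₁ q)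
      ... | inj₁ q with ∊approximation⁻ k q
      ...   | inj₁ r = inj₁ r
      ...   | inj₂ (j , r , s) = inj₂ (j , ∊∪ˡ r , s)

  opaque

    -- The graph of u consists of the pairs that belong to some finite
    -- approximation to u.
    recursion : (u : ℕ → V) → (∀ n → u n ∊ M) → (φ : ∀ {n} → Fin n → Fin n → Fm n) →
      (∀ {n} (e : Fin n → V) i j k → e i ≋ u k → e j ∊ M → ⟦ φ i j ⟧ e → e j ≋ u (suc k)) →
      (∀ {n} (e : Fin n → V) i j k → e i ≋ u k → e j ≋ u (suc k) → ⟦ φ i j ⟧ e) → graph u ∊ M
    recursion u u∊M φ sound complete = collect
      where
      closed : ∀ {n} → Fm (suc n)
      -- Every entry is the base entry or is justified by an entry at the preceding index. By
      -- induction on the index this alone forces the value `u k` at `num k`.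
      closed = ∀ᶠ∈ x₀ (x₀ ≈ᶠ ⟨ con ∅ ∅∊M , con (u 0) (u∊M 0) ⟩ᵗ ∨ᶠ
        ∃ᶠ (∃ᶠ (∃ᶠ (⟨ x₂ , x₁ ⟩ᵗ ∈ᶠ x₄ ∧ᶠ x₃ ≈ᶠ ⟨ Sᵗ x₂ , x₀ ⟩ᵗ ∧ᶠ φ (suc zero) zero))))
      exact : ∀ {n} {e : Fin n → V} {g} → ⟦ closed {n} ⟧ (g ∷ e) → ∀ k {x y} → x ≋ num k → y ∊ M → ⟨ x , y ⟩ ∊ g → y ≋ u k
      exact cl zero x≋0 y∊M p with cl _ p
      ... | inj₁ q = proj₂ (⟨⟩-injective q)
      ... | inj₂ (w , _ , _ , _ , _ , _ , _ , r , _) =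
        ⊥-elim (∅-empty (∊-respʳ (≋-trans (≋-sym (proj₁ (⟨⟩-injective r))) x≋0) (∊∪ʳ {w} (∊⁅⁆ˡ ≋-refl))))
      exact {n} {e} {g} cl (suc k) {x} {y} x≋k y∊M p with cl _ p
      ... | inj₁ q with () ← num-injective {suc k} {0} (≋-trans (≋-sym x≋k) (proj₁ (⟨⟩-injective q)))
      ... | inj₂ (w , w∊M , w' , w'∊M , z' , z'∊M , q , r , s) = ≋-trans (proj₂ (⟨⟩-injective r))
        (sound (z' ∷ w' ∷ w ∷ ⟨ x , y ⟩ ∷ g ∷ e) (suc zero) zero k
          (exact {n} {e} cl k (S-injective-num (≋-trans (≋-sym (proj₁ (⟨⟩-injective r))) (≋-trans x≋k (num-suc k)))) w'∊M q) z'∊M s)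
      approximation-closed : ∀ {n} {e : Fin n → V} k → ⟦ closed {n} ⟧ (approximation u u∊M k ∷ e)
      approximation-closed {n} {e} k z z∊ with ∊approximation⁻ u u∊M k z∊
      ... | inj₁ p = inj₁ p
      ... | inj₂ (j , p , q) = inj₂ (num j , num∊M j , u j , u∊M j , u (suc j) , u∊M (suc j) , p ,
            ≋-trans q (⟨⟩-cong (num-suc j) ≋-refl) ,
            complete (u (suc j) ∷ u j ∷ num j ∷ z ∷ approximation u u∊M k ∷ e) (suc zero) zero j ≋-refl ≋-refl)
      collect : graph u ∊ M
      collect with b , b∊M , b⁻ , b⁺ ← replace ω∊M
          (∃ᶠ (∃ᶠ (x₃ ≈ᶠ ⟨ x₂ , x₁ ⟩ᵗ ∧ᶠ ⟨ x₂ , x₁ ⟩ᵗ ∈ᶠ x₀ ∧ᶠ closed)))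
          (λ x z z' x∊ω _ _ (y , y∊M , g , g∊M , p , q , cl) (y' , y'∊M , g' , g'∊M , p' , q' , cl') →
            let k , x≋k = ∊ω⁻ x∊ω in ≋-trans p (≋-trans (⟨⟩-cong ≋-refl
              (≋-trans (exact {e = y ∷ x ∷ z ∷ []} cl k x≋k y∊M q)
                (≋-sym (exact {e = y' ∷ x ∷ z' ∷ []} cl' k x≋k y'∊M q')))) (≋-sym p')))
        = ∊M-resp (≋-ext
            (λ z z∊ → let k , z≋ = graph-index z∊ in ∊-respˡ (≋-sym z≋) (b⁺ (num∊ω k) (⟨⟩∊M (num∊M k) (u∊M k))
               (u k , u∊M k , approximation u u∊M k , approximation∊M u u∊M k , ≋-refl , ∊approximation u u∊M k ,
                approximation-closed {e = u k ∷ num k ∷ ⟨ num k , u k ⟩ ∷ []} k)))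
            (λ z z∊ → let x , x∊ω , y , y∊M , g , g∊M , p , q , cl = b⁻ z∊
                          k , x≋k = ∊ω⁻ x∊ω
                      in ∊-respˡ (≋-sym (≋-trans p (⟨⟩-cong x≋k (exact {e = y ∷ x ∷ z ∷ []} cl k x≋k y∊M q)))) (∊graph k)))
            b∊M

  iterated-⋃ : V → ℕ → V
  iterated-⋃ a zero = a
  iterated-⋃ a (suc n) = Union (iterated-⋃ a n)

  opaque

    transitive-closure : ∀ {a} → a ∊ M → Σ V λ T → T ∊ M ×
      (∀ {x y} → y ∊ T → x ∊ y → x ∊ T) × (∀ {x} → x ∊ a → x ∊ T)
    transitive-closure {a} a∊M = collect
      where
      u∊M : ∀ n → iterated-⋃ a n ∊ M
      u∊M zero = a∊M
      u∊M (suc n) = Union∊M (u∊M n)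
      E∊M : graph (iterated-⋃ a) ∊ M
      E∊M = recursion (iterated-⋃ a) u∊M (λ i j → var j ≈ᶠ ⋃ᵗ (var i))
        (λ e i j k p _ q → ≋-trans q (Union-cong p)) (λ e i j k p q → ≋-trans q (Union-cong (≋-sym p)))
      collect : Σ V λ T → T ∊ M × (∀ {x y} → y ∊ T → x ∊ y → x ∊ T) × (∀ {x} → x ∊ a → x ∊ T)
      -- Two unions of the graph reach its values, the iterated unions of `a`; the third reaches
      -- their elements.
      collect with T , T∊M , T⁻ , T⁺ ← separate (Union∊M (Union∊M (Union∊M E∊M)))
          (∃ᶠ∈ (con ω ω∊M) (∃ᶠ (⟨ x₁ , x₀ ⟩ᵗ ∈ᶠ con (graph (iterated-⋃ a)) E∊M ∧ᶠ x₂ ∈ᶠ x₀)))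
        = T , T∊M ,
          (λ {x} {y} y∊T x∊y → let _ , k , k∊ω , z , z∊M , p , q = T⁻ y∊T
                                   n , k≋n = ∊ω⁻ k∊ω
                                   q' = ∊-respʳ (∊graph⁻ (∊-respˡ (⟨⟩-cong k≋n ≋-refl) p)) q
                               in member (suc n) (∊Union⁺ q' x∊y)) ,
          (λ {x} x∊a → member 0 x∊a)
        where
        member : ∀ n {x} → x ∊ iterated-⋃ a n → x ∊ T
        member n {x} x∊ = T⁺ (∊Union⁺ (∊Union²ʳ (∊graph n)) x∊) (num n , num∊ω n , iterated-⋃ a n , u∊M n , ∊graph n , x∊)

    -- The coding by which `countable-union` merges a sequence of enumerations into a single one.
    pairs : Σ V λ E → E ∊ M × SingleValued E × (∀ a b → Σ ℕ λ n → ⟨ num n , ⟨ num a , num b ⟩ ⟩ ∊ E)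
    pairs = graph u , graph∊M , single , λ a b → let n , p = unpair-surjective a b in
        n , subst (λ z → ⟨ num n , ⟨ num (proj₁ z) , num (proj₂ z) ⟩ ⟩ ∊ graph u) p (∊graph n)
      where
      u : ℕ → V
      u n = ⟨ num (proj₁ (unpair n)) , num (proj₂ (unpair n)) ⟩
      single : SingleValued (graph u)
      single x y y' p q with graph-index p
      ... | n , r = ≋-trans (∊graph⁻ (∊-respˡ (⟨⟩-cong (proj₁ (⟨⟩-injective r)) ≋-refl) p))
                            (≋-sym (∊graph⁻ (∊-respˡ (⟨⟩-cong (proj₁ (⟨⟩-injective r)) ≋-refl) q)))
      step : ∀ {n} → Fin n → Fin n → Fm n
      step i j = ∃ᶠ (var (suc i) ≈ᶠ ⟨ x₀ , con ∅ ∅∊M ⟩ᵗ ∧ᶠ var (suc j) ≈ᶠ ⟨ con ∅ ∅∊M , Sᵗ x₀ ⟩ᵗ) ∨ᶠ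
                 ∃ᶠ (∃ᶠ (var (suc (suc i)) ≈ᶠ ⟨ x₁ , Sᵗ x₀ ⟩ᵗ ∧ᶠ var (suc (suc j)) ≈ᶠ ⟨ Sᵗ x₁ , x₀ ⟩ᵗ))
      sound : ∀ {n} (e : Fin n → V) i j k → e i ≋ u k → e j ∊ M → ⟦ step i j ⟧ e → e j ≋ u (suc k)
      sound e i j k p _ s with unpair k
      sound e i j k p _ (inj₁ (x , _ , q , r)) | a , zero =
        ≋-trans r (⟨⟩-cong ≋-refl (≋-trans (S-cong (proj₁ (⟨⟩-injective (≋-trans (≋-sym q) p)))) (≋-sym (num-suc a))))
      sound e i j k p _ (inj₁ (x , _ , q , r)) | a , suc b
        with () ← num-injective {0} {suc b} (proj₂ (⟨⟩-injective (≋-trans (≋-sym q) p)))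
      sound e i j k p _ (inj₂ (x , _ , y , _ , q , r)) | a , zero =
        ⊥-elim (∅-empty (∊-respʳ (proj₂ (⟨⟩-injective (≋-trans (≋-sym q) p))) (∊∪ʳ (∊⁅⁆ˡ ≋-refl))))
      sound e i j k p _ (inj₂ (x , _ , y , _ , q , r)) | a , suc b = ≋-trans r
        (⟨⟩-cong (≋-trans (S-cong (proj₁ (⟨⟩-injective (≋-trans (≋-sym q) p)))) (≋-sym (num-suc a)))
          (S-injective-num (≋-trans (proj₂ (⟨⟩-injective (≋-trans (≋-sym q) p))) (num-suc b))))
      complete : ∀ {n} (e : Fin n → V) i j k → e i ≋ u k → e j ≋ u (suc k) → ⟦ step i j ⟧ e
      complete e i j k p q with unpair k
      ... | a , zero = inj₁ (num a , num∊M a , p , ≋-trans q (⟨⟩-cong ≋-refl (num-suc a)))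
      ... | a , suc b = inj₂ (num a , num∊M a , num b , num∊M b , ≋-trans p (⟨⟩-cong ≋-refl (num-suc b)) ,
                              ≋-trans q (⟨⟩-cong (num-suc a) ≋-refl))
      graph∊M : graph u ∊ M
      graph∊M = recursion u (λ n → ⟨⟩∊M (num∊M _) (num∊M _)) step sound complete


-- Countability in M

module Smallness (em : ExcludedMiddle (lsuc 0ℓ)) (M : V) (M-transitive : Transitive M) (zfc : ZFC M)
                 (Z : V) (Z∊M : Z ∊ M) where

  open Classical em
  open Model em M M-transitive zfc
  open Constructions em M M-transitive zfc
  open Recursion em M M-transitive zfc
  open ZFC zfc using (choice)

  -- Some h ∈ M enumerates a superset of { x ∈ Z : P x }.
  Small : ∀ {ℓ} → (V → Set ℓ) → Set (lsuc 0ℓ ⊔ ℓ)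
  Small P = Σ V λ h → h ∊ M × SingleValued h × (∀ x → x ∊ Z → P x → Σ ℕ λ n → ⟨ num n , x ⟩ ∊ h)

  Small-⊆ : ∀ {ℓ ℓ'} {P : V → Set ℓ} {Q : V → Set ℓ'} → (∀ x → x ∊ Z → P x → Q x) → Small Q → Small P
  Small-⊆ P⊆Q (h , h∊M , sv , cover) = h , h∊M , sv , λ x x∊Z Px → cover x x∊Z (P⊆Q x x∊Z Px)

  opaque

    choose : ∀ {A} → A ∊ M → (∀ x → x ∊ A → Σ V λ z → z ∊ x) →
      (∀ x y z → x ∊ A → y ∊ A → z ∊ x → z ∊ y → x ≋ y) →
      Σ V λ c → c ∊ M × (∀ x → x ∊ A → Σ V λ z → z ∊ x × z ∊ c × (∀ z' → z' ∊ x → z' ∊ c → z' ≋ z))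
    choose {A} A∊M inhabited disjoint
      with a , A≋a ← index A∊M
      with c , c-spec ← choice a
             (λ x x∈a → let z , z∊x = inhabited (el M x) (∊-respʳ (≋-sym A≋a) (∊-in x∈a))
                            i , z≋i = index (M-trans (el∊M x) z∊x)
                        in i , ∊-out (∊-respˡ z≋i z∊x))
             (λ x y z x∈a y∈a z∈x z∈y → ≋-out (disjoint (el M x) (el M y) (el M z)
               (∊-respʳ (≋-sym A≋a) (∊-in x∈a)) (∊-respʳ (≋-sym A≋a) (∊-in y∈a)) (∊-in z∈x) (∊-in z∈y)))
      = el M c , el∊M c , pick
      where
      pick : ∀ x → x ∊ A → Σ V λ z → z ∊ x × z ∊ el M c × (∀ z' → z' ∊ x → z' ∊ el M c → z' ≋ z)
      pick x x∊A with i , x≋i ← index (M-trans A∊M x∊A)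
        with z , (z∈i , z∈c) , unique ← c-spec i (∊-out (∊-resp x≋i A≋a x∊A))
        = el M z , ∊-respʳ (≋-sym x≋i) (∊-in z∈i) , ∊-in z∈c , λ z' z'∊x z'∊c →
            let j , z'≋j = index (M-trans (el∊M c) z'∊c)
            in ≋-trans z'≋j (≋-in (unique j (∊-out (∊-resp z'≋j x≋i z'∊x)) (∊-out (∊-respˡ z'≋j z'∊c))))

  module _ {R : V} (R∊M : R ∊ M) (small : ∀ n → Small (λ x → ⟨ num n , x ⟩ ∊ R)) where

    private
      open PowerSet (power (⊗∊M ω∊M Z∊M)) renaming (set to P; set∊M to P∊M)
      Pᶜ Zᶜ ωᶜ : ∀ {n} → Tm n
      Pᶜ = con P P∊M
      Zᶜ = con Z Z∊M
      ωᶜ = con ω ω∊M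

      -- the pairs ⟨ k , h ⟩ such that h enumerates a superset of the k-th fibre of R
      goodᶠ : Fm 1
      goodᶠ = ∃ᶠ∈ ωᶜ (∃ᶠ∈ Pᶜ (x₂ ≈ᶠ ⟨ x₁ , x₀ ⟩ᵗ
        ∧ᶠ ∀ᶠ∈ ωᶜ (∀ᶠ∈ Zᶜ (∀ᶠ∈ Zᶜ (⟨ x₂ , x₁ ⟩ᵗ ∈ᶠ x₃ ⇒ᶠ ⟨ x₂ , x₀ ⟩ᵗ ∈ᶠ x₃ ⇒ᶠ x₁ ≈ᶠ x₀)))
        ∧ᶠ ∀ᶠ∈ Zᶜ (⟨ x₂ , x₀ ⟩ᵗ ∈ᶠ con R R∊M ⇒ᶠ ∃ᶠ∈ ωᶜ (⟨ x₀ , x₁ ⟩ᵗ ∈ᶠ x₂))))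

    opaque

      -- The hypothesis yields an enumeration of each fibre separately, outside `M`. To select one
      -- for all `k` at once, `M` forms for each `k` the set of good pairs `⟨ k , h ⟩`; these sets
      -- are disjoint because of the tag `k`, so choice in `M` applies.
      countable-union : Small (λ x → Σ ℕ λ n → ⟨ num n , x ⟩ ∊ R)
      countable-union with Gd , Gd∊M , Gd⁻ , Gd⁺ ← separate (⊗∊M ω∊M P∊M) goodᶠ = result
        where
        φ : Fm 2
        φ = ∀ᶠ∈ (con Gd Gd∊M) (x₀ ∈ᶠ x₂ ⇔ᶠ ∃ᶠ∈ Pᶜ (x₁ ≈ᶠ ⟨ x₂ , x₀ ⟩ᵗ)) ∧ᶠ ∀ᶠ∈ x₁ (x₀ ∈ᶠ con Gd Gd∊M)
        unique : ∀ {k k' y y'} → k ≋ k' → ⟦ φ ⟧ (k ∷ y ∷ []) → ⟦ φ ⟧ (k' ∷ y' ∷ []) → y ≋ y'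
        unique k≋k' (p , q) (p' , q') = ≋-ext
          (λ z z∊y → let h , h∊P , r = proj₁ (p z (q z z∊y)) z∊y in
            proj₂ (p' z (q z z∊y)) (h , h∊P , ≋-trans r (⟨⟩-cong k≋k' ≋-refl)))
          (λ z z∊y → let h , h∊P , r = proj₁ (p' z (q' z z∊y)) z∊y in
            proj₂ (p z (q' z z∊y)) (h , h∊P , ≋-trans r (⟨⟩-cong (≋-sym k≋k') ≋-refl)))
        good : ∀ n → Σ V λ h → h ∊ P × ⟨ num n , h ⟩ ∊ Gd
        good n with h , h∊M , sv , cover ← small n
          -- The given `h` may also list sets outside `Z`; its restriction belongs to the power set
          -- from which the good pairs are taken.
          with h' , h'∊M , h'⁻ , h'⁺ ← separate h∊M (x₀ ∈ᶠ con (ω ⊗ Z) (⊗∊M ω∊M Z∊M))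
          = h' , h'∊P , Gd⁺ (∊⊗⁺ (num∊ω n) h'∊P) (num n , num∊ω n , h' , h'∊P , ≋-refl ,
              (λ l _ x _ x' _ p q → sv l x x' (proj₁ (h'⁻ p)) (proj₁ (h'⁻ q))) ,
              (λ x x∊Z p → let l , q = cover x x∊Z p in num l , num∊ω l , h'⁺ q (∊⊗⁺ (num∊ω l) x∊Z)))
          where
          h'∊P : h' ∊ P
          h'∊P = subsets h'∊M (λ z z∊ → proj₂ (h'⁻ z∊))
        section : ∀ n → Σ V λ y → y ∊ M × ⟦ φ ⟧ (num n ∷ y ∷ [])
        section n with y , y∊M , y⁻ , y⁺ ← separate Gd∊M (∃ᶠ∈ Pᶜ (x₁ ≈ᶠ ⟨ con (num n) (num∊M n) , x₀ ⟩ᵗ))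
          = y , y∊M , (λ z z∊ → (λ p → proj₂ (y⁻ p)) , y⁺ z∊) , λ z z∊ → proj₁ (y⁻ z∊)
        result : Small (λ x → Σ ℕ λ n → ⟨ num n , x ⟩ ∊ R)
        result
          with 𝒜 , 𝒜∊M , 𝒜⁻ , 𝒜⁺ ← replace ω∊M φ (λ x y y' _ _ _ p q → unique ≋-refl p q)
          with c , c∊M , pick ← choose 𝒜∊M
            (λ y y∊ → let k , k∊ω , p , q = 𝒜⁻ y∊
                          n , k≋n = ∊ω⁻ k∊ω
                          h , h∊P , r = good n
                      in ⟨ num n , h ⟩ , proj₂ (p _ r) (h , h∊P , ⟨⟩-cong (≋-sym k≋n) ≋-refl))
            (λ y y' z y∊ y'∊ z∊y z∊y' →
              let k , k∊ω , p , q = 𝒜⁻ y∊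
                  k' , k'∊ω , p' , q' = 𝒜⁻ y'∊
                  h , h∊P , r = proj₁ (p z (q z z∊y)) z∊y
                  h' , h'∊P , r' = proj₁ (p' z (q' z z∊y')) z∊y'
              in unique (proj₁ (⟨⟩-injective (≋-trans (≋-sym r) r'))) (p , q) (p' , q'))
          with E , E∊M , E-sv , E-all ← pairs
          -- At the code of `(n , l)`, `e` has the `l`-th entry of the enumeration selected for `n`.
          with e , e∊M , e⁻ , e⁺ ← separate (⊗∊M ω∊M Z∊M)
            (∃ᶠ∈ ωᶜ (∃ᶠ∈ Zᶜ (x₂ ≈ᶠ ⟨ x₁ , x₀ ⟩ᵗ ∧ᶠ ∃ᶠ∈ ωᶜ (∃ᶠ∈ ωᶜ (∃ᶠ∈ Pᶜ
              (⟨ x₄ , ⟨ x₂ , x₁ ⟩ᵗ ⟩ᵗ ∈ᶠ con E E∊M ∧ᶠ ⟨ x₂ , x₀ ⟩ᵗ ∈ᶠ con c c∊M ∧ᶠ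
               ⟨ x₂ , x₀ ⟩ᵗ ∈ᶠ con Gd Gd∊M ∧ᶠ ⟨ x₁ , x₃ ⟩ᵗ ∈ᶠ x₀))))))
          = e , e∊M , single , cover
          where
          one-h : ∀ {k h h'} → k ∊ ω → h ∊ P → h' ∊ P → ⟨ k , h ⟩ ∊ c → ⟨ k , h' ⟩ ∊ c → ⟨ k , h ⟩ ∊ Gd → ⟨ k , h' ⟩ ∊ Gd → h ≋ h'
          one-h {k} {h} {h'} k∊ω h∊P h'∊P p p' q q'
            with n , k≋n ← ∊ω⁻ k∊ω
            with y , y∊M , s , t ← section n
            with z , z∊y , z∊c , only ← pick y (𝒜⁺ (num∊ω n) y∊M (s , t))
            = proj₂ (⟨⟩-injective (≋-trans
                (only _ (proj₂ (s _ q) (h , h∊P , ⟨⟩-cong k≋n ≋-refl)) p)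
                (≋-sym (only _ (proj₂ (s _ q') (h' , h'∊P , ⟨⟩-cong k≋n ≋-refl)) p'))))
          single : SingleValued e
          single j x x' p p'
            with _ , j₁ , _ , x₁' , x₁'∊Z , r , k , k∊ω , l , l∊ω , h , h∊P , a , b , d , f ← e⁻ p
            with _ , j₂ , _ , x₂' , x₂'∊Z , r' , k' , k'∊ω , l' , l'∊ω , h' , h'∊P , a' , b' , d' , f' ← e⁻ p'
            with k≋k' , l≋l' ← ⟨⟩-injective (E-sv j _ _
                   (∊-respˡ (⟨⟩-cong (≋-sym (proj₁ (⟨⟩-injective r))) ≋-refl) a)
                   (∊-respˡ (⟨⟩-cong (≋-sym (proj₁ (⟨⟩-injective r'))) ≋-refl) a'))
            with h≋h' ← one-h k∊ω h∊P h'∊P b (∊-respˡ (⟨⟩-cong (≋-sym k≋k') ≋-refl) b') d (∊-respˡ (⟨⟩-cong (≋-sym k≋k') ≋-refl) d')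
            with _ , k₃ , _ , h₃ , _ , r₃ , sv , _ ← Gd⁻ d
            with h≋h₃ ← proj₂ (⟨⟩-injective r₃)
            = ≋-trans (proj₂ (⟨⟩-injective r)) (≋-trans
                (sv l l∊ω x₁' x₁'∊Z x₂' x₂'∊Z (∊-respʳ h≋h₃ f)
                  (∊-resp (⟨⟩-cong (≋-sym l≋l') ≋-refl) (≋-trans (≋-sym h≋h') h≋h₃) f'))
                (≋-sym (proj₂ (⟨⟩-injective r'))))
          cover : ∀ x → x ∊ Z → (Σ ℕ λ n → ⟨ num n , x ⟩ ∊ R) → Σ ℕ λ j → ⟨ num j , x ⟩ ∊ e
          cover x x∊Z (n , p)
            with y , y∊M , s , t ← section n
            with z , z∊y , z∊c , _ ← pick y (𝒜⁺ (num∊ω n) y∊M (s , t))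
            with h , h∊P , z≋ ← proj₁ (s z (t z z∊y)) z∊y
            with _ , k₃ , _ , h₃ , _ , r₃ , _ , cov ← Gd⁻ (∊-respˡ z≋ (t z z∊y))
            with l , l∊ω , q ← cov x x∊Z (∊-respˡ (⟨⟩-cong (proj₁ (⟨⟩-injective r₃)) ≋-refl) p)
            with m , l≋m ← ∊ω⁻ l∊ω
            with j , r ← E-all n m
            = j , e⁺ (∊⊗⁺ (num∊ω j) x∊Z) (num j , num∊ω j , x , x∊Z , ≋-refl , num n , num∊ω n , num m , num∊ω m , h , h∊P ,
                r , ∊-respˡ z≋ z∊c , ∊-respˡ z≋ (t z z∊y) ,
                ∊-resp (⟨⟩-cong l≋m ≋-refl) (≋-sym (proj₂ (⟨⟩-injective r₃))) q)

  opaque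

    Small-∅ : Small (λ _ → ⊥)
    Small-∅ = ∅ , ∅∊M , (λ x y y' p _ → ⊥-elim (∅-empty p)) , λ x _ ()

    Small-singleton : ∀ {y} → y ∊ M → Small (_≋ y)
    Small-singleton {y} y∊M = ⁅ ⟨ ∅ , y ⟩ , ⟨ ∅ , y ⟩ ⁆ , ⁅⁆∊M (⟨⟩∊M ∅∊M y∊M) (⟨⟩∊M ∅∊M y∊M) ,
      (λ x z z' p q → ≋-trans (proj₂ (⟨⟩-injective (∊⁅⁆₁ p))) (≋-sym (proj₂ (⟨⟩-injective (∊⁅⁆₁ q))))) ,
      λ x _ p → 0 , ∊⁅⁆ˡ (⟨⟩-cong ≋-refl p)

    -- A case of `countable-union`: the fibre of `R` over 0 is enumerated by `h`, all the others by
    -- `k`.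
    Small-⊎ : ∀ {ℓ ℓ'} {P : V → Set ℓ} {Q : V → Set ℓ'} → Small P → Small Q → Small (λ x → P x ⊎ Q x)
    Small-⊎ {P = P} {Q} (h , h∊M , h-sv , h-cover) (k , k∊M , k-sv , k-cover)
      with R , R∊M , R⁻ , R⁺ ← separate (⊗∊M ω∊M Z∊M) (∃ᶠ∈ (con ω ω∊M) (∃ᶠ∈ (con Z Z∊M) (x₂ ≈ᶠ ⟨ x₁ , x₀ ⟩ᵗ ∧ᶠ
             (x₁ ≈ᶠ con ∅ ∅∊M ∧ᶠ ∃ᶠ∈ (con ω ω∊M) (⟨ x₀ , x₁ ⟩ᵗ ∈ᶠ con h h∊M) ∨ᶠ
              ¬ᶠ (x₁ ≈ᶠ con ∅ ∅∊M) ∧ᶠ ∃ᶠ∈ (con ω ω∊M) (⟨ x₀ , x₁ ⟩ᵗ ∈ᶠ con k k∊M)))))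
      = Small-⊆ (λ x x∊Z → [ (λ p → let l , q = h-cover x x∊Z p in 0 , R⁺ (∊⊗⁺ (num∊ω 0) x∊Z)
                                 (∅ , num∊ω 0 , x , x∊Z , ≋-refl , inj₁ (≋-refl , num l , num∊ω l , q)))
                           , (λ p → let l , q = k-cover x x∊Z p in 1 , R⁺ (∊⊗⁺ (num∊ω 1) x∊Z)
                                 (num 1 , num∊ω 1 , x , x∊Z , ≋-refl , inj₂ (1≉0 , num l , num∊ω l , q))) ]′)
          (countable-union R∊M each)
      where
      1≉0 : ¬ (num 1 ≋ ∅)
      1≉0 p with () ← num-injective {1} {0} p
      each : ∀ n → Small (λ x → ⟨ num n , x ⟩ ∊ R)
      each zero = h , h∊M , h-sv , λ x _ p → first p
        where
        first : ∀ {x} → ⟨ num 0 , x ⟩ ∊ R → Σ ℕ λ n → ⟨ num n , x ⟩ ∊ h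
        first p with _ , i , _ , y , _ , r , s ← R⁻ p with s
        ... | inj₁ (_ , l , l∊ω , q) = let n , l≋n = ∊ω⁻ l∊ω in n , ∊-respˡ (⟨⟩-cong l≋n (≋-sym (proj₂ (⟨⟩-injective r)))) q
        ... | inj₂ (i≉0 , _) = ⊥-elim (i≉0 (≋-sym (proj₁ (⟨⟩-injective r))))
      each (suc m) = k , k∊M , k-sv , λ x _ p → second p
        where
        second : ∀ {x} → ⟨ num (suc m) , x ⟩ ∊ R → Σ ℕ λ n → ⟨ num n , x ⟩ ∊ k
        second p with _ , i , _ , y , _ , r , s ← R⁻ p with s
        ... | inj₁ (i≋0 , _) with () ← num-injective {suc m} {0} (≋-trans (proj₁ (⟨⟩-injective r)) i≋0)
        ... | inj₂ (_ , l , l∊ω , q) = let n , l≋n = ∊ω⁻ l∊ω in n , ∊-respˡ (⟨⟩-cong l≋n (≋-sym (proj₂ (⟨⟩-injective r)))) q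


-- Names

opaque

  -- The name `ρ` sits three ∈-steps below `σ`, by way of `⟨ ρ , d ⟩` and the singleton of `ρ`. The
  -- induction therefore carries `P` for a set, its elements and their elements.
  name-induction : ∀ {ℓ} (P : V → Set ℓ) → (∀ σ → (∀ ρ d → ⟨ ρ , d ⟩ ∊ σ → P ρ) → P σ) → ∀ σ → P σ
  name-induction P step σ = proj₁ (∊-induction
    (λ x → P x × (∀ y → y ∊ x → P y) × (∀ y z → y ∊ x → z ∊ y → P z))
    (λ x ih → step x (λ ρ d p → proj₂ (proj₂ (ih _ p)) _ ρ (∊⁅⁆ˡ ≋-refl) (∊⁅⁆ˡ ≋-refl)) ,
              (λ y p → proj₁ (ih y p)) , (λ y z p q → proj₁ (proj₂ (ih y p)) z q)) σ)

module Names (ℙ G : V) where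

  private
    -- A derivation stores indices into `⋃ (⋃ τ)`, so passing to a bisimilar set means relocating
    -- every one of them.
    IsName-resp′ : ∀ {τ} → IsName ℙ τ → ∀ {τ'} → τ ≋ τ' → IsName ℙ τ'
    IsName-resp′ {τ} (name σ c eq σ-name) {τ'} τ≋τ' =
      name (λ i → proj₁ (place i)) (λ i → c (match i))
        (λ i → ≋-out (≋-trans (proj₂ (index (∊-respʳ (≋-sym τ≋τ') (el∊ τ' i))))
          (≋-trans (≋-in (eq (match i))) (⟨⟩-cong (proj₂ (place i)) ≋-refl))))
        (λ i → IsName-resp′ (σ-name (match i)) (proj₂ (place i)))
      where
      match : ix τ' → ix τ
      match i = proj₁ (index (∊-respʳ (≋-sym τ≋τ') (el∊ τ' i)))
      place : ∀ i → Σ (ix (⋃ (⋃ τ'))) λ j → el (⋃ (⋃ τ)) (σ (match i)) ≋ el (⋃ (⋃ τ')) j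
      place i = index (∊⋃⋃ˡ {f = τ'} (∊-resp (≋-in (eq (match i))) τ≋τ' (el∊ τ (match i))))

    val-cong′ : ∀ {τ} (n : IsName ℙ τ) {τ'} (n' : IsName ℙ τ') → τ ≋ τ' → val G n ≋ val G n'
    val-cong′ {τ} n@(name σ c eq σ-name) {τ'} n'@(name σ' c' eq' σ'-name) τ≋τ' = ≋-ext
      (λ y y∊ → let (i , c∈G) , y≋ = index y∊
                    j , i≋j = index (∊-respʳ τ≋τ' (el∊ τ i))
                    σ≋ , c≋ = ⟨⟩-injective (≋-trans (≋-sym (≋-in (eq i))) (≋-trans i≋j (≋-in (eq' j))))
                in ∊-index {y = val G n'} (j , ∊-out (∊-respˡ c≋ (∊-in {y = G} c∈G))) (≋-trans y≋ (val-cong′ (σ-name i) (σ'-name j) σ≋)))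
      (λ y y∊ → let (j , c∈G) , y≋ = index y∊
                    i , j≋i = index (∊-respʳ (≋-sym τ≋τ') (el∊ τ' j))
                    σ≋ , c≋ = ⟨⟩-injective (≋-trans (≋-sym (≋-in (eq i))) (≋-trans (≋-sym j≋i) (≋-in (eq' j))))
                in ∊-index {y = val G n} (i , ∊-out (∊-respˡ (≋-sym c≋) (∊-in {y = G} c∈G)))
                     (≋-trans y≋ (≋-sym (val-cong′ (σ-name i) (σ'-name j) σ≋))))

  opaque

    val-cong : ∀ {τ τ'} (n : IsName ℙ τ) (n' : IsName ℙ τ') → τ ≋ τ' → val G n ≋ val G n'
    val-cong n n' p = val-cong′ n n' p

    name-intro : ∀ τ → (∀ z → z ∊ τ → Σ V λ σ → Σ V λ c → z ≋ ⟨ σ , c ⟩ × c ∊ ℙ × IsName ℙ σ) → IsName ℙ τ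
    name-intro τ parts = name (λ i → proj₁ (place i)) (λ i → proj₁ (index (c∊ i)))
        (λ i → ≋-out (≋-trans (z≋ i) (⟨⟩-cong (proj₂ (place i)) (proj₂ (index (c∊ i))))))
        (λ i → IsName-resp′ (σ-name i) (proj₂ (place i)))
      where
      σ' c' : ix τ → V
      σ' i = proj₁ (parts (el τ i) (el∊ τ i))
      c' i = proj₁ (proj₂ (parts (el τ i) (el∊ τ i)))
      z≋ : ∀ i → el τ i ≋ ⟨ σ' i , c' i ⟩
      z≋ i = proj₁ (proj₂ (proj₂ (parts (el τ i) (el∊ τ i))))
      c∊ : ∀ i → c' i ∊ ℙ
      c∊ i = proj₁ (proj₂ (proj₂ (proj₂ (parts (el τ i) (el∊ τ i)))))
      σ-name : ∀ i → IsName ℙ (σ' i)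
      σ-name i = proj₂ (proj₂ (proj₂ (proj₂ (parts (el τ i) (el∊ τ i)))))
      place : ∀ i → Σ (ix (⋃ (⋃ τ))) λ j → σ' i ≋ el (⋃ (⋃ τ)) j
      place i = index (∊⋃⋃ˡ {f = τ} (∊-respˡ (z≋ i) (el∊ τ i)))

    name-elim : ∀ {τ σ c} → IsName ℙ τ → ⟨ σ , c ⟩ ∊ τ → c ∊ ℙ × IsName ℙ σ
    name-elim {τ} (name σ c eq σ-name) p =
      let i , q = index p
          r , s = ⟨⟩-injective (≋-trans q (≋-in (eq i)))
      in ∊-index (c i) s , IsName-resp′ (σ-name i) (≋-sym r)

    ∊val⁺ : ∀ {τ σ c} (n : IsName ℙ τ) (n' : IsName ℙ σ) → ⟨ σ , c ⟩ ∊ τ → c ∊ G → val G n' ∊ val G n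
    ∊val⁺ {τ} n@(name σ c eq σ-name) n' p c∊G =
      let i , q = index p
          r , s = ⟨⟩-injective (≋-trans q (≋-in (eq i)))
      in ∊-index {y = val G n} (i , ∊-out (∊-respˡ s c∊G)) (val-cong′ n' (σ-name i) r)

    ∊val⁻ : ∀ {τ y} (n : IsName ℙ τ) → y ∊ val G n →
      Σ V λ σ → Σ V λ c → ⟨ σ , c ⟩ ∊ τ × c ∊ G × Σ (IsName ℙ σ) λ n' → y ≋ val G n'
    ∊val⁻ {τ} (name σ c eq σ-name) y∊ =
      let (i , c∈G) , y≋ = index y∊
      in el (⋃ (⋃ τ)) (σ i) , el ℙ (c i) , ∊-respˡ (≋-in (eq i)) (el∊ τ i) , ∊-in c∈G , σ-name i , y≋

    ∊extension⁺ : ∀ {M τ} → τ ∊ M → (n : IsName ℙ τ) → val G n ∊ extension M ℙ G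
    ∊extension⁺ {M} τ∊M n = let i , τ≋ = index τ∊M in
      ∊-index {y = extension M ℙ G} (i , IsName-resp′ n τ≋) (val-cong′ n (IsName-resp′ n τ≋) τ≋)

    ∊extension⁻ : ∀ {M x} → x ∊ extension M ℙ G → Σ V λ τ → τ ∊ M × Σ (IsName ℙ τ) λ n → x ≋ val G n
    ∊extension⁻ {M} p = let (i , n) , q = index p in el M i , el∊ M i , n , q


-- Forcing equality of names

-- Genericity for an order that is a set: once `Le` is in `M`, the order can occur in formulas as a
-- constant. The forcing machinery needs nothing else about the poset.
record GenericFilter (M ℙ Le G : V) : Set₁ where
  field
    ≼-refl   : ∀ {c} → c ∊ ℙ → ⟨ c , c ⟩ ∊ Le
    ≼-trans  : ∀ {c d e} → ⟨ c , d ⟩ ∊ Le → ⟨ d , e ⟩ ∊ Le → ⟨ c , e ⟩ ∊ Le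
    G⊆ℙ      : ∀ {c} → c ∊ G → c ∊ ℙ
    nonempty : Σ V λ c → c ∊ G
    upward   : ∀ {c d} → c ∊ G → d ∊ ℙ → ⟨ c , d ⟩ ∊ Le → d ∊ G
    directed : ∀ {c d} → c ∊ G → d ∊ G → Σ V λ e → e ∊ G × ⟨ e , c ⟩ ∊ Le × ⟨ e , d ⟩ ∊ Le
    meets    : ∀ {D} → D ∊ M → (∀ {d} → d ∊ D → d ∊ ℙ) →
               (∀ {c} → c ∊ ℙ → Σ V λ d → d ∊ D × ⟨ d , c ⟩ ∊ Le) → Σ V λ c → c ∊ G × c ∊ D

module Forcing (em : ExcludedMiddle (lsuc 0ℓ)) (M : V) (M-transitive : Transitive M) (zfc : ZFC M)
               (ℙ Le G : V) (ℙ∊M : ℙ ∊ M) (Le∊M : Le ∊ M) (filter : GenericFilter M ℙ Le G) where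

  open Classical em
  open Model em M M-transitive zfc
  open Constructions em M M-transitive zfc
  open GenericFilter filter public
  open Names ℙ G

  infix 4 _≼_
  infix 8 _≼ᶠ_
  _≼_ : V → V → Set
  c ≼ d = ⟨ c , d ⟩ ∊ Le

  _≼ᶠ_ : ∀ {n} → Tm n → Tm n → Fm n
  s ≼ᶠ t = ⟨ s , t ⟩ᵗ ∈ᶠ con Le Le∊M

  ℙᶜ : ∀ {n} → Tm n
  ℙᶜ = con ℙ ℙ∊M

  opaque

    -- Density below `c₀` becomes density everywhere by adding the conditions incompatible with
    -- `c₀`. The filter contains none of these, being directed.
    generic-below : ∀ {c₀} → c₀ ∊ G → (φ : Fm 1) →
      (∀ c → c ∊ ℙ → c ≼ c₀ → Σ V λ d → d ∊ ℙ × d ≼ c × ⟦ φ ⟧ (d ∷ [])) → Σ V λ d → d ∊ G × ⟦ φ ⟧ (d ∷ [])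
    generic-below {c₀} c₀∊G φ dense
      with D₁ , D₁∊M , D₁⁻ , D₁⁺ ← separate ℙ∊M φ
      with D , D∊M , D⁻ , D⁺ ← separate ℙ∊M (x₀ ∈ᶠ con D₁ D₁∊M ∨ᶠ
             ∀ᶠ∈ ℙᶜ (¬ᶠ (x₀ ≼ᶠ x₁ ∧ᶠ x₀ ≼ᶠ con c₀ (M-trans ℙ∊M (G⊆ℙ c₀∊G)))))
      = conclude (meets D∊M (λ p → proj₁ (D⁻ p)) D-dense)
      where
      D-dense : ∀ {c} → c ∊ ℙ → Σ V λ d → d ∊ D × d ≼ c
      D-dense {c} c∊ℙ with dec (Σ V λ e → e ∊ ℙ × e ≼ c × e ≼ c₀)
      ... | yes (e , e∊ℙ , e≼c , e≼c₀) = let d , d∊ℙ , d≼e , p = dense e e∊ℙ e≼c₀ in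
            d , D⁺ d∊ℙ (inj₁ (D₁⁺ d∊ℙ p)) , ≼-trans d≼e e≼c
      ... | no ¬e = c , D⁺ c∊ℙ (inj₂ λ e e∊ℙ (p , q) → ¬e (e , e∊ℙ , p , q)) , ≼-refl c∊ℙ
      conclude : (Σ V λ c → c ∊ G × c ∊ D) → Σ V λ d → d ∊ G × ⟦ φ ⟧ (d ∷ [])
      conclude (c , c∊G , c∊D) with D⁻ c∊D
      ... | _ , inj₁ p = c , c∊G , proj₂ (D₁⁻ p)
      ... | _ , inj₂ p = let e , e∊G , q , r = directed c∊G c₀∊G in ⊥-elim (p e (G⊆ℙ e∊G) (q , r))

    generic : (φ : Fm 1) → (∀ c → c ∊ ℙ → Σ V λ d → d ∊ ℙ × d ≼ c × ⟦ φ ⟧ (d ∷ [])) → Σ V λ d → d ∊ G × ⟦ φ ⟧ (d ∷ [])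
    generic φ dense = generic-below (proj₂ nonempty) φ λ c c∊ℙ _ → dense c c∊ℙ

  module Equality (T : V) (T∊M : T ∊ M) (T-trans : ∀ {x y} → y ∊ T → x ∊ y → x ∊ T) where

    Tᶜ : ∀ {n} → Tm n
    Tᶜ = con T T∊M

    subname : ∀ {σ ρ d} → σ ∊ T → ⟨ ρ , d ⟩ ∊ σ → ρ ∊ T
    subname p q = T-trans (T-trans (T-trans p q) (∊⁅⁆ˡ ≋-refl)) (∊⁅⁆ˡ ≋-refl)

    -- A symmetric relation R such that, whenever (c , σ , τ) ∈ R, the condition
    -- c forces every element of σ to be R-related to an element of τ.  By
    -- well-foundedness, "c forces σ = τ" is the largest such relation; defining
    -- it in this way avoids recursion inside M.
    bisimulation : ∀ {n} → Fm (suc n)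
    bisimulation = ∀ᶠ∈ ℙᶜ (∀ᶠ∈ Tᶜ (∀ᶠ∈ Tᶜ (⟨ x₂ , ⟨ x₁ , x₀ ⟩ᵗ ⟩ᵗ ∈ᶠ x₃ ⇒ᶠ
      ⟨ x₂ , ⟨ x₀ , x₁ ⟩ᵗ ⟩ᵗ ∈ᶠ x₃ ∧ᶠ
      ∀ᶠ∈ Tᶜ (∀ᶠ∈ ℙᶜ (⟨ x₁ , x₀ ⟩ᵗ ∈ᶠ x₃ ⇒ᶠ ∀ᶠ∈ ℙᶜ (x₀ ≼ᶠ x₅ ⇒ᶠ x₀ ≼ᶠ x₁ ⇒ᶠ
        ∃ᶠ∈ ℙᶜ (∃ᶠ∈ Tᶜ (∃ᶠ∈ ℙᶜ (x₂ ≼ᶠ x₃ ∧ᶠ ⟨ x₁ , x₀ ⟩ᵗ ∈ᶠ x₆ ∧ᶠ x₂ ≼ᶠ x₀ ∧ᶠ ⟨ x₂ , ⟨ x₅ , x₁ ⟩ᵗ ⟩ᵗ ∈ᶠ x₉)))))))))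

    opaque

      -- The union of all bisimulations that belong to `M`. Maximality is thereby a single
      -- quantifier over elements of `M`, and separation applies.
      equality : Σ V λ Eq → Eq ∊ M ×
        (∀ {z} → z ∊ Eq → z ∊ ℙ ⊗ T ⊗ T × Σ V λ R → R ∊ M × z ∊ R × ⟦ bisimulation {0} ⟧ (R ∷ [])) ×
        (∀ {z} → z ∊ ℙ ⊗ T ⊗ T → (Σ V λ R → R ∊ M × z ∊ R × ⟦ bisimulation {0} ⟧ (R ∷ [])) → z ∊ Eq)
      equality = separate (⊗∊M ℙ∊M (⊗∊M T∊M T∊M)) (∃ᶠ (x₁ ∈ᶠ x₀ ∧ᶠ bisimulation))

    Eq : V
    Eq = proj₁ equality

    Eq∊M : Eq ∊ M
    Eq∊M = proj₁ (proj₂ equality)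

    infix 4 _⊩_≐_
    _⊩_≐_ : V → V → V → Set
    c ⊩ σ ≐ τ = ⟨ c , ⟨ σ , τ ⟩ ⟩ ∊ Eq

    opaque

      ⊩-bound : ∀ {c σ τ} → c ⊩ σ ≐ τ → c ∊ ℙ × σ ∊ T × τ ∊ T
      ⊩-bound p = let q = proj₁ (proj₁ (proj₂ (proj₂ equality)) p)
                  in ∊⊗⁻ˡ q , ∊⊗⁻ˡ (∊⊗⁻ʳ q) , ∊⊗⁻ʳ (∊⊗⁻ʳ q)

      ⊩-intro : ∀ {R c σ τ} → R ∊ M → ⟦ bisimulation {0} ⟧ (R ∷ []) → c ∊ ℙ → σ ∊ T → τ ∊ T →
                ⟨ c , ⟨ σ , τ ⟩ ⟩ ∊ R → c ⊩ σ ≐ τ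
      ⊩-intro {R} R∊M b c∊ℙ σ∊T τ∊T p = proj₂ (proj₂ (proj₂ equality)) (∊⊗⁺ c∊ℙ (∊⊗⁺ σ∊T τ∊T)) (R , R∊M , p , b)

      ⊩-sym : ∀ {c σ τ} → c ⊩ σ ≐ τ → c ⊩ τ ≐ σ
      ⊩-sym {c} {σ} {τ} p =
        let _ , R , R∊M , q , b = proj₁ (proj₂ (proj₂ equality)) p
            c∊ℙ , σ∊T , τ∊T = ⊩-bound p
        in ⊩-intro R∊M b c∊ℙ τ∊T σ∊T (proj₁ (b c c∊ℙ σ σ∊T τ τ∊T q))

      ⊩-step : ∀ {c σ τ ρ d e} → c ⊩ σ ≐ τ → ⟨ ρ , d ⟩ ∊ σ → d ∊ ℙ → e ∊ ℙ → e ≼ c → e ≼ d →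
        Σ V λ e' → e' ∊ ℙ × Σ V λ ρ' → ρ' ∊ T × Σ V λ d' → d' ∊ ℙ × e' ≼ e × ⟨ ρ' , d' ⟩ ∊ τ × e' ≼ d' × e' ⊩ ρ ≐ ρ'
      ⊩-step {c} {σ} {τ} {ρ} {d} {e} p q d∊ℙ e∊ℙ e≼c e≼d
        with _ , R , R∊M , r , b ← proj₁ (proj₂ (proj₂ equality)) p
        with c∊ℙ , σ∊T , τ∊T ← ⊩-bound p
        with e' , e'∊ℙ , ρ' , ρ'∊T , d' , d'∊ℙ , s , t , u , v ←
               proj₂ (b c c∊ℙ σ σ∊T τ τ∊T r) ρ (subname σ∊T q) d d∊ℙ q e e∊ℙ e≼c e≼d
        = e' , e'∊ℙ , ρ' , ρ'∊T , d' , d'∊ℙ , s , t , u , ⊩-intro R∊M b e'∊ℙ (subname σ∊T q) ρ'∊T v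

      -- `⊩-step` finds its witness densely, and `meet` moves it into `G` below a common extension
      -- of the conditions at hand. Symmetry gives the second inclusion, so induction on `σ` alone
      -- suffices.
      ⊩-sound : ∀ σ {τ c} (n : IsName ℙ σ) (n' : IsName ℙ τ) → c ∊ G → c ⊩ σ ≐ τ → val G n ≋ val G n'
      ⊩-sound = name-induction
        (λ σ → ∀ {τ c} (n : IsName ℙ σ) (n' : IsName ℙ τ) → c ∊ G → c ⊩ σ ≐ τ → val G n ≋ val G n') step
        where
        meet : ∀ {c σ τ ρ d} → IsName ℙ σ → c ∊ G → c ⊩ σ ≐ τ → ⟨ ρ , d ⟩ ∊ σ → d ∊ G →
          Σ V λ e → e ∊ G × Σ V λ ρ' → ρ' ∊ T × Σ V λ d' → d' ∊ ℙ × ⟨ ρ' , d' ⟩ ∊ τ × e ≼ d' × e ⊩ ρ ≐ ρ'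
        meet {c} {σ} {τ} {ρ} {d} n c∊G p q d∊G with e , e∊G , e≼c , e≼d ← directed c∊G d∊G
          = generic-below e∊G
              (∃ᶠ∈ Tᶜ (∃ᶠ∈ ℙᶜ (⟨ x₁ , x₀ ⟩ᵗ ∈ᶠ con τ (M-trans T∊M (proj₂ (proj₂ (⊩-bound p)))) ∧ᶠ x₂ ≼ᶠ x₀ ∧ᶠ
                ⟨ x₂ , ⟨ con ρ (M-trans T∊M (subname (proj₁ (proj₂ (⊩-bound p))) q)) , x₁ ⟩ᵗ ⟩ᵗ ∈ᶠ con Eq Eq∊M)))
              (λ b b∊ℙ b≼e → let e' , e'∊ℙ , ρ' , ρ'∊T , d' , d'∊ℙ , s , t , u , v =
                                   ⊩-step p q (G⊆ℙ d∊G) b∊ℙ (≼-trans b≼e e≼c) (≼-trans b≼e e≼d)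
                             in e' , e'∊ℙ , s , ρ' , ρ'∊T , d' , d'∊ℙ , t , u , v)
        step : ∀ σ → (∀ ρ d → ⟨ ρ , d ⟩ ∊ σ → ∀ {τ c} (n : IsName ℙ ρ) (n' : IsName ℙ τ) → c ∊ G → c ⊩ ρ ≐ τ → val G n ≋ val G n') →
          ∀ {τ c} (n : IsName ℙ σ) (n' : IsName ℙ τ) → c ∊ G → c ⊩ σ ≐ τ → val G n ≋ val G n'
        step σ ih {τ} {c} n n' c∊G p = ≋-ext
          (λ y y∊ → let ρ , d , q , d∊G , m , y≋ = ∊val⁻ n y∊
                        e , e∊G , ρ' , ρ'∊T , d' , d'∊ℙ , r , e≼d' , s = meet n c∊G p q d∊G
                        m' = proj₂ (name-elim n' r)
                    in ∊-respˡ (≋-sym (≋-trans y≋ (ih ρ d q m m' e∊G s))) (∊val⁺ n' m' r (upward e∊G d'∊ℙ e≼d')))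
          (λ y y∊ → let ρ , d , q , d∊G , m , y≋ = ∊val⁻ n' y∊
                        e , e∊G , ρ' , ρ'∊T , d' , d'∊ℙ , r , e≼d' , s = meet n' c∊G (⊩-sym p) q d∊G
                        m' = proj₂ (name-elim n r)
                    in ∊-respˡ (≋-trans (ih ρ' d' r m' m e∊G (⊩-sym s)) (≋-sym y≋)) (∊val⁺ n m' r (upward e∊G d'∊ℙ e≼d')))

    -- Some element of σ is forced by the condition x₀ to differ from every element of τ.
    separated : ∀ {σ τ} → σ ∊ M → τ ∊ M → Fm 1
    separated {σ} {τ} σ∊M τ∊M = ∃ᶠ∈ Tᶜ (∃ᶠ∈ ℙᶜ (⟨ x₁ , x₀ ⟩ᵗ ∈ᶠ con σ σ∊M ∧ᶠ x₂ ≼ᶠ x₀ ∧ᶠ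
      ∀ᶠ∈ ℙᶜ (x₀ ≼ᶠ x₃ ⇒ᶠ ∀ᶠ∈ Tᶜ (∀ᶠ∈ ℙᶜ (⟨ x₁ , x₀ ⟩ᵗ ∈ᶠ con τ τ∊M ⇒ᶠ x₂ ≼ᶠ x₀ ⇒ᶠ
        ¬ᶠ (⟨ x₂ , ⟨ x₄ , x₁ ⟩ᵗ ⟩ᵗ ∈ᶠ con Eq Eq∊M))))))

    opaque

      -- If no extension of `c` separates the two names in either direction, then `Eq` stays a
      -- bisimulation after adding both ordered pairs of them at every `a ≼ c`. Hence the additions
      -- were already below the largest one.
      ⊩-dense : ∀ {σ τ} (σ∊T : σ ∊ T) (τ∊T : τ ∊ T) c → c ∊ ℙ →
        (∀ e → e ∊ ℙ → e ≼ c → ¬ ⟦ separated (M-trans T∊M σ∊T) (M-trans T∊M τ∊T) ⟧ (e ∷ [])) →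
        (∀ e → e ∊ ℙ → e ≼ c → ¬ ⟦ separated (M-trans T∊M τ∊T) (M-trans T∊M σ∊T) ⟧ (e ∷ [])) → c ⊩ σ ≐ τ
      ⊩-dense {σ} {τ} σ∊T τ∊T c c∊ℙ agree agree'
        with R , R∊M , R⁻ , R⁺ ← separate (⊗∊M ℙ∊M (⊗∊M T∊M T∊M)) (x₀ ∈ᶠ con Eq Eq∊M ∨ᶠ
               ∃ᶠ∈ ℙᶜ (x₀ ≼ᶠ con c (M-trans ℙ∊M c∊ℙ) ∧ᶠ
                 (x₁ ≈ᶠ ⟨ x₀ , ⟨ con σ (M-trans T∊M σ∊T) , con τ (M-trans T∊M τ∊T) ⟩ᵗ ⟩ᵗ ∨ᶠ
                  x₁ ≈ᶠ ⟨ x₀ , ⟨ con τ (M-trans T∊M τ∊T) , con σ (M-trans T∊M σ∊T) ⟩ᵗ ⟩ᵗ)))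
        = ⊩-intro R∊M bisim c∊ℙ σ∊T τ∊T (R⁺ (∊⊗⁺ c∊ℙ (∊⊗⁺ σ∊T τ∊T)) (inj₂ (c , c∊ℙ , ≼-refl c∊ℙ , inj₁ ≋-refl)))
        where
        Next : V → V → V → Set₁
        Next ρ τ' e = Σ V λ e' → e' ∊ ℙ × Σ V λ ρ' → ρ' ∊ T × Σ V λ d' → d' ∊ ℙ ×
          e' ≼ e × ⟨ ρ' , d' ⟩ ∊ τ' × e' ≼ d' × ⟨ e' , ⟨ ρ , ρ' ⟩ ⟩ ∊ R
        next : ∀ {σ' τ'} (σ'∊T : σ' ∊ T) (τ'∊T : τ' ∊ T) →
          (∀ e → e ∊ ℙ → e ≼ c → ¬ ⟦ separated (M-trans T∊M σ'∊T) (M-trans T∊M τ'∊T) ⟧ (e ∷ [])) →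
          ∀ {ρ d e} → ⟨ ρ , d ⟩ ∊ σ' → d ∊ ℙ → e ∊ ℙ → e ≼ c → e ≼ d → Next ρ τ' e
        next {σ'} {τ'} σ'∊T τ'∊T ag {ρ} {d} {e} p d∊ℙ e∊ℙ e≼c e≼d = stable (Next ρ τ' e) λ ¬next →
          ag e e∊ℙ e≼c (ρ , subname σ'∊T p , d , d∊ℙ , p , e≼d , λ e' e'∊ℙ e'≼e ρ' ρ'∊T d' d'∊ℙ q e'≼d' r →
            ¬next (e' , e'∊ℙ , ρ' , ρ'∊T , d' , d'∊ℙ , e'≼e , q , e'≼d' ,
              R⁺ (∊⊗⁺ e'∊ℙ (∊⊗⁺ (subname σ'∊T p) ρ'∊T)) (inj₁ r)))
        bisim : ⟦ bisimulation {0} ⟧ (R ∷ [])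
        bisim c₁ c₁∊ℙ σ₁ σ₁∊T τ₁ τ₁∊T p with R⁻ p
        ... | _ , inj₁ q = R⁺ (∊⊗⁺ c₁∊ℙ (∊⊗⁺ τ₁∊T σ₁∊T)) (inj₁ (⊩-sym q)) , λ ρ ρ∊T d d∊ℙ r e e∊ℙ e≼c₁ e≼d →
              let e' , e'∊ℙ , ρ' , ρ'∊T , d' , d'∊ℙ , s , t , u , v = ⊩-step q r d∊ℙ e∊ℙ e≼c₁ e≼d
              in e' , e'∊ℙ , ρ' , ρ'∊T , d' , d'∊ℙ , s , t , u , R⁺ (∊⊗⁺ e'∊ℙ (∊⊗⁺ ρ∊T ρ'∊T)) (inj₁ v)
        ... | _ , inj₂ (a , a∊ℙ , a≼c , inj₁ q) =
              let c₁≋a , r = ⟨⟩-injective q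
                  σ₁≋σ , τ₁≋τ = ⟨⟩-injective r
              in R⁺ (∊⊗⁺ c₁∊ℙ (∊⊗⁺ τ₁∊T σ₁∊T)) (inj₂ (a , a∊ℙ , a≼c , inj₂ (⟨⟩-cong c₁≋a (⟨⟩-cong τ₁≋τ σ₁≋σ)))) ,
                 λ ρ ρ∊T d d∊ℙ s e e∊ℙ e≼c₁ e≼d →
                   let e' , e'∊ℙ , ρ' , ρ'∊T , d' , d'∊ℙ , s , t , u , v =
                         next σ∊T τ∊T agree (∊-respʳ σ₁≋σ s) d∊ℙ e∊ℙ (≼-trans (∊-respˡ (⟨⟩-cong ≋-refl c₁≋a) e≼c₁) a≼c) e≼d
                   in e' , e'∊ℙ , ρ' , ρ'∊T , d' , d'∊ℙ , s , ∊-respʳ (≋-sym τ₁≋τ) t , u , v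
        ... | _ , inj₂ (a , a∊ℙ , a≼c , inj₂ q) =
              let c₁≋a , r = ⟨⟩-injective q
                  σ₁≋τ , τ₁≋σ = ⟨⟩-injective r
              in R⁺ (∊⊗⁺ c₁∊ℙ (∊⊗⁺ τ₁∊T σ₁∊T)) (inj₂ (a , a∊ℙ , a≼c , inj₁ (⟨⟩-cong c₁≋a (⟨⟩-cong τ₁≋σ σ₁≋τ)))) ,
                 λ ρ ρ∊T d d∊ℙ s e e∊ℙ e≼c₁ e≼d →
                   let e' , e'∊ℙ , ρ' , ρ'∊T , d' , d'∊ℙ , s , t , u , v =
                         next τ∊T σ∊T agree' (∊-respʳ σ₁≋τ s) d∊ℙ e∊ℙ (≼-trans (∊-respˡ (⟨⟩-cong ≋-refl c₁≋a) e≼c₁) a≼c) e≼d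
                   in e' , e'∊ℙ , ρ' , ρ'∊T , d' , d'∊ℙ , s , ∊-respʳ (≋-sym τ₁≋σ) t , u , v

      ⊩-resp : ∀ {c c' σ τ} → c' ∊ ℙ → c' ≼ c → c ⊩ σ ≐ τ → c' ⊩ σ ≐ τ
      ⊩-resp {c} {c'} {σ} {τ} c'∊ℙ c'≼c p with _ , σ∊T , τ∊T ← ⊩-bound p =
        ⊩-dense σ∊T τ∊T c' c'∊ℙ (below {σ∊M = M-trans T∊M σ∊T} {M-trans T∊M τ∊T} p) (below {σ∊M = M-trans T∊M τ∊T} {M-trans T∊M σ∊T} (⊩-sym p))
        where
        below : ∀ {σ τ} {σ∊M : σ ∊ M} {τ∊M : τ ∊ M} → c ⊩ σ ≐ τ → ∀ e → e ∊ ℙ → e ≼ c' → ¬ ⟦ separated σ∊M τ∊M ⟧ (e ∷ [])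
        below q e e∊ℙ e≼c' (ρ , ρ∊T , d , d∊ℙ , r , e≼d , sep) =
          let e' , e'∊ℙ , ρ' , ρ'∊T , d' , d'∊ℙ , s , t , u , v = ⊩-step q r d∊ℙ e∊ℙ (≼-trans e≼c' c'≼c) e≼d
          in sep e' e'∊ℙ s ρ' ρ'∊T d' d'∊ℙ t u v

      -- Densely often a condition forces equality or separates one name from the other. A
      -- separating condition in `G` would exhibit an element of one value that, by the induction
      -- hypothesis, is not in the other.
      ⊩-complete : ∀ σ {τ} (n : IsName ℙ σ) (n' : IsName ℙ τ) → σ ∊ T → τ ∊ T → val G n ≋ val G n' →
        Σ V λ c → c ∊ G × c ⊩ σ ≐ τ
      ⊩-complete = name-induction
        (λ σ → ∀ {τ} (n : IsName ℙ σ) (n' : IsName ℙ τ) → σ ∊ T → τ ∊ T → val G n ≋ val G n' → Σ V λ c → c ∊ G × c ⊩ σ ≐ τ)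
        λ σ ih {τ} n n' σ∊T τ∊T eq → step σ ih n n' σ∊T τ∊T eq
        where
        refute : ∀ {σ τ c ρ d} (n : IsName ℙ σ) (n' : IsName ℙ τ) → τ ∊ T → val G n ≋ val G n' →
          (∀ ρ' d' → ⟨ ρ' , d' ⟩ ∊ τ → (m : IsName ℙ ρ) (m' : IsName ℙ ρ') → val G m ≋ val G m' → Σ V λ e → e ∊ G × e ⊩ ρ ≐ ρ') →
          c ∊ G → d ∊ ℙ → ⟨ ρ , d ⟩ ∊ σ → c ≼ d →
          (∀ e → e ∊ ℙ → e ≼ c → ∀ ρ' → ρ' ∊ T → ∀ d' → d' ∊ ℙ → ⟨ ρ' , d' ⟩ ∊ τ → e ≼ d' → ¬ (e ⊩ ρ ≐ ρ')) → ⊥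
        refute n n' τ∊T eq ih c∊G d∊ℙ p c≼d apart
          with m ← proj₂ (name-elim n p)
          with ρ' , d' , q , d'∊G , m' , eq' ← ∊val⁻ n' (∊-respʳ eq (∊val⁺ n m p (upward c∊G d∊ℙ c≼d)))
          with e , e∊G , r ← ih ρ' d' q m m' eq'
          with a , a∊G , a≼c , a≼d' ← directed c∊G d'∊G
          with b , b∊G , b≼a , b≼e ← directed a∊G e∊G
          = apart b (G⊆ℙ b∊G) (≼-trans b≼a a≼c) ρ' (subname τ∊T q) d' (G⊆ℙ d'∊G) q (≼-trans b≼a a≼d') (⊩-resp (G⊆ℙ b∊G) b≼e r)
        step : ∀ σ → (∀ ρ d → ⟨ ρ , d ⟩ ∊ σ → ∀ {τ} (n : IsName ℙ ρ) (n' : IsName ℙ τ) → ρ ∊ T → τ ∊ T →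
                        val G n ≋ val G n' → Σ V λ c → c ∊ G × c ⊩ ρ ≐ τ) →
          ∀ {τ} (n : IsName ℙ σ) (n' : IsName ℙ τ) → σ ∊ T → τ ∊ T → val G n ≋ val G n' → Σ V λ c → c ∊ G × c ⊩ σ ≐ τ
        step σ ih {τ} n n' σ∊T τ∊T eq = conclude (generic
            (⟨ x₀ , ⟨ con σ (M-trans T∊M σ∊T) , con τ (M-trans T∊M τ∊T) ⟩ᵗ ⟩ᵗ ∈ᶠ con Eq Eq∊M ∨ᶠ
              (separated (M-trans T∊M σ∊T) (M-trans T∊M τ∊T) ∨ᶠ separated (M-trans T∊M τ∊T) (M-trans T∊M σ∊T))) dense)
          where
          Apart Apart' : V → Set₁
          Apart c = ⟦ separated (M-trans T∊M σ∊T) (M-trans T∊M τ∊T) ⟧ (c ∷ [])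
          Apart' c = ⟦ separated (M-trans T∊M τ∊T) (M-trans T∊M σ∊T) ⟧ (c ∷ [])
          dense : ∀ c → c ∊ ℙ → Σ V λ d → d ∊ ℙ × d ≼ c × (d ⊩ σ ≐ τ ⊎ (Apart d ⊎ Apart' d))
          dense c c∊ℙ with dec (Σ V λ e → e ∊ ℙ × e ≼ c × (Apart e ⊎ Apart' e))
          ... | yes (e , e∊ℙ , e≼c , p) = e , e∊ℙ , e≼c , inj₂ p
          ... | no ¬p = c , c∊ℙ , ≼-refl c∊ℙ , inj₁ (⊩-dense σ∊T τ∊T c c∊ℙ
                (λ e e∊ℙ e≼c p → ¬p (e , e∊ℙ , e≼c , inj₁ p)) (λ e e∊ℙ e≼c p → ¬p (e , e∊ℙ , e≼c , inj₂ p)))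
          conclude : (Σ V λ c → c ∊ G × (c ⊩ σ ≐ τ ⊎ (Apart c ⊎ Apart' c))) → Σ V λ c → c ∊ G × c ⊩ σ ≐ τ
          conclude (c , c∊G , inj₁ p) = c , c∊G , p
          conclude (c , c∊G , inj₂ (inj₁ (ρ , ρ∊T , d , d∊ℙ , p , c≼d , apart))) = ⊥-elim (refute n n' τ∊T eq
            (λ ρ' d' q m m' → ih ρ d p m m' ρ∊T (subname τ∊T q)) c∊G d∊ℙ p c≼d apart)
          conclude (c , c∊G , inj₂ (inj₂ (ρ , ρ∊T , d , d∊ℙ , p , c≼d , apart))) = ⊥-elim (refute n' n σ∊T (≋-sym eq)
            (λ ρ' d' q m m' eq' → let e , e∊G , r = ih ρ' d' q m' m (subname σ∊T q) ρ∊T (≋-sym eq') in e , e∊G , ⊩-sym r)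
            c∊G d∊ℙ p c≼d apart)


-- Conditions

bit : Bool → V
bit b = if b then num 1 else num 0

opaque

  bit-injective : ∀ {b b'} → bit b ≋ bit b' → b ≡ b'
  bit-injective {true} {true} p = refl
  bit-injective {false} {false} p = refl
  bit-injective {true} {false} p with () ← num-injective {1} {0} p
  bit-injective {false} {true} p with () ← num-injective {0} {1} p

  bit∊2 : ∀ b → bit b ∊ num 2
  bit∊2 true = ∊num {1} {2} (s≤s (s≤s z≤n))
  bit∊2 false = ∊num {0} {2} (s≤s z≤n)

  ∊2⁻ : ∀ {x} → x ∊ num 2 → Σ Bool λ b → x ≋ bit b
  ∊2⁻ p with ∊num⁻ {2} p
  ... | 0 , _ , q = false , q
  ... | 1 , _ , q = true , q
  ... | suc (suc _) , s≤s (s≤s ()) , _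

infix 4 _∈ˡ_
_∈ˡ_ : V → List V → Set₁
γ ∈ˡ xs = Any (γ ≋_) xs

∈ˡ-resp : ∀ {γ γ' xs} → γ ≋ γ' → γ ∈ˡ xs → γ' ∈ˡ xs
∈ˡ-resp p = Any.map (≋-trans (≋-sym p))

-- For a condition c = (p , q): γ ∈ dom p, p(γ)(i) = b, and q({α,β}) = k.

opaque

  Dom : V → V → Set₁
  Dom c γ = Σ V λ p → Σ V λ q → c ≋ ⟨ p , q ⟩ × Σ V λ y → ⟨ γ , y ⟩ ∊ p

  Bit : V → V → ℕ → Bool → Set₁
  Bit c γ i b = Σ V λ p → Σ V λ q → c ≋ ⟨ p , q ⟩ × Σ V λ y → ⟨ γ , y ⟩ ∊ p × ⟨ num i , bit b ⟩ ∊ y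

  Link : V → V → V → ℕ → Set₁
  Link c α β k = Σ V λ p → Σ V λ q → c ≋ ⟨ p , q ⟩ × ⟨ ⁅ α , β ⁆ , num k ⟩ ∊ q

opaque
  unfolding Dom Bit Link

  Bit⇒Dom : ∀ {c γ i b} → Bit c γ i b → Dom c γ
  Bit⇒Dom (p , q , r , y , s , _) = p , q , r , y , s

  Dom-resp : ∀ {c c' γ γ'} → c ≋ c' → γ ≋ γ' → Dom c γ → Dom c' γ'
  Dom-resp e f (p , q , r , y , s) = p , q , ≋-trans (≋-sym e) r , y , ∊-respˡ (⟨⟩-cong f ≋-refl) s

  Bit-resp : ∀ {c c' γ γ' i b} → c ≋ c' → γ ≋ γ' → Bit c γ i b → Bit c' γ' i b
  Bit-resp e f (p , q , r , y , s , t) = p , q , ≋-trans (≋-sym e) r , y , ∊-respˡ (⟨⟩-cong f ≋-refl) s , t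

  Link-resp : ∀ {c c' α α' β β' k} → c ≋ c' → α ≋ α' → β ≋ β' → Link c α β k → Link c' α' β' k
  Link-resp e f g (p , q , r , s) = p , q , ≋-trans (≋-sym e) r , ∊-respˡ (⟨⟩-cong (⁅⁆-cong f g) ≋-refl) s

  Link-sym : ∀ {c α β k} → Link c α β k → Link c β α k
  Link-sym (p , q , r , s) = p , q , r , ∊-respˡ (⟨⟩-cong ⁅⁆-comm ≋-refl) s

-- On conditions this is `_≤_`, but stated through facts invariant under bisimilarity instead of
-- chosen components, so that it composes directly.
record Extends (d c : V) : Set₁ where
  constructor extends
  field
    doms  : ∀ {γ} → Dom c γ → Dom d γ
    bits  : ∀ {γ i b} → Bit c γ i b → Bit d γ i b
    links : ∀ {α β k} → Link c α β k → Link d α β k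

Extends-refl : ∀ {c} → Extends c c
Extends-refl = extends (λ x → x) (λ x → x) (λ x → x)

Extends-trans : ∀ {c d e} → Extends c d → Extends d e → Extends c e
Extends-trans (extends a b c) (extends a' b' c') = extends (λ x → a (a' x)) (λ x → b (b' x)) (λ x → c (c' x))

-- What the arguments use of a condition, with numerals turned into natural numbers and the finite
-- domain into a list. The components `p` and `q` remain only to pass between `Extends` and `_≤_`.
record View (κ c : V) : Set₁ where
  field
    p q      : V
    c≋       : c ≋ ⟨ p , q ⟩
    p-elem   : ∀ {z} → z ∊ p → Σ V λ γ → Σ V λ y → z ≋ ⟨ γ , y ⟩
    p-unique : ∀ {γ y y'} → ⟨ γ , y ⟩ ∊ p → ⟨ γ , y' ⟩ ∊ p → y ≋ y'
    y-elem   : ∀ {γ y w} → ⟨ γ , y ⟩ ∊ p → w ∊ y → Σ ℕ λ i → Σ Bool λ b → w ≋ ⟨ num i , bit b ⟩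
    q-elem   : ∀ {z} → z ∊ q → Σ V λ α → Σ V λ β → Σ ℕ λ k → z ≋ ⟨ ⁅ α , β ⁆ , num k ⟩
    support  : List V
    height   : ℕ
    Dom⇒     : ∀ {γ} → Dom c γ → γ ∈ˡ support
    ⇒Dom     : ∀ {γ} → γ ∈ˡ support → Dom c γ
    Dom⊆κ    : ∀ {γ} → Dom c γ → γ ∊ κ
    Bit-total   : ∀ {γ i} → Dom c γ → i <ⁿ height → Σ Bool λ b → Bit c γ i b
    Bit-bound   : ∀ {γ i b} → Bit c γ i b → i <ⁿ height
    Bit-unique  : ∀ {γ i b b'} → Bit c γ i b → Bit c γ i b' → b ≡ b'
    Link-unique : ∀ {α β k k'} → Link c α β k → Link c α β k' → k ≡ k'
    Link-dom    : ∀ {α β k} → Link c α β k → Dom c α × Dom c β × ¬ (α ≋ β) × k <ⁿ height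
    Link-disjoint : ∀ {α β k i} → Link c α β k → k ≤ⁿ i → i <ⁿ height → Bit c α i false ⊎ Bit c β i false

opaque
  unfolding Dom Bit Link

  view : ∀ {κ c} → IsCondition κ c → View κ c
  view {κ} {c} cond = record
    { p = p ; q = q ; c≋ = ≋-in pair
    ; p-elem = λ z∊p → let x , y , _ , _ , r = P.graph _ (∊-out z∊p) in x , y , ≋-in r
    ; p-unique = λ {γ} {y} {y'} a b → ≋-in (P.unique γ y y' (∊-out a) (∊-out b))
    ; y-elem = λ a w∊y → elem (column a) w∊y
    ; q-elem = λ z∊q → let α , β , k , _ , _ , _ , _ , r = edge z∊q in α , β , k , r
    ; support = tabulate xs
    ; height = n
    ; Dom⇒ = λ d → let y , a = dom-p d ; i , r = in-F (proj₁ (row a)) in Anyₚ.tabulate⁺ i r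
    ; ⇒Dom = λ a → let i , r = Anyₚ.tabulate⁻ a ; y , b = P.total _ (∊-out (in-F⁻ i r)) in p , q , ≋-in pair , y , ∊-in b
    ; Dom⊆κ = λ d → let y , a = dom-p d in in-κ (proj₁ (row a))
    ; Bit-total = total
    ; Bit-bound = λ (p' , q' , r , y , a , b) → bound (column (p-resp r a)) b
    ; Bit-unique = λ {γ} {i} {b} {b'} (p' , q' , r , y , s , t) (p'' , q'' , r' , y' , s' , t') →
        bit-injective (≋-in (_⟶_.unique (column (p-resp r s)) (num i) (bit b) (bit b') (∊-out t)
          (∊-out (∊-respʳ (≋-in (P.unique γ y' y (∊-out (p-resp r' s')) (∊-out (p-resp r s)))) t'))))
    ; Link-unique = λ (p' , q' , r , s) (p'' , q'' , r' , s') →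
        num-injective (≋-in (Q.unique _ _ _ (∊-out (q-resp r s)) (∊-out (q-resp r' s'))))
    ; Link-dom = links
    ; Link-disjoint = disj
    }
    where
    open IsCondition cond
    module P = _⟶_ p-function
    module Q = _⟶_ q-function
    n : ℕ
    n = proj₁ (∊ω⁻ (∊-in N∈ω))
    N≋n : N ≋ num n
    N≋n = proj₂ (∊ω⁻ (∊-in N∈ω))
    xs : Fin (proj₁ F-finite) → V
    xs = proj₁ (proj₂ F-finite)
    in-F : ∀ {γ} → γ ∊ F → Σ (Fin (proj₁ F-finite)) λ i → γ ≋ xs i
    in-F a = index {y = sup _ xs} (∊-respʳ (≋-in (proj₂ (proj₂ F-finite))) a)
    in-F⁻ : ∀ {γ} i → γ ≋ xs i → γ ∊ F
    in-F⁻ i r = ∊-respʳ (≋-sym (≋-in (proj₂ (proj₂ F-finite)))) (∊-index {y = sup _ xs} i r)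
    in-κ : ∀ {γ} → γ ∊ F → γ ∊ κ
    in-κ a = let i , r = index a in ∊-respˡ (≋-sym r) (∊-in (F⊆κ i))
    p-resp : ∀ {p' q' z} → c ≋ ⟨ p' , q' ⟩ → z ∊ p' → z ∊ p
    p-resp r = ∊-respʳ (proj₁ (⟨⟩-injective (≋-trans (≋-sym r) (≋-in pair))))
    q-resp : ∀ {p' q' z} → c ≋ ⟨ p' , q' ⟩ → z ∊ q' → z ∊ q
    q-resp r = ∊-respʳ (proj₂ (⟨⟩-injective (≋-trans (≋-sym r) (≋-in pair))))
    dom-p : ∀ {γ} → Dom c γ → Σ V λ y → ⟨ γ , y ⟩ ∊ p
    dom-p (p' , q' , r , y , a) = y , p-resp r a
    row : ∀ {γ y} → ⟨ γ , y ⟩ ∊ p → γ ∊ F × Σ V λ y' → (N ⟶ (_∈ num 2)) y' × y ≋ y'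
    row a = let x , y' , b , f , r = P.graph _ (∊-out a)
                s , t = ⟨⟩-injective (≋-in r)
            in ∊-respˡ (≋-sym s) (∊-in b) , y' , f , t
    ⟶-resp : ∀ {y y'} → y ≋ y' → (N ⟶ (_∈ num 2)) y' → (N ⟶ (_∈ num 2)) y
    ⟶-resp r f = record
      { graph = λ z a → _⟶_.graph f z (∊-out (∊-respʳ r (∊-in a)))
      ; total = λ x a → let w , b = _⟶_.total f x a in w , ∊-out (∊-respʳ (≋-sym r) (∊-in b))
      ; unique = λ x w w' a b → _⟶_.unique f x w w' (∊-out (∊-respʳ r (∊-in a))) (∊-out (∊-respʳ r (∊-in b))) }
    column : ∀ {γ y} → ⟨ γ , y ⟩ ∊ p → (N ⟶ (_∈ num 2)) y
    column a = let _ , y' , f , r = row a in ⟶-resp r f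
    elem : ∀ {y w} → (N ⟶ (_∈ num 2)) y → w ∊ y → Σ ℕ λ i → Σ Bool λ b → w ≋ ⟨ num i , bit b ⟩
    elem f a = let x , v , b , d , r = _⟶_.graph f _ (∊-out a)
                   i , _ , x≋i = ∊num⁻ (∊-respʳ N≋n (∊-in b))
                   b' , v≋b = ∊2⁻ (∊-in d)
               in i , b' , ≋-trans (≋-in r) (⟨⟩-cong x≋i v≋b)
    bound : ∀ {y i v} → (N ⟶ (_∈ num 2)) y → ⟨ num i , v ⟩ ∊ y → i <ⁿ n
    bound f a = let x , v , b , d , r = _⟶_.graph f _ (∊-out a)
                in num∊num (∊-resp (≋-sym (proj₁ (⟨⟩-injective (≋-in r)))) N≋n (∊-in b))
    total : ∀ {γ i} → Dom c γ → i <ⁿ n → Σ Bool λ b → Bit c γ i b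
    total {γ} {i} d i<n =
      let y , a = dom-p d
          v , b = _⟶_.total (column a) (num i) (∊-out (∊-respʳ (≋-sym N≋n) (∊num i<n)))
          x , v' , _ , v'∈2 , r = _⟶_.graph (column a) _ b
          b' , v≋b = ∊2⁻ (∊-respˡ (≋-sym (proj₂ (⟨⟩-injective (≋-in r)))) (∊-in v'∈2))
      in b' , p , q , ≋-in pair , y , a , ∊-respˡ (⟨⟩-cong ≋-refl v≋b) (∊-in {y = y} b)
    edge : ∀ {z} → z ∊ q → Σ V λ α → Σ V λ β → Σ ℕ λ k → α ∊ F × β ∊ F × ¬ (α ≋ β) × k <ⁿ n × z ≋ ⟨ ⁅ α , β ⁆ , num k ⟩
    edge a = let x , v , x∈E , v∈N , r = Q.graph _ (∊-out a)
                 α , β , α∈F , β∈F , α≉β , s = E⊆[F]² x x∈E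
                 k , k<n , v≋k = ∊num⁻ (∊-respʳ N≋n (∊-in v∈N))
             in α , β , k , ∊-in α∈F , ∊-in β∈F , (λ t → α≉β (≋-out t)) , k<n , ≋-trans (≋-in r) (⟨⟩-cong (≋-in s) v≋k)
    F⇒Dom : ∀ {γ} → γ ∊ F → Dom c γ
    F⇒Dom a = let y , b = P.total _ (∊-out a) in p , q , ≋-in pair , y , ∊-in b
    links : ∀ {α β k} → Link c α β k → Dom c α × Dom c β × ¬ (α ≋ β) × k <ⁿ n
    links (p' , q' , r , s) with edge (q-resp r s)
    ... | α' , β' , k' , α'∊F , β'∊F , α'≉β' , k'<n , t with ⟨⟩-injective t
    ...   | u , v with num-injective v
    ...     | refl with ⁅⁆-injective u
    ...       | inj₁ (a , b) = F⇒Dom (∊-respˡ (≋-sym a) α'∊F) , F⇒Dom (∊-respˡ (≋-sym b) β'∊F) ,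
                               (λ w → α'≉β' (≋-trans (≋-sym a) (≋-trans w b))) , k'<n
    ...       | inj₂ (a , b) = F⇒Dom (∊-respˡ (≋-sym a) β'∊F) , F⇒Dom (∊-respˡ (≋-sym b) α'∊F) ,
                               (λ w → α'≉β' (≋-trans (≋-sym b) (≋-trans (≋-sym w) a))) , k'<n
    zero-bit : ∀ {α i} → ⟨ num i , num 0 ⟩ ∈ p ′ α → Bit c α i false
    zero-bit {α} a = let y , b , d = ∊′⁻ {p} {α} (∊-in a) in p , q , ≋-in pair , y , b , d
    disj : ∀ {α β k i} → Link c α β k → k ≤ⁿ i → i <ⁿ n → Bit c α i false ⊎ Bit c β i false
    disj {α} {β} {k} {i} (p' , q' , r , s) k≤i i<n with disjoint α β (num k) (∊-out (q-resp r s)) (num i)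
           (λ j → let m , m<k , t = ∊num⁻ {k} (el∊ (num k) j) in
             ∊-out (∊-respˡ (≋-sym t) (∊num (ℕₚ.<-≤-trans m<k k≤i)))) (∊-out (∊-respʳ (≋-sym N≋n) (∊num i<n)))
    ... | inj₁ a = inj₁ (zero-bit a)
    ... | inj₂ a = inj₂ (zero-bit a)

  ≤⇒Extends : ∀ {c d} → d ≤ c → Extends d c
  ≤⇒Extends {c} {d} le = extends
      (λ {γ} (p , q , r , y , a) → let y' , b = ∊dom⁻ (dom⊆ (∊dom⁺ (p-resp r a))) in p₁ , q₁ , ≋-in pair₁ , y' , b)
      (λ {γ} (p , q , r , y , a , b) →
        let y' , a' , b' = ∊′⁻ {p₁} {γ} (val⊆ (∊dom⁺ (p-resp r a)) (∊′⁺ (p-resp r a) b)) in p₁ , q₁ , ≋-in pair₁ , y' , a' , b')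
      (λ (p , q , r , a) → p₁ , q₁ , ≋-in pair₁ , q⊆ (q-resp r a))
    where
    open _≤_ le
    p-resp : ∀ {p' q' z} → c ≋ ⟨ p' , q' ⟩ → z ∊ p' → z ∊ p₂
    p-resp r = ∊-respʳ (proj₁ (⟨⟩-injective (≋-trans (≋-sym r) (≋-in pair₂))))
    q-resp : ∀ {p' q' z} → c ≋ ⟨ p' , q' ⟩ → z ∊ q' → z ∊ q₂
    q-resp r = ∊-respʳ (proj₂ (⟨⟩-injective (≋-trans (≋-sym r) (≋-in pair₂))))
    sub : ∀ x y → x ⊆ y → ∀ {z} → z ∊ x → z ∊ y
    sub x y x⊆y a = let i , r = index a in ∊-respˡ (≋-sym r) (∊-in (x⊆y i))
    dom⊆ : ∀ {γ} → γ ∊ dom p₂ → γ ∊ dom p₁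
    dom⊆ = sub (dom p₂) (dom p₁) dom-⊇
    val⊆ : ∀ {γ z} → γ ∊ dom p₂ → z ∊ p₂ ′ γ → z ∊ p₁ ′ γ
    val⊆ {γ} a = sub (p₂ ′ γ) (p₁ ′ γ) (p-⊇ γ (∊-out a))
    q⊆ : ∀ {z} → z ∊ q₂ → z ∊ q₁
    q⊆ = sub q₂ q₁ q-⊇

  Extends⇒≤ : ∀ {κ c d} → View κ c → View κ d → Extends d c → d ≤ c
  Extends⇒≤ {κ} {c} {d} C D (extends dm bt lk) = record
    { p₁ = D.p ; q₁ = D.q ; p₂ = C.p ; q₂ = C.q ; pair₁ = ≋-out D.c≋ ; pair₂ = ≋-out C.c≋
    ; dom-⊇ = λ i → let y , a = ∊dom⁻ (el∊ (dom C.p) i)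
                        p' , q' , r , y' , b = dm (C.p , C.q , C.c≋ , y , a)
                    in ∊-out (∊dom⁺ (p-resp r b))
    ; p-⊇ = λ γ _ i → let y , a , b = ∊′⁻ {C.p} {γ} (el∊ (C.p ′ γ) i)
                          j , b' , w≋ = C.y-elem a b
                          p' , q' , r , y' , s , t = bt {γ} {j} {b'} (C.p , C.q , C.c≋ , y , a , ∊-respˡ w≋ b)
                      in ∊-out (∊-respˡ (≋-sym w≋) (∊′⁺ (p-resp r s) t))
    ; q-⊇ = λ i → let α , β , k , z≋ = C.q-elem (el∊ C.q i)
                      p' , q' , r , s = lk {α} {β} {k} (C.p , C.q , C.c≋ , ∊-respˡ z≋ (el∊ C.q i))
                  in ∊-out (∊-respˡ (≋-sym z≋) (q-resp r s)) }
    where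
    module C = View C
    module D = View D
    p-resp : ∀ {p' q' z} → d ≋ ⟨ p' , q' ⟩ → z ∊ p' → z ∊ D.p
    p-resp r = ∊-respʳ (proj₁ (⟨⟩-injective (≋-trans (≋-sym r) D.c≋)))
    q-resp : ∀ {p' q' z} → d ≋ ⟨ p' , q' ⟩ → z ∊ q' → z ∊ D.q
    q-resp r = ∊-respʳ (proj₂ (⟨⟩-injective (≋-trans (≋-sym r) D.c≋)))

-- A condition given by a list of rows, a Boolean matrix and a relation for the links. Each
-- extension argument below only designs a blueprint; the coding as a set is done once, by `Build`.
record Blueprint (κ : V) : Set₂ where
  field
    support  : List V
    ⊆κ       : ∀ {γ} → γ ∈ˡ support → γ ∊ κ
    height   : ℕ
    value    : V → ℕ → Bool
    value-resp : ∀ {γ γ'} i → γ ≋ γ' → value γ i ≡ value γ' i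
    Edge     : V → V → ℕ → Set₁
    Edge-resp   : ∀ {α α' β β' k} → α ≋ α' → β ≋ β' → Edge α β k → Edge α' β' k
    Edge-sym    : ∀ {α β k} → Edge α β k → Edge β α k
    Edge-unique : ∀ {α β k k'} → Edge α β k → Edge α β k' → k ≡ k'
    Edge-dom    : ∀ {α β k} → Edge α β k → α ∈ˡ support × β ∈ˡ support × ¬ (α ≋ β) × k <ⁿ height
    Edge-disjoint : ∀ {α β k i} → Edge α β k → k ≤ⁿ i → i <ⁿ height → value α i ≡ false ⊎ value β i ≡ false

module Build (em : ExcludedMiddle (lsuc 0ℓ)) {κ : V} (B : Blueprint κ) where

  open Classical em
  open Blueprint B

  private
    L : ℕ
    L = length support

    at : Fin L → V
    at = lookup support

    at∈ : ∀ i → at i ∈ˡ support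
    at∈ i = Any.map ≡⇒≋ (lookup∈ support i)
      where
      lookup∈ : ∀ (xs : List V) i → Any (lookup xs i ≡_) xs
      lookup∈ (x List.∷ xs) zero = here refl
      lookup∈ (x List.∷ xs) (suc i) = there (lookup∈ xs i)

    position : ∀ {γ} → γ ∈ˡ support → Σ (Fin L) λ i → γ ≋ at i
    position a = Any.index a , Anyₚ.lookup-index a

  opaque

    column : V → V
    column γ = sup (Fin height) λ i → ⟨ num (toℕ i) , bit (value γ (toℕ i)) ⟩

    ∊column⁺ : ∀ {γ i} → i <ⁿ height → ⟨ num i , bit (value γ i) ⟩ ∊ column γ
    ∊column⁺ {γ} {i} i<n = ∊-index (fromℕ< i<n)
      (≡⇒≋ (cong (λ j → ⟨ num j , bit (value γ j) ⟩) (sym (toℕ-fromℕ< i<n))))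

    ∊column⁻ : ∀ {γ w} → w ∊ column γ → Σ ℕ λ i → i <ⁿ height × w ≋ ⟨ num i , bit (value γ i) ⟩
    ∊column⁻ a = let i , r = index a in toℕ i , toℕ<n i , r

    column-cong : ∀ {γ γ'} → γ ≋ γ' → column γ ≋ column γ'
    column-cong {γ} {γ'} r = ≋-ext (half r) (half (≋-sym r))
      where
      half : ∀ {γ γ'} → γ ≋ γ' → ∀ w → w ∊ column γ → w ∊ column γ'
      half {γ} {γ'} r w a = let i , i<n , s = ∊column⁻ {γ} a in
        ∊-respˡ (≋-sym (≋-trans s (≡⇒≋ (cong (λ b → ⟨ num i , bit b ⟩) (value-resp i r))))) (∊column⁺ {γ'} i<n)

    rows : V
    rows = sup (Fin L) λ i → ⟨ at i , column (at i) ⟩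

    ∊rows⁺ : ∀ {γ} → γ ∈ˡ support → ⟨ γ , column γ ⟩ ∊ rows
    ∊rows⁺ a = let i , r = position a in ∊-index i (⟨⟩-cong r (column-cong r))

    ∊rows : ∀ {z} → z ∊ rows → Σ V λ γ → γ ∈ˡ support × z ≋ ⟨ γ , column γ ⟩
    ∊rows a = let i , r = index a in at i , at∈ i , r

    ∊rows⁻ : ∀ {γ y} → ⟨ γ , y ⟩ ∊ rows → γ ∈ˡ support × y ≋ column γ
    ∊rows⁻ a = let δ , b , r = ∊rows a ; s , t = ⟨⟩-injective r in
      ∈ˡ-resp (≋-sym s) b , ≋-trans t (column-cong (≋-sym s))

    -- `Edge` lives in `Set₁` and is too large to index a tree; `True (dec _)` is an equivalent
    -- proposition in `Set`.
    edges : V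
    edges = sup (Σ (Fin L × Fin L × ℕ) λ (i , j , k) → True (dec (Edge (at i) (at j) k)))
      λ ((i , j , k) , _) → ⟨ ⁅ at i , at j ⁆ , num k ⟩

    ∊edges⁺ : ∀ {α β k} → Edge α β k → ⟨ ⁅ α , β ⁆ , num k ⟩ ∊ edges
    ∊edges⁺ {α} {β} {k} a =
      let b , c , _ , _ = Edge-dom a ; i , r = position b ; j , s = position c
      in ∊-index ((i , j , k) , fromWitness (Edge-resp r s a)) (⟨⟩-cong (⁅⁆-cong r s) ≋-refl)

    ∊edges : ∀ {z} → z ∊ edges → Σ V λ α → Σ V λ β → Σ ℕ λ k → Edge α β k × z ≋ ⟨ ⁅ α , β ⁆ , num k ⟩
    ∊edges a = let ((i , j , k) , w) , r = index a in at i , at j , k , toWitness w , r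

    ∊edges⁻ : ∀ {α β k} → ⟨ ⁅ α , β ⁆ , num k ⟩ ∊ edges → Edge α β k
    ∊edges⁻ a with ∊edges a
    ... | α' , β' , k' , e , r with ⟨⟩-injective r
    ...   | s , t with num-injective t
    ...     | refl with ⁅⁆-injective s
    ...       | inj₁ (u , v) = Edge-resp (≋-sym u) (≋-sym v) e
    ...       | inj₂ (u , v) = Edge-resp (≋-sym u) (≋-sym v) (Edge-sym e)

    edge-sets : V
    edge-sets = sup (Σ (Fin L × Fin L × ℕ) λ (i , j , k) → True (dec (Edge (at i) (at j) k)))
      λ ((i , j , k) , _) → ⁅ at i , at j ⁆

    ∊edge-sets : ∀ {z} → z ∊ edge-sets → Σ V λ α → Σ V λ β → Σ ℕ λ k → Edge α β k × z ≋ ⁅ α , β ⁆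
    ∊edge-sets a = let ((i , j , k) , w) , r = index a in at i , at j , k , toWitness w , r

    ∊edge-sets⁺ : ∀ {α β k} → Edge α β k → ⁅ α , β ⁆ ∊ edge-sets
    ∊edge-sets⁺ {α} {β} {k} a =
      let b , c , _ , _ = Edge-dom a ; i , r = position b ; j , s = position c
      in ∊-index ((i , j , k) , fromWitness (Edge-resp r s a)) (⁅⁆-cong r s)

  built : V
  built = ⟨ rows , edges ⟩

  opaque

    column-function : ∀ γ → (num height ⟶ (_∈ num 2)) (column γ)
    column-function γ = record
      { graph = λ z a → let i , i<n , r = ∊column⁻ (∊-in a) in
          num i , bit (value γ i) , ∊-out (∊num i<n) , ∊-out (bit∊2 (value γ i)) , ≋-out r
      ; total = λ x a → let i , i<n , r = ∊num⁻ (∊-in a) in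
          bit (value γ i) , ∊-out (∊-respˡ (⟨⟩-cong (≋-sym r) ≋-refl) (∊column⁺ {γ} i<n))
      ; unique = λ x y y' a b → ≋-out (same (∊-in a) (∊-in b)) }
      where
      same : ∀ {x y y'} → ⟨ x , y ⟩ ∊ column γ → ⟨ x , y' ⟩ ∊ column γ → y ≋ y'
      same a b with ∊column⁻ a | ∊column⁻ b
      ... | i , _ , r | j , _ , s with ⟨⟩-injective r | ⟨⟩-injective s
      ...   | x≋i , t | x≋j , u with num-injective (≋-trans (≋-sym x≋i) x≋j)
      ...     | refl = ≋-trans t (≋-sym u)

    built-condition : IsCondition κ built
    built-condition = record
      { p = rows ; q = edges ; F = sup (Fin L) at ; N = num height ; pair = ≈-refl _
      ; F-finite = L , at , ≈-refl _
      ; F⊆κ = λ i → ∊-out (⊆κ (at∈ i))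
      ; N∈ω = ∊-out (num∊ω height)
      ; p-function = record
        { graph = λ z a → let γ , b , r = ∊rows (∊-in a) ; i , s = position b in
            γ , column γ , (i , ≋-out s) , column-function γ , ≋-out r
        ; total = λ x (i , r) → column x , ∊-out (∊rows⁺ (∈ˡ-resp (≋-sym (≋-in r)) (at∈ i)))
        ; unique = λ x y y' a b → ≋-out (≋-trans (proj₂ (∊rows⁻ (∊-in a))) (≋-sym (proj₂ (∊rows⁻ (∊-in b))))) }
      ; E = edge-sets
      ; E⊆[F]² = λ e a → let α , β , k , d , r = ∊edge-sets (∊-in a)
                             x , y , z , _ = Edge-dom d
                             i , s = position x ; j , t = position y
                         in α , β , (i , ≋-out s) , (j , ≋-out t) , (λ u → z (≋-in u)) , ≋-out r
      ; q-function = record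
        { graph = λ z a → let α , β , k , d , r = ∊edges (∊-in a) in
            ⁅ α , β ⁆ , num k , ∊-out (∊edge-sets⁺ d) , ∊-out (∊num (proj₂ (proj₂ (proj₂ (Edge-dom d))))) , ≋-out r
        ; total = λ x a → let α , β , k , d , r = ∊edge-sets (∊-in a) in
            num k , ∊-out (∊-respˡ (⟨⟩-cong (≋-sym r) ≋-refl) (∊edges⁺ d))
        ; unique = λ x y y' a b → ≋-out (same (∊-in a) (∊-in b)) }
      ; disjoint = λ α β n a i n⊆i i∈N → disj α β n i (∊-in a) n⊆i (∊-in i∈N) }
      where
      same : ∀ {x y y'} → ⟨ x , y ⟩ ∊ edges → ⟨ x , y' ⟩ ∊ edges → y ≋ y'
      same a b with ∊edges a
      ... | α , β , k , d , r with ∊edges b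
      ...   | α' , β' , k' , d' , r' =
        let x≋ , y≋ = ⟨⟩-injective r ; _ , y'≋ = ⟨⟩-injective r'
            e = ∊edges⁻ {α} {β} {k'} (∊-respˡ (⟨⟩-cong x≋ y'≋) b)
        in ≋-trans y≋ (≋-trans (≡⇒≋ (cong num (Edge-unique d e))) (≋-sym y'≋))
      zero-bit : ∀ {α i} → α ∈ˡ support → i <ⁿ height → value α i ≡ false → ⟨ num i , num 0 ⟩ ∊ rows ′ α
      zero-bit {α} {i} a i<n v = ∊′⁺ (∊rows⁺ a) (subst (λ b → ⟨ num i , bit b ⟩ ∊ column α) v (∊column⁺ {α} i<n))
      disj : ∀ α β n i → ⟨ ⁅ α , β ⁆ , n ⟩ ∊ edges → n ⊆ i → i ∊ num height →
        ⟨ i , num 0 ⟩ ∈ rows ′ α ⊎ ⟨ i , num 0 ⟩ ∈ rows ′ β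
      disj α β n i a n⊆i i∊N with ∊edges a | ∊num⁻ i∊N
      ... | _ , _ , k , _ , r | j , j<N , i≋j =
        let n≋k = proj₂ (⟨⟩-injective r)
            e = ∊edges⁻ {α} {β} {k} (∊-respˡ (⟨⟩-cong ≋-refl n≋k) a)
            x , y , _ , _ = Edge-dom e
            up = λ {γ} (b : ⟨ num j , num 0 ⟩ ∊ rows ′ γ) →
              ∊-out {⟨ i , num 0 ⟩} {rows ′ γ} (∊-respˡ (⟨⟩-cong (≋-sym i≋j) ≋-refl) b)
        in [ (λ v → inj₁ (up (zero-bit x j<N v))) , (λ v → inj₂ (up (zero-bit y j<N v))) ]′
             (Edge-disjoint e (k≤j n≋k) j<N)
        where
        -- Were `j < k`, then `num j` would be an element of `n`, hence of `i ≋ num j`, against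
        -- foundation.
        k≤j : ∀ {k} → n ≋ num k → k ≤ⁿ j
        k≤j {k} n≋k with k ℕₚ.≤? j
        ... | yes le = le
        ... | no ¬le = let l , s = index (∊-respʳ (≋-sym n≋k) (∊num (ℕₚ.≰⇒> ¬le))) in
              ⊥-elim (∊-irrefl (num j) (∊-resp (≋-sym s) i≋j (∊-in {el n l} (n⊆i l))))

  opaque
    unfolding Dom Bit Link

    rows-resp : ∀ {p q z} → built ≋ ⟨ p , q ⟩ → z ∊ p → z ∊ rows
    rows-resp r = ∊-respʳ (≋-sym (proj₁ (⟨⟩-injective r)))

    Dom⁺ : ∀ {γ} → γ ∈ˡ support → Dom built γ
    Dom⁺ a = rows , edges , ≋-refl , _ , ∊rows⁺ a

    Dom⁻ : ∀ {γ} → Dom built γ → γ ∈ˡ support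
    Dom⁻ (p , q , r , y , a) = proj₁ (∊rows⁻ (rows-resp r a))

    Bit⁺ : ∀ {γ i} → γ ∈ˡ support → i <ⁿ height → Bit built γ i (value γ i)
    Bit⁺ {γ} a i<n = rows , edges , ≋-refl , column γ , ∊rows⁺ a , ∊column⁺ {γ} i<n

    Bit⁻ : ∀ {γ i b} → Bit built γ i b → γ ∈ˡ support × i <ⁿ height × value γ i ≡ b
    Bit⁻ {γ} {i} {b} (p , q , r , y , a , d) with ∊rows⁻ (rows-resp r a)
    ... | x , s with ∊column⁻ (∊-respʳ s d)
    ...   | j , j<n , t with ⟨⟩-injective t
    ...     | u , v with num-injective u
    ...       | refl = x , j<n , sym (bit-injective v)

    Link⁺ : ∀ {α β k} → Edge α β k → Link built α β k
    Link⁺ e = rows , edges , ≋-refl , ∊edges⁺ e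

    Link⁻ : ∀ {α β k} → Link built α β k → Edge α β k
    Link⁻ (p , q , r , a) = ∊edges⁻ (∊-respʳ (≋-sym (proj₂ (⟨⟩-injective r))) a)


-- The Hechler order and its data as sets of the model

module Hechler (em : ExcludedMiddle (lsuc 0ℓ)) (M : V) (M-transitive : Transitive M) (zfc : ZFC M)
               (κ : V) (κ∊M : κ ∊ M) (ℙ : V) (ℙ∊M : ℙ ∊ M) (poset : IsHechlerPoset κ ℙ) where

  open Classical em
  open Model em M M-transitive zfc
  open Constructions em M M-transitive zfc
  open Recursion em M M-transitive zfc

  opaque
    unfolding Dom Bit Link

    ℙ-view : ∀ {c} → c ∊ ℙ → View κ c
    ℙ-view {c} c∊ℙ = view (to (poset c) (∊-out c∊ℙ))

    built∊ℙ : (B : Blueprint κ) → Build.built em B ∊ ℙ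
    built∊ℙ B = ∊-in (from (poset _) (Build.built-condition em B))

    -- `_≤_` quantifies over all of `V`. Its content is definable over `M` because the components,
    -- rows and links of a condition are elements of `M`.
    order : Σ V λ Le → Le ∊ M × (∀ {e c} → ⟨ e , c ⟩ ∊ Le → e ∊ ℙ × c ∊ ℙ × Extends e c) ×
      (∀ {e c} → e ∊ ℙ → c ∊ ℙ → Extends e c → ⟨ e , c ⟩ ∊ Le)
    order with Le , Le∊M , Le⁻ , Le⁺ ← separate (⊗∊M ℙ∊M ℙ∊M) (∃ᶠ∈ (con ℙ ℙ∊M) (∃ᶠ∈ (con ℙ ℙ∊M) (x₂ ≈ᶠ ⟨ x₁ , x₀ ⟩ᵗ ∧ᶠ
        ∃ᶠ (∃ᶠ (∃ᶠ (∃ᶠ (x₅ ≈ᶠ ⟨ x₃ , x₂ ⟩ᵗ ∧ᶠ x₄ ≈ᶠ ⟨ x₁ , x₀ ⟩ᵗ ∧ᶠ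
          ∀ᶠ∈ (con κ κ∊M) (∀ᶠ (⟨ x₁ , x₀ ⟩ᵗ ∈ᶠ x₃ ⇒ᶠ ∃ᶠ (⟨ x₂ , x₀ ⟩ᵗ ∈ᶠ x₆ ∧ᶠ ∀ᶠ∈ x₁ (x₀ ∈ᶠ x₁)))) ∧ᶠ
          ∀ᶠ∈ x₀ (x₀ ∈ᶠ x₃))))))))
      = Le , Le∊M ,
        (λ {e} {c} a → let _ , e' , e'∊ℙ , c' , c'∊ℙ , r , p₁ , p₁∊M , q₁ , _ , p₂ , p₂∊M , q₂ , _ , s , t , f , g = Le⁻ a
                           e≋ , c≋ = ⟨⟩-injective r
                       in ∊-respˡ (≋-sym e≋) e'∊ℙ , ∊-respˡ (≋-sym c≋) c'∊ℙ ,
                          elim (∊-respˡ (≋-sym c≋) c'∊ℙ) p₂∊M (≋-trans e≋ s) (≋-trans c≋ t) f g) ,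
        λ {e} {c} e∊ℙ c∊ℙ x → Le⁺ (∊⊗⁺ e∊ℙ c∊ℙ) (e , e∊ℙ , c , c∊ℙ , ≋-refl , intro e∊ℙ c∊ℙ x)
      where
      elim : ∀ {e c p₁ q₁ p₂ q₂} → c ∊ ℙ → p₂ ∊ M → e ≋ ⟨ p₁ , q₁ ⟩ → c ≋ ⟨ p₂ , q₂ ⟩ →
        (∀ γ → γ ∊ κ → ∀ y → y ∊ M → ⟨ γ , y ⟩ ∊ p₂ → Σ V λ y' → y' ∊ M × ⟨ γ , y' ⟩ ∊ p₁ × (∀ w → w ∊ y → w ∊ y')) →
        (∀ w → w ∊ q₂ → w ∊ q₁) → Extends e c
      elim {e} {c} {p₁} {q₁} {p₂} {q₂} c∊ℙ p₂∊M e≋ c≋ f g = extends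
          (λ (p , q , r , y , a) → let y' , _ , b , _ = next r a in p₁ , q₁ , e≋ , y' , b)
          (λ (p , q , r , y , a , d) → let y' , _ , b , s = next r a in p₁ , q₁ , e≋ , y' , b , s _ d)
          (λ (p , q , r , a) → p₁ , q₁ , e≋ , g _ (∊-respʳ (proj₂ (⟨⟩-injective (≋-trans (≋-sym r) c≋))) a))
        where
        next : ∀ {p q γ y} → c ≋ ⟨ p , q ⟩ → ⟨ γ , y ⟩ ∊ p → Σ V λ y' → y' ∊ M × ⟨ γ , y' ⟩ ∊ p₁ × (∀ w → w ∊ y → w ∊ y')
        next {p} {q} {γ} {y} r a =
          let b = ∊-respʳ (proj₁ (⟨⟩-injective (≋-trans (≋-sym r) c≋))) a
          in f γ (View.Dom⊆κ (ℙ-view c∊ℙ) (p , q , r , y , a)) y (proj₂ (⟨⟩∊M⁻ (M-trans p₂∊M b))) b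
      intro : ∀ {e c} → e ∊ ℙ → c ∊ ℙ → Extends e c →
        Σ V λ p₁ → p₁ ∊ M × Σ V λ q₁ → q₁ ∊ M × Σ V λ p₂ → p₂ ∊ M × Σ V λ q₂ → q₂ ∊ M × e ≋ ⟨ p₁ , q₁ ⟩ × c ≋ ⟨ p₂ , q₂ ⟩ ×
        (∀ γ → γ ∊ κ → ∀ y → y ∊ M → ⟨ γ , y ⟩ ∊ p₂ → Σ V λ y' → y' ∊ M × ⟨ γ , y' ⟩ ∊ p₁ × (∀ w → w ∊ y → w ∊ y')) ×
        (∀ w → w ∊ q₂ → w ∊ q₁)
      intro {e} {c} e∊ℙ c∊ℙ (extends dm bt lk) =
        E.p , proj₁ E∊M , E.q , proj₂ E∊M , C.p , proj₁ C∊M , C.q , proj₂ C∊M , E.c≋ , C.c≋ ,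
        (λ γ _ y _ a →
          let p , q , r , y' , b = dm (C.p , C.q , C.c≋ , y , a)
              b' = p-resp r b
          in y' , proj₂ (⟨⟩∊M⁻ (M-trans (proj₁ E∊M) b')) , b' , λ w w∊y →
              let i , v , w≋ = C.y-elem a w∊y
                  p' , q' , r' , y'' , d , d' = bt {γ} {i} {v} (C.p , C.q , C.c≋ , y , a , ∊-respˡ w≋ w∊y)
              in ∊-resp (≋-sym w≋) (E.p-unique (p-resp r' d) b') d') ,
        (λ w a → let α , β , k , w≋ = C.q-elem a
                     p , q , r , b = lk {α} {β} {k} (C.p , C.q , C.c≋ , ∊-respˡ w≋ a)
                 in ∊-resp (≋-sym w≋) (proj₂ (⟨⟩-injective (≋-trans (≋-sym r) E.c≋))) b)
        where
        module E = View (ℙ-view e∊ℙ)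
        module C = View (ℙ-view c∊ℙ)
        E∊M : E.p ∊ M × E.q ∊ M
        E∊M = ⟨⟩∊M⁻ (∊-respˡ E.c≋ (M-trans ℙ∊M e∊ℙ))
        C∊M : C.p ∊ M × C.q ∊ M
        C∊M = ⟨⟩∊M⁻ (∊-respˡ C.c≋ (M-trans ℙ∊M c∊ℙ))
        p-resp : ∀ {p' q' z} → e ≋ ⟨ p' , q' ⟩ → z ∊ p' → z ∊ E.p
        p-resp r = ∊-respʳ (proj₁ (⟨⟩-injective (≋-trans (≋-sym r) E.c≋)))

    -- `Dom` lives outside the formula language; as a set of `M` it can be used there as a constant.
    -- The same holds for `bit-set` and `size-set`.
    dom-set : Σ V λ D → D ∊ M × (∀ {c γ} → c ∊ ℙ → Dom c γ → ⟨ c , γ ⟩ ∊ D) × (∀ {c γ} → ⟨ c , γ ⟩ ∊ D → Dom c γ)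
    dom-set with D , D∊M , D⁻ , D⁺ ← separate (⊗∊M ℙ∊M κ∊M) (∃ᶠ∈ (con ℙ ℙ∊M) (∃ᶠ∈ (con κ κ∊M)
        (x₂ ≈ᶠ ⟨ x₁ , x₀ ⟩ᵗ ∧ᶠ ∃ᶠ (∃ᶠ (x₃ ≈ᶠ ⟨ x₁ , x₀ ⟩ᵗ ∧ᶠ ∃ᶠ (⟨ x₃ , x₀ ⟩ᵗ ∈ᶠ x₂))))))
      = D , D∊M ,
        (λ {c} {γ} c∊ℙ d@(p , q , r , y , a) →
          let p∊M , q∊M = ⟨⟩∊M⁻ (∊-respˡ r (M-trans ℙ∊M c∊ℙ))
              γ∊κ = View.Dom⊆κ (ℙ-view c∊ℙ) d
          in D⁺ (∊⊗⁺ c∊ℙ γ∊κ) (c , c∊ℙ , γ , γ∊κ , ≋-refl , p , p∊M , q , q∊M , r , y , proj₂ (⟨⟩∊M⁻ (M-trans p∊M a)) , a)) ,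
        λ a → let _ , c , _ , γ , _ , r , p , _ , q , _ , s , y , _ , b = D⁻ a
                  c≋ , γ≋ = ⟨⟩-injective r
              in Dom-resp (≋-sym c≋) (≋-sym γ≋) (p , q , s , y , b)

    bit-set : Σ V λ D → D ∊ M × (∀ {c γ i b} → c ∊ ℙ → Bit c γ i b → ⟨ ⟨ c , γ ⟩ , ⟨ num i , bit b ⟩ ⟩ ∊ D) ×
      (∀ {c γ i j} → ⟨ ⟨ c , γ ⟩ , ⟨ i , j ⟩ ⟩ ∊ D → Σ ℕ λ n → Σ Bool λ b → i ≋ num n × j ≋ bit b × Bit c γ n b)
    bit-set with D , D∊M , D⁻ , D⁺ ← separate (⊗∊M (⊗∊M ℙ∊M κ∊M) (⊗∊M ω∊M (num∊M 2)))
        (∃ᶠ∈ (con ℙ ℙ∊M) (∃ᶠ∈ (con κ κ∊M) (∃ᶠ∈ (con ω ω∊M) (∃ᶠ∈ (con (num 2) (num∊M 2))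
          (x₄ ≈ᶠ ⟨ ⟨ x₃ , x₂ ⟩ᵗ , ⟨ x₁ , x₀ ⟩ᵗ ⟩ᵗ ∧ᶠ
            ∃ᶠ (∃ᶠ (∃ᶠ (x₆ ≈ᶠ ⟨ x₂ , x₁ ⟩ᵗ ∧ᶠ ⟨ x₅ , x₀ ⟩ᵗ ∈ᶠ x₂ ∧ᶠ ⟨ x₄ , x₃ ⟩ᵗ ∈ᶠ x₀))))))))
      = D , D∊M ,
        (λ {c} {γ} {i} {b} c∊ℙ d@(p , q , r , y , a , a') →
          let p∊M , q∊M = ⟨⟩∊M⁻ (∊-respˡ r (M-trans ℙ∊M c∊ℙ))
              γ∊κ = View.Dom⊆κ (ℙ-view c∊ℙ) (Bit⇒Dom {b = b} d)
          in D⁺ (∊⊗⁺ (∊⊗⁺ c∊ℙ γ∊κ) (∊⊗⁺ (num∊ω i) (bit∊2 b)))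
             (c , c∊ℙ , γ , γ∊κ , num i , num∊ω i , bit b , bit∊2 b , ≋-refl ,
              p , p∊M , q , q∊M , y , proj₂ (⟨⟩∊M⁻ (M-trans p∊M a)) , r , a , a')) ,
        λ a → let _ , c , _ , γ , _ , i , i∊ω , j , j∊2 , r , p , _ , q , _ , y , _ , s , b , d = D⁻ a
                  u , v = ⟨⟩-injective r
                  c≋ , γ≋ = ⟨⟩-injective u
                  i≋ , j≋ = ⟨⟩-injective v
                  n , i≋n = ∊ω⁻ i∊ω
                  b' , j≋b = ∊2⁻ j∊2
              in n , b' , ≋-trans i≋ i≋n , ≋-trans j≋ j≋b ,
                 Bit-resp (≋-sym c≋) (≋-sym γ≋) (p , q , s , y , b , ∊-respˡ (⟨⟩-cong i≋n j≋b) d)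

  enumerate : ℕ → List V → V
  enumerate n List.[] = ∅
  enumerate n (x List.∷ xs) = ⁅ ⟨ num n , x ⟩ , ⟨ num n , x ⟩ ⁆ ∪ enumerate (suc n) xs

  opaque

    enumerate∊M : ∀ n xs → (∀ {x} → x ∈ˡ xs → x ∊ M) → enumerate n xs ∊ M
    enumerate∊M n List.[] _ = ∅∊M
    enumerate∊M n (x List.∷ xs) p = let q = ⟨⟩∊M (num∊M n) (p (here ≋-refl)) in
      ∪∊M (⁅⁆∊M q q) (enumerate∊M (suc n) xs (λ a → p (there a)))

    ∊enumerate⁺ : ∀ n {x xs} → x ∈ˡ xs → Σ ℕ λ k → k <ⁿ n +ⁿ length xs × ⟨ num k , x ⟩ ∊ enumerate n xs
    ∊enumerate⁺ n {xs = y List.∷ ys} (here r) = n , ℕₚ.m<m+n n (s≤s z≤n) , ∊∪ˡ (∊⁅⁆ˡ (⟨⟩-cong ≋-refl r))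
    ∊enumerate⁺ n {xs = y List.∷ ys} (there a) = let k , k< , b = ∊enumerate⁺ (suc n) a in
      k , subst (k <ⁿ_) (sym (ℕₚ.+-suc n (length ys))) k< , ∊∪ʳ b

    ∊enumerate⁻ : ∀ n xs {i x} → ⟨ i , x ⟩ ∊ enumerate n xs → Σ ℕ λ k → n ≤ⁿ k × i ≋ num k
    ∊enumerate⁻ n List.[] a = ⊥-elim (∅-empty a)
    ∊enumerate⁻ n (y List.∷ ys) a with ∊∪⁻ a
    ... | inj₁ b = n , ℕₚ.≤-refl , proj₁ (⟨⟩-injective (∊⁅⁆₁ b))
    ... | inj₂ b = let k , n<k , r = ∊enumerate⁻ (suc n) ys b in k , ℕₚ.<⇒≤ n<k , r

    enumerate-single : ∀ n xs → SingleValued (enumerate n xs)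
    enumerate-single n List.[] i x y a b = ⊥-elim (∅-empty a)
    enumerate-single n (z List.∷ zs) i x y a b with ∊∪⁻ a | ∊∪⁻ b
    ... | inj₁ a' | inj₁ b' = ≋-trans (proj₂ (⟨⟩-injective (∊⁅⁆₁ a'))) (≋-sym (proj₂ (⟨⟩-injective (∊⁅⁆₁ b'))))
    ... | inj₂ a' | inj₂ b' = enumerate-single (suc n) zs i x y a' b'
    ... | inj₁ a' | inj₂ b' = ⊥-elim (later a' b')
      where
      later : ⟨ i , x ⟩ ∊ ⁅ ⟨ num n , z ⟩ , ⟨ num n , z ⟩ ⁆ → ⟨ i , y ⟩ ∊ enumerate (suc n) zs → ⊥
      later a b with ∊enumerate⁻ (suc n) zs b
      ... | k , n<k , r = ℕₚ.<-irrefl (num-injective (≋-trans (≋-sym (proj₁ (⟨⟩-injective (∊⁅⁆₁ a)))) r)) n<k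
    ... | inj₂ a' | inj₁ b' = ⊥-elim (later b' a')
      where
      later : ⟨ i , y ⟩ ∊ ⁅ ⟨ num n , z ⟩ , ⟨ num n , z ⟩ ⁆ → ⟨ i , x ⟩ ∊ enumerate (suc n) zs → ⊥
      later a b with ∊enumerate⁻ (suc n) zs b
      ... | k , n<k , r = ℕₚ.<-irrefl (num-injective (≋-trans (≋-sym (proj₁ (⟨⟩-injective (∊⁅⁆₁ a)))) r)) n<k

  -- A single number bounds both the cardinality of the domain and the height. The first bound
  -- limits the length of a root, the second makes the possible patterns on a root finite in number.
  record Size≤ (c : V) (n : ℕ) : Set₁ where
    field
      place          : ∀ {γ} → Dom c γ → Σ ℕ λ i → i <ⁿ n
      place-injective : ∀ {γ γ'} (d : Dom c γ) (d' : Dom c γ') → proj₁ (place d) ≡ proj₁ (place d') → γ ≋ γ'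
      bits<          : ∀ {γ i b} → Bit c γ i b → i <ⁿ n

  opaque

    size-set : Σ V λ D → D ∊ M × (∀ {c} → c ∊ ℙ → Σ ℕ λ n → ⟨ num n , c ⟩ ∊ D) ×
      (∀ {n c} → ⟨ num n , c ⟩ ∊ D → Size≤ c n)
    size-set
      with Ds , Ds∊M , Ds⁺ , Ds⁻ ← dom-set
      with Bs , Bs∊M , Bs⁺ , Bs⁻ ← bit-set
      with D , D∊M , D⁻ , D⁺ ← separate (⊗∊M ω∊M ℙ∊M) (∃ᶠ∈ (con ω ω∊M) (∃ᶠ∈ (con ℙ ℙ∊M) (x₂ ≈ᶠ ⟨ x₁ , x₀ ⟩ᵗ ∧ᶠ ∃ᶠ (
          ∀ᶠ∈ (con ω ω∊M) (∀ᶠ∈ (con κ κ∊M) (∀ᶠ∈ (con κ κ∊M) (⟨ x₂ , x₁ ⟩ᵗ ∈ᶠ x₃ ⇒ᶠ ⟨ x₂ , x₀ ⟩ᵗ ∈ᶠ x₃ ⇒ᶠ x₁ ≈ᶠ x₀))) ∧ᶠ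
          ∀ᶠ∈ (con κ κ∊M) (⟨ x₂ , x₀ ⟩ᵗ ∈ᶠ con Ds Ds∊M ⇒ᶠ ∃ᶠ∈ x₃ (⟨ x₀ , x₁ ⟩ᵗ ∈ᶠ x₂)) ∧ᶠ
          ∀ᶠ∈ (con κ κ∊M) (∀ᶠ∈ (con ω ω∊M) (∀ᶠ∈ (con (num 2) (num∊M 2))
            (⟨ ⟨ x₄ , x₂ ⟩ᵗ , ⟨ x₁ , x₀ ⟩ᵗ ⟩ᵗ ∈ᶠ con Bs Bs∊M ⇒ᶠ x₁ ∈ᶠ x₅)))))))
      = D , D∊M , exists , bound
      where
      exists : ∀ {c} → c ∊ ℙ → Σ ℕ λ n → ⟨ num n , c ⟩ ∊ D
      exists {c} c∊ℙ = n , D⁺ (∊⊗⁺ (num∊ω n) c∊ℙ) (num n , num∊ω n , c , c∊ℙ , ≋-refl , enumerate 0 C.support ,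
          enumerate∊M 0 C.support (λ a → M-trans κ∊M (C.Dom⊆κ (C.⇒Dom a))) ,
          (λ i _ γ _ γ' _ → enumerate-single 0 C.support i γ γ') ,
          (λ γ _ a → let k , k< , b = ∊enumerate⁺ 0 (C.Dom⇒ (Ds⁻ a)) in
            num k , ∊num (ℕₚ.<-≤-trans k< (ℕₚ.m≤m+n (length C.support) C.height)) , b) ,
          (λ γ _ i _ j _ a → let k , b , i≋k , j≋b , d = Bs⁻ a in
            ∊-respˡ (≋-sym i≋k) (∊num (ℕₚ.<-≤-trans (C.Bit-bound d) (ℕₚ.m≤n+m C.height (length C.support))))))
        where
        module C = View (ℙ-view c∊ℙ)
        n : ℕ
        -- Positions in the list stay below the first summand and columns below the second, so the
        -- sum bounds both.
        n = length C.support +ⁿ C.height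
      bound : ∀ {n c} → ⟨ num n , c ⟩ ∊ D → Size≤ c n
      bound {n} {c} a with D⁻ a
      ... | _ , n' , _ , c' , c'∊ℙ , r , g , _ , single , cover , bits = record
          { place = λ d → let i , i<n , _ = find d in i , i<n
          ; place-injective = λ {γ} {γ'} d d' eq → same d d' eq
          ; bits< = λ {γ} {i} {b} d → let d' = Bit-resp c≋ ≋-refl d in
              num∊num (∊-respʳ (≋-sym n≋) (bits γ (C.Dom⊆κ (Bit⇒Dom d')) (num i) (num∊ω i) (bit b) (bit∊2 b) (Bs⁺ c'∊ℙ d'))) }
        where
        module C = View (ℙ-view c'∊ℙ)
        n≋ : num n ≋ n'
        n≋ = proj₁ (⟨⟩-injective r)
        c≋ : c ≋ c'
        c≋ = proj₂ (⟨⟩-injective r)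
        find : ∀ {γ} → Dom c γ → Σ ℕ λ i → i <ⁿ n × ⟨ num i , γ ⟩ ∊ g
        find {γ} d = let d' = Dom-resp c≋ ≋-refl d
                         i , i∊n , p = cover γ (C.Dom⊆κ d') (Ds⁺ c'∊ℙ d')
                         k , k<n , i≋k = ∊num⁻ (∊-respʳ (≋-sym n≋) i∊n)
                     in k , k<n , ∊-respˡ (⟨⟩-cong i≋k ≋-refl) p
        same : ∀ {γ γ'} (d : Dom c γ) (d' : Dom c γ') → proj₁ (find d) ≡ proj₁ (find d') → γ ≋ γ'
        same {γ} {γ'} d d' eq = single (num (proj₁ (find d))) (num∊ω _)
          γ (C.Dom⊆κ (Dom-resp c≋ ≋-refl d)) γ' (C.Dom⊆κ (Dom-resp c≋ ≋-refl d'))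
          (proj₂ (proj₂ (find d))) (subst (λ k → ⟨ num k , γ' ⟩ ∊ g) (sym eq) (proj₂ (proj₂ (find d'))))

    -- If `n` were the first natural number missing from `κ`, then `κ` would be `num n`, and the
    -- identity would be an injection into ω in `M`. The inclusion of `κ` in `num n` is an
    -- ∈-induction: a transitive subset of `num n` is a numeral at most `n`.
    ω⊆κ : Ordinal κ → ¬ CountableIn M κ → ∀ n → num n ∊ κ
    ω⊆κ (κ-trans , elem-trans) uncountable n = below (suc n) n ℕₚ.≤-refl
      where
      initial : ∀ n {γ} → (∀ {x y} → y ∊ γ → x ∊ y → x ∊ γ) → (∀ x → x ∊ γ → x ∊ num n) → Σ ℕ λ k → k ≤ⁿ n × γ ≋ num k
      initial zero _ sub = 0 , z≤n , ≋-ext sub (λ x a → ⊥-elim (∅-empty a))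
      initial (suc n) {γ} tr sub with dec₀ (num n ∊ γ)
      ... | yes a = suc n , ℕₚ.≤-refl , ≋-ext sub (λ x b → let k , k<n , r = ∊num⁻ {suc n} b in ∊-respˡ (≋-sym r) (all k<n))
        where
        all : ∀ {k} → k <ⁿ suc n → num k ∊ γ
        all (s≤s k≤n) with ℕₚ.m≤n⇒m<n∨m≡n k≤n
        ... | inj₁ k<n = tr a (∊num k<n)
        ... | inj₂ refl = a
      ... | no ¬a = let k , k≤n , r = initial n tr smaller in k , ℕₚ.m≤n⇒m≤1+n k≤n , r
        where
        smaller : ∀ x → x ∊ γ → x ∊ num n
        smaller x b with ∊num⁻ {suc n} (sub x b)
        ... | k , s≤s k≤n , r with ℕₚ.m≤n⇒m<n∨m≡n k≤n
        ...   | inj₁ k<n = ∊-respˡ (≋-sym r) (∊num k<n)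
        ...   | inj₂ refl = ⊥-elim (¬a (∊-respˡ r b))
      finite-countable : ∀ n → κ ≋ num n → CountableIn M κ
      finite-countable n κ≋n with f , f∊M , f⁻ , f⁺ ← separate (⊗∊M ω∊M ω∊M) (∃ᶠ∈ (con κ κ∊M) (x₁ ≈ᶠ ⟨ x₀ , x₀ ⟩ᵗ))
        = f , ∊-out f∊M , record
          { function = record
            { graph = λ z a → let b , x , x∊κ , r = f⁻ (∊-in a) in x , x , ∊-out x∊κ , ∊-out (natural x∊κ) , ≋-out r
            ; total = λ x a → x , ∊-out (f⁺ (∊⊗⁺ (natural (∊-in a)) (natural (∊-in a))) (x , ∊-in a , ≋-refl))
            ; unique = λ x y y' a b → ≋-out (≋-trans (≋-sym (diagonal (∊-in a))) (diagonal (∊-in b))) }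
          ; injective = λ x x' y a b → ≋-out (≋-trans (diagonal (∊-in a)) (≋-sym (diagonal (∊-in b)))) }
        where
        natural : ∀ {x} → x ∊ κ → x ∊ ω
        natural a = let k , _ , r = ∊num⁻ (∊-respʳ κ≋n a) in ∊-respˡ (≋-sym r) (num∊ω k)
        diagonal : ∀ {x y} → ⟨ x , y ⟩ ∊ f → x ≋ y
        diagonal a = let _ , z , _ , r = f⁻ a ; s , t = ⟨⟩-injective r in ≋-trans s (≋-sym t)
      below : ∀ n j → j <ⁿ n → num j ∊ κ
      below (suc n) j (s≤s j≤n) with ℕₚ.m≤n⇒m<n∨m≡n j≤n
      ... | inj₁ j<n = below n j j<n
      ... | inj₂ refl = stable₀ (num n ∊ κ) λ n∉κ → uncountable (finite-countable n (≋-ext (κ⊆n n∉κ)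
              (λ x a → let k , k<n , r = ∊num⁻ {n} a in ∊-respˡ (≋-sym r) (below n k k<n))))
        where
        κ⊆n : ¬ (num n ∊ κ) → ∀ γ → γ ∊ κ → γ ∊ num n
        κ⊆n n∉κ = ∊-induction (λ γ → γ ∊ κ → γ ∊ num n) λ γ ih γ∊κ →
          let k , k≤n , r = initial n (λ {x} {y} a b → ∊-in (elem-trans γ (∊-out γ∊κ) y x (∊-out a) (∊-out b)))
                              (λ x a → ih x a (∊-in (κ-trans γ x (∊-out γ∊κ) (∊-out a))))
          in [ (λ k<n → ∊-respˡ (≋-sym r) (∊num k<n)) , (λ eq → ⊥-elim (n∉κ (∊-respˡ (≋-trans r (≡⇒≋ (cong num eq))) γ∊κ))) ]′ (ℕₚ.m≤n⇒m<n∨m≡n k≤n)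

  Le : V
  Le = proj₁ order

  Le∊M : Le ∊ M
  Le∊M = proj₁ (proj₂ order)

  opaque

    Le⁻ : ∀ {e c} → ⟨ e , c ⟩ ∊ Le → e ∊ ℙ × c ∊ ℙ × Extends e c
    Le⁻ = proj₁ (proj₂ (proj₂ order))

    Le⁺ : ∀ {e c} → e ∊ ℙ → c ∊ ℙ → Extends e c → ⟨ e , c ⟩ ∊ Le
    Le⁺ = proj₂ (proj₂ (proj₂ order))

    ≤⇒Le : ∀ {e c} → e ∊ ℙ → c ∊ ℙ → e ≤ c → ⟨ e , c ⟩ ∊ Le
    ≤⇒Le e∊ℙ c∊ℙ e≤c = Le⁺ e∊ℙ c∊ℙ (≤⇒Extends e≤c)

    Le⇒≤ : ∀ {e c} → ⟨ e , c ⟩ ∊ Le → e ≤ c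
    Le⇒≤ a = let e∊ℙ , c∊ℙ , x = Le⁻ a in Extends⇒≤ (ℙ-view c∊ℙ) (ℙ-view e∊ℙ) x

    generic-filter : ∀ {G} → Generic M ℙ G → GenericFilter M ℙ Le G
    generic-filter {G} gen = record
      { ≼-refl = λ c∊ℙ → Le⁺ c∊ℙ c∊ℙ Extends-refl
      ; ≼-trans = λ a b → let c∊ℙ , _ , x = Le⁻ a ; _ , e∊ℙ , y = Le⁻ b in Le⁺ c∊ℙ e∊ℙ (Extends-trans x y)
      ; G⊆ℙ = G⊆ℙ
      ; nonempty = let c , a = Generic.nonempty gen in c , ∊-in a
      ; upward = λ {c} {d} c∊G d∊ℙ a → ∊-in (Generic.upward gen c d (∊-out c∊G) (∊-out d∊ℙ) (Le⇒≤ a))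
      ; directed = λ {c} {d} c∊G d∊G → let e , a , b , b' = Generic.directed gen c d (∊-out c∊G) (∊-out d∊G) in
          e , ∊-in a , ≤⇒Le (G⊆ℙ (∊-in a)) (G⊆ℙ c∊G) b , ≤⇒Le (G⊆ℙ (∊-in a)) (G⊆ℙ d∊G) b'
      ; meets = λ {D} D∊M D⊆ℙ dense →
          let c , a , b = Generic.meets gen D (∊-out D∊M)
                ((λ i → ∊-out (D⊆ℙ (el∊ D i))) , λ c c∈ℙ → let d , d∊D , le = dense (∊-in c∈ℙ) in d , ∊-out d∊D , Le⇒≤ le)
          in c , ∊-in a , ∊-in b }
      where
      G⊆ℙ : ∀ {c} → c ∊ G → c ∊ ℙ
      G⊆ℙ a = let i , r = index a in ∊-respˡ (≋-sym r) (∊-in (Generic.subset gen i))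


-- Extensions of conditions

module Extension (em : ExcludedMiddle (lsuc 0ℓ)) (κ : V) where

  open Classical em

  decide : Set₁ → Bool
  decide P = does (dec P)

  opaque

    decide-true : ∀ {P} → P → decide P ≡ true
    decide-true {P} = dec-true (dec P)

    decide-false : ∀ {P} → ¬ P → decide P ≡ false
    decide-false {P} = dec-false (dec P)

    decide-cong : ∀ {P Q} → (P → Q) → (Q → P) → decide P ≡ decide Q
    decide-cong {P} {Q} f g with dec P
    ... | yes p = sym (decide-true (f p))
    ... | no ¬p = sym (decide-false (λ q → ¬p (g q)))

  ∈ˡ-one : ∀ {α γ} → α ∊ κ → γ ∈ˡ α List.∷ List.[] → γ ∊ κ
  ∈ˡ-one α∊κ (here r) = ∊-respˡ (≋-sym r) α∊κ

  ∈ˡ-two : ∀ {α β γ} → α ∊ κ → β ∊ κ → γ ∈ˡ α List.∷ β List.∷ List.[] → γ ∊ κ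
  ∈ˡ-two α∊κ β∊κ (here r) = ∊-respˡ (≋-sym r) α∊κ
  ∈ˡ-two α∊κ β∊κ (there a) = ∈ˡ-one β∊κ a

  -- The weakest condition. It belongs to every generic filter and hence tags the entries of
  -- canonical names that are to be present unconditionally.
  trivial : Blueprint κ
  trivial = record
    { support = List.[] ; ⊆κ = λ () ; height = 0 ; value = λ _ _ → false ; value-resp = λ _ _ → refl
    ; Edge = λ _ _ _ → Lift (lsuc 0ℓ) ⊥ ; Edge-resp = λ { _ _ (lift ()) } ; Edge-sym = λ { (lift ()) }
    ; Edge-unique = λ { (lift ()) } ; Edge-dom = λ { (lift ()) } ; Edge-disjoint = λ { (lift ()) } }

  trivial-max : ∀ {c} → Extends c (Build.built em trivial)
  trivial-max = extends (λ d → ⊥-elim (none (Dom⁻ d))) (λ b → ⊥-elim (none (proj₁ (Bit⁻ b))))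
                        (λ l → ⊥-elim (lower (Link⁻ l)))
    where
    open Build em trivial
    none : ∀ {γ} → ¬ (γ ∈ˡ List.[])
    none ()

  -- New rows for the elements of extra, and new columns up to height n that are
  -- zero except in the row of μ.
  module Raise {c} (C : View κ c) (extra : List V) (extra⊆κ : ∀ {γ} → γ ∈ˡ extra → γ ∊ κ)
               (μ : V) (n : ℕ) (N≤n : View.height C ≤ⁿ n) where

    private
      module C = View C

      One : V → ℕ → Set₁
      One γ i = Bit c γ i true ⊎ (C.height ≤ⁿ i × γ ≋ μ)

      One-resp : ∀ {γ γ' i} → γ ≋ γ' → One γ i → One γ' i
      One-resp r = [ (λ b → inj₁ (Bit-resp ≋-refl r b)) , (λ (h , s) → inj₂ (h , ≋-trans (≋-sym r) s)) ]′

      old-zero : ∀ {γ i} → Bit c γ i false → ¬ One γ i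
      old-zero b (inj₁ b') with () ← C.Bit-unique b b'
      old-zero b (inj₂ (h , _)) = ℕₚ.<⇒≱ (C.Bit-bound b) h

      new-zero : ∀ {γ i} → C.height ≤ⁿ i → ¬ (γ ≋ μ) → ¬ One γ i
      new-zero h γ≉μ (inj₁ b) = ℕₚ.<⇒≱ (C.Bit-bound b) h
      new-zero h γ≉μ (inj₂ (_ , r)) = γ≉μ r

    blueprint : Blueprint κ
    blueprint = record
      { support = extra ++ˡ C.support
      ; ⊆κ = λ a → [ extra⊆κ , (λ b → C.Dom⊆κ (C.⇒Dom b)) ]′ (Anyₚ.++⁻ extra a)
      ; height = n
      ; value = λ γ i → decide (One γ i)
      ; value-resp = λ i r → decide-cong (One-resp r) (One-resp (≋-sym r))
      ; Edge = Link c
      ; Edge-resp = Link-resp ≋-refl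
      ; Edge-sym = Link-sym
      ; Edge-unique = C.Link-unique
      ; Edge-dom = λ l → let a , b , d , e = C.Link-dom l in
          Anyₚ.++⁺ʳ extra (C.Dom⇒ a) , Anyₚ.++⁺ʳ extra (C.Dom⇒ b) , d , ℕₚ.<-≤-trans e N≤n
      ; Edge-disjoint = disjoint }
      where
      disjoint : ∀ {α β k i} → Link c α β k → k ≤ⁿ i → i <ⁿ n → decide (One α i) ≡ false ⊎ decide (One β i) ≡ false
      disjoint {α} {β} {k} {i} l k≤i i<n with i ℕₚ.<? C.height
      ... | yes i<N = [ (λ b → inj₁ (decide-false (old-zero b))) , (λ b → inj₂ (decide-false (old-zero b))) ]′ (C.Link-disjoint l k≤i i<N)
      -- In a new column only the row of `μ` contains a one, and the two ends of a link are
      -- distinct.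
      ... | no i≮N with dec₀ (α ≋ μ)
      ...   | no α≉μ = inj₁ (decide-false (new-zero (ℕₚ.≮⇒≥ i≮N) α≉μ))
      ...   | yes α≋μ = inj₂ (decide-false (new-zero (ℕₚ.≮⇒≥ i≮N) λ β≋μ →
                proj₁ (proj₂ (proj₂ (C.Link-dom l))) (≋-trans α≋μ (≋-sym β≋μ))))

    open Build em blueprint public

    opaque

      old-dom : ∀ {γ} → Dom c γ → Dom built γ
      old-dom d = Dom⁺ (Anyₚ.++⁺ʳ extra (C.Dom⇒ d))

      new-dom : ∀ {γ} → γ ∈ˡ extra → Dom built γ
      new-dom a = Dom⁺ (Anyₚ.++⁺ˡ a)

      raises : Extends built c
      raises = extends old-dom
        (λ {γ} {i} {b} a → subst (Bit built γ i) (bits a) (Bit⁺ (Anyₚ.++⁺ʳ extra (C.Dom⇒ (Bit⇒Dom a))) (ℕₚ.<-≤-trans (C.Bit-bound a) N≤n)))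
        Link⁺
        where
        bits : ∀ {γ i b} → Bit c γ i b → decide (One γ i) ≡ b
        bits {b = true} a = decide-true (inj₁ a)
        bits {b = false} a = decide-false (old-zero a)

      total : ∀ {γ i} → Dom built γ → i <ⁿ n → Σ Bool λ b → Bit built γ i b
      total d i<n = _ , Bit⁺ (Dom⁻ d) i<n

      marked : ∀ {i} → Dom built μ → C.height ≤ⁿ i → i <ⁿ n → Bit built μ i true
      marked {i} d h i<n = subst (Bit built μ i) (decide-true (inj₂ (h , ≋-refl))) (Bit⁺ (Dom⁻ d) i<n)

      unmarked : ∀ {γ i} → Dom built γ → ¬ (γ ≋ μ) → C.height ≤ⁿ i → i <ⁿ n → Bit built γ i false
      unmarked {γ} {i} d γ≉μ h i<n = subst (Bit built γ i) (decide-false (new-zero h γ≉μ)) (Bit⁺ (Dom⁻ d) i<n)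

  -- A row for m that copies the row of α, with the links of α.
  module Copy {c} (C : View κ c) {α m} (α∈ : Dom c α) (m∊κ : m ∊ κ) (m∉ : ¬ Dom c m) where

    private
      module C = View C

      One : V → ℕ → Set₁
      One γ i = Bit c γ i true ⊎ (γ ≋ m × Bit c α i true)

      One-resp : ∀ {γ γ' i} → γ ≋ γ' → One γ i → One γ' i
      One-resp r = [ (λ b → inj₁ (Bit-resp ≋-refl r b)) , (λ (s , b) → inj₂ (≋-trans (≋-sym r) s , b)) ]′

      old-zero : ∀ {γ i} → Bit c γ i false → ¬ One γ i
      old-zero b (inj₁ b') with () ← C.Bit-unique b b'
      old-zero b (inj₂ (r , _)) = m∉ (Dom-resp ≋-refl r (Bit⇒Dom b))

      copy-zero : ∀ {γ i} → γ ≋ m → Bit c α i false → ¬ One γ i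
      copy-zero r b (inj₁ b') = m∉ (Dom-resp ≋-refl r (Bit⇒Dom b'))
      copy-zero r b (inj₂ (_ , b')) with () ← C.Bit-unique b b'

      -- The copy is not linked to `α` itself, since a link of `α` has a different other end; two
      -- equal rows never have to be almost disjoint here.
      Edge : V → V → ℕ → Set₁
      Edge γ δ k = Link c γ δ k ⊎ (γ ≋ m × Link c α δ k) ⊎ (δ ≋ m × Link c γ α k)

      left : ∀ {γ δ k} → Link c γ δ k → Dom c γ
      left l = proj₁ (C.Link-dom l)

      right : ∀ {γ δ k} → Link c γ δ k → Dom c δ
      right l = proj₁ (proj₂ (C.Link-dom l))

    blueprint : Blueprint κ
    blueprint = record
      { support = m List.∷ C.support
      ; ⊆κ = λ { (here r) → ∊-respˡ (≋-sym r) m∊κ ; (there a) → C.Dom⊆κ (C.⇒Dom a) }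
      ; height = C.height
      ; value = λ γ i → decide (One γ i)
      ; value-resp = λ i r → decide-cong (One-resp r) (One-resp (≋-sym r))
      ; Edge = Edge
      ; Edge-resp = λ r s → λ { (inj₁ l) → inj₁ (Link-resp ≋-refl r s l)
                              ; (inj₂ (inj₁ (t , l))) → inj₂ (inj₁ (≋-trans (≋-sym r) t , Link-resp ≋-refl ≋-refl s l))
                              ; (inj₂ (inj₂ (t , l))) → inj₂ (inj₂ (≋-trans (≋-sym s) t , Link-resp ≋-refl r ≋-refl l)) }
      ; Edge-sym = λ { (inj₁ l) → inj₁ (Link-sym l)
                     ; (inj₂ (inj₁ (t , l))) → inj₂ (inj₂ (t , Link-sym l))
                     ; (inj₂ (inj₂ (t , l))) → inj₂ (inj₁ (t , Link-sym l)) }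
      ; Edge-unique = unique
      ; Edge-dom = λ { (inj₁ l) → let a , b , d , e = C.Link-dom l in there (C.Dom⇒ a) , there (C.Dom⇒ b) , d , e
                     ; (inj₂ (inj₁ (t , l))) → let a , b , d , e = C.Link-dom l in
                         here t , there (C.Dom⇒ b) , (λ s → m∉ (Dom-resp ≋-refl (≋-trans (≋-sym s) t) b)) , e
                     ; (inj₂ (inj₂ (t , l))) → let a , b , d , e = C.Link-dom l in
                         there (C.Dom⇒ a) , here t , (λ s → m∉ (Dom-resp ≋-refl (≋-trans s t) a)) , e }
      ; Edge-disjoint = disjoint }
      where
      unique : ∀ {γ δ k k'} → Edge γ δ k → Edge γ δ k' → k ≡ k'
      unique (inj₁ l) (inj₁ l') = C.Link-unique l l'
      unique (inj₁ l) (inj₂ (inj₁ (t , _))) = ⊥-elim (m∉ (Dom-resp ≋-refl t (left l)))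
      unique (inj₁ l) (inj₂ (inj₂ (t , _))) = ⊥-elim (m∉ (Dom-resp ≋-refl t (right l)))
      unique (inj₂ (inj₁ (t , _))) (inj₁ l) = ⊥-elim (m∉ (Dom-resp ≋-refl t (left l)))
      unique (inj₂ (inj₁ (_ , l))) (inj₂ (inj₁ (_ , l'))) = C.Link-unique l l'
      unique (inj₂ (inj₁ (t , _))) (inj₂ (inj₂ (_ , l))) = ⊥-elim (m∉ (Dom-resp ≋-refl t (left l)))
      unique (inj₂ (inj₂ (t , _))) (inj₁ l) = ⊥-elim (m∉ (Dom-resp ≋-refl t (right l)))
      unique (inj₂ (inj₂ (t , _))) (inj₂ (inj₁ (_ , l))) = ⊥-elim (m∉ (Dom-resp ≋-refl t (right l)))
      unique (inj₂ (inj₂ (_ , l))) (inj₂ (inj₂ (_ , l'))) = C.Link-unique l l'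
      disjoint : ∀ {γ δ k i} → Edge γ δ k → k ≤ⁿ i → i <ⁿ C.height → decide (One γ i) ≡ false ⊎ decide (One δ i) ≡ false
      disjoint (inj₁ l) k≤i i<N = [ (λ b → inj₁ (decide-false (old-zero b))) , (λ b → inj₂ (decide-false (old-zero b))) ]′
        (C.Link-disjoint l k≤i i<N)
      disjoint (inj₂ (inj₁ (t , l))) k≤i i<N =
        [ (λ b → inj₁ (decide-false (copy-zero t b))) , (λ b → inj₂ (decide-false (old-zero b))) ]′ (C.Link-disjoint l k≤i i<N)
      disjoint (inj₂ (inj₂ (t , l))) k≤i i<N =
        [ (λ b → inj₁ (decide-false (old-zero b))) , (λ b → inj₂ (decide-false (copy-zero t b))) ]′ (C.Link-disjoint l k≤i i<N)

    open Build em blueprint public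

    opaque

      copies : Extends built c
      copies = extends (λ d → Dom⁺ (there (C.Dom⇒ d)))
        (λ {γ} {i} {b} a → subst (Bit built γ i) (bits a) (Bit⁺ (there (C.Dom⇒ (Bit⇒Dom a))) (C.Bit-bound a)))
        (λ l → Link⁺ (inj₁ l))
        where
        bits : ∀ {γ i b} → Bit c γ i b → decide (One γ i) ≡ b
        bits {b = true} a = decide-true (inj₁ a)
        bits {b = false} a = decide-false (old-zero a)

      copy-dom : Dom built m
      copy-dom = Dom⁺ (here ≋-refl)

      copy-bit : ∀ {i b} → Bit c α i b → Bit built m i b
      copy-bit {i} {b} a = subst (Bit built m i) (bits a) (Bit⁺ (here ≋-refl) (C.Bit-bound a))
        where
        bits : ∀ {b} → Bit c α i b → decide (One m i) ≡ b
        bits {true} a = decide-true (inj₂ (≋-refl , a))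
        bits {false} a = decide-false (copy-zero ≋-refl a)

      copy-link : ∀ {δ k} → Link c α δ k → Link built m δ k
      copy-link l = Link⁺ (inj₂ (inj₁ (≋-refl , l)))

  -- A common extension of e and c in which the row of α copies that of m in e.
  module Amalgam {e c} (E : View κ e) (C : View κ c) {α m}
    (α∈ : Dom c α) (α∉ : ¬ Dom e α) (m∈ : Dom e m)
    (bits  : ∀ {γ i b} → Dom e γ → Bit c γ i b → Bit e γ i b)
    (bitsα : ∀ {i b} → Bit c α i b → Bit e m i b)
    (links  : ∀ {γ δ k} → Dom e γ → Dom e δ → Link c γ δ k → Link e γ δ k)
    (linksα : ∀ {δ k} → Dom e δ → Link c α δ k → Link e m δ k) where

    private
      module E = View E
      module C = View C

      One : V → ℕ → Set₁
      One γ i = Bit e γ i true ⊎ (γ ≋ α × Bit e m i true) ⊎ Bit c γ i true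

      One-resp : ∀ {γ γ' i} → γ ≋ γ' → One γ i → One γ' i
      One-resp r (inj₁ b) = inj₁ (Bit-resp ≋-refl r b)
      One-resp r (inj₂ (inj₁ (s , b))) = inj₂ (inj₁ (≋-trans (≋-sym r) s , b))
      One-resp r (inj₂ (inj₂ b)) = inj₂ (inj₂ (Bit-resp ≋-refl r b))

      -- In `c` the row of `α` has a bit in each column, and `bitsα` finds all of these bits in the
      -- row of `m` in `e`.
      height≤ : C.height ≤ⁿ E.height
      height≤ with C.height ℕₚ.≤? E.height
      ... | yes le = le
      ... | no ¬le = ⊥-elim (ℕₚ.<-irrefl refl (E.Bit-bound (bitsα (proj₂ (C.Bit-total α∈ (ℕₚ.≰⇒> ¬le))))))

      clash : ∀ {γ i} → Bit e γ i true → ¬ Bit e γ i false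
      clash b b' with () ← E.Bit-unique b b'

      zero-c : ∀ {γ i} → Bit c γ i false → ¬ One γ i
      zero-c z (inj₁ b) = clash b (bits (Bit⇒Dom b) z)
      zero-c z (inj₂ (inj₁ (r , b))) = clash b (bitsα (Bit-resp ≋-refl r z))
      zero-c z (inj₂ (inj₂ b)) with () ← C.Bit-unique b z

      zero-e : ∀ {γ i} → Bit e γ i false → ¬ One γ i
      zero-e z (inj₁ b) = clash b z
      zero-e z (inj₂ (inj₁ (r , b))) = α∉ (Dom-resp ≋-refl r (Bit⇒Dom z))
      zero-e z (inj₂ (inj₂ b)) = clash (bits (Bit⇒Dom z) b) z

      zero-α : ∀ {γ i} → γ ≋ α → Bit e m i false → ¬ One γ i
      zero-α r z (inj₁ b) = α∉ (Dom-resp ≋-refl r (Bit⇒Dom b))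
      zero-α r z (inj₂ (inj₁ (_ , b))) = clash b z
      zero-α r z (inj₂ (inj₂ b)) = clash (bitsα (Bit-resp ≋-refl r b)) z

      zero-new : ∀ {γ i} → ¬ Dom e γ → ¬ (γ ≋ α) → C.height ≤ⁿ i → ¬ One γ i
      zero-new γ∉ γ≉α h (inj₁ b) = γ∉ (Bit⇒Dom b)
      zero-new γ∉ γ≉α h (inj₂ (inj₁ (r , _))) = γ≉α r
      zero-new γ∉ γ≉α h (inj₂ (inj₂ b)) = ℕₚ.<⇒≱ (C.Bit-bound b) h

      -- `α` takes over the row of `m` but not the links that `m` has in `e`: only the links it has
      -- in `c` constrain it.
      Edge : V → V → ℕ → Set₁
      Edge γ δ k = Link e γ δ k ⊎ Link c γ δ k

      Off : V → V → ℕ → Set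
      Off γ δ i = decide (One γ i) ≡ false ⊎ decide (One δ i) ≡ false

      disjoint-e : ∀ {γ δ k i} → Link e γ δ k → k ≤ⁿ i → i <ⁿ E.height → Off γ δ i
      disjoint-e l k≤i i<N = [ (λ z → inj₁ (decide-false (zero-e z))) , (λ z → inj₂ (decide-false (zero-e z))) ]′
        (E.Link-disjoint l k≤i i<N)

      disjoint-α : ∀ {γ δ k i} → γ ≋ α → Dom e δ → Link c γ δ k → k ≤ⁿ i → i <ⁿ E.height → Off γ δ i
      disjoint-α r d l k≤i i<N = [ (λ z → inj₁ (decide-false (zero-α r z))) , (λ z → inj₂ (decide-false (zero-e z))) ]′
        (E.Link-disjoint (linksα d (Link-resp ≋-refl r ≋-refl l)) k≤i i<N)

      disjoint : ∀ {γ δ k i} → Edge γ δ k → k ≤ⁿ i → i <ⁿ E.height → Off γ δ i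
      disjoint (inj₁ l) k≤i i<N = disjoint-e l k≤i i<N
      disjoint {γ} {δ} {k} {i} (inj₂ l) k≤i i<N with i ℕₚ.<? C.height
      ... | yes i<C = [ (λ z → inj₁ (decide-false (zero-c z))) , (λ z → inj₂ (decide-false (zero-c z))) ]′ (C.Link-disjoint l k≤i i<C)
      -- Above the height of `c`, a row that is neither in `e` nor that of `α` is zero. The other
      -- links of `c` have both ends in `dom e` or at `α`, and these correspond to links of `e`,
      -- with `m` in place of `α`.
      ... | no i≮C with dec (Dom e γ) | dec₀ (γ ≋ α) | dec (Dom e δ) | dec₀ (δ ≋ α)
      ...   | no γ∉ | no γ≉α | _ | _ = inj₁ (decide-false (zero-new γ∉ γ≉α (ℕₚ.≮⇒≥ i≮C)))
      ...   | _ | _ | no δ∉ | no δ≉α = inj₂ (decide-false (zero-new δ∉ δ≉α (ℕₚ.≮⇒≥ i≮C)))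
      ...   | yes a | _ | yes b | _ = disjoint-e (links a b l) k≤i i<N
      ...   | _ | yes r | yes b | _ = disjoint-α r b l k≤i i<N
      ...   | yes a | _ | _ | yes s = [ inj₂ , inj₁ ]′ (disjoint-α s a (Link-sym l) k≤i i<N)
      ...   | _ | yes r | _ | yes s = ⊥-elim (proj₁ (proj₂ (proj₂ (C.Link-dom l))) (≋-trans r (≋-sym s)))

    blueprint : Blueprint κ
    blueprint = record
      { support = E.support ++ˡ C.support
      ; ⊆κ = λ a → [ (λ b → E.Dom⊆κ (E.⇒Dom b)) , (λ b → C.Dom⊆κ (C.⇒Dom b)) ]′ (Anyₚ.++⁻ E.support a)
      ; height = E.height
      ; value = λ γ i → decide (One γ i)
      ; value-resp = λ i r → decide-cong (One-resp r) (One-resp (≋-sym r))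
      ; Edge = Edge
      ; Edge-resp = λ r s → [ (λ l → inj₁ (Link-resp ≋-refl r s l)) , (λ l → inj₂ (Link-resp ≋-refl r s l)) ]′
      ; Edge-sym = [ (λ l → inj₁ (Link-sym l)) , (λ l → inj₂ (Link-sym l)) ]′
      ; Edge-unique = unique
      ; Edge-dom = λ { (inj₁ l) → let a , b , d , h = E.Link-dom l in Anyₚ.++⁺ˡ (E.Dom⇒ a) , Anyₚ.++⁺ˡ (E.Dom⇒ b) , d , h
                     ; (inj₂ l) → let a , b , d , h = C.Link-dom l in
                         Anyₚ.++⁺ʳ E.support (C.Dom⇒ a) , Anyₚ.++⁺ʳ E.support (C.Dom⇒ b) , d , ℕₚ.<-≤-trans h height≤ }
      ; Edge-disjoint = disjoint }
      where
      mixed : ∀ {γ δ k k'} → Link e γ δ k → Link c γ δ k' → k ≡ k'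
      mixed l l' = let a , b , _ = E.Link-dom l in E.Link-unique l (links a b l')
      unique : ∀ {γ δ k k'} → Edge γ δ k → Edge γ δ k' → k ≡ k'
      unique (inj₁ l) (inj₁ l') = E.Link-unique l l'
      unique (inj₁ l) (inj₂ l') = mixed l l'
      unique (inj₂ l) (inj₁ l') = sym (mixed l' l)
      unique (inj₂ l) (inj₂ l') = C.Link-unique l l'

    open Build em blueprint public

    opaque

      extends-e : Extends built e
      extends-e = extends (λ d → Dom⁺ (Anyₚ.++⁺ˡ (E.Dom⇒ d)))
        (λ {γ} {i} {b} a → subst (Bit built γ i) (same a) (Bit⁺ (Anyₚ.++⁺ˡ (E.Dom⇒ (Bit⇒Dom a))) (E.Bit-bound a)))
        (λ l → Link⁺ (inj₁ l))
        where
        same : ∀ {γ i b} → Bit e γ i b → decide (One γ i) ≡ b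
        same {b = true} a = decide-true (inj₁ a)
        same {b = false} a = decide-false (zero-e a)

      extends-c : Extends built c
      extends-c = extends (λ d → Dom⁺ (Anyₚ.++⁺ʳ E.support (C.Dom⇒ d)))
        (λ {γ} {i} {b} a → subst (Bit built γ i) (same a)
          (Bit⁺ (Anyₚ.++⁺ʳ E.support (C.Dom⇒ (Bit⇒Dom a))) (ℕₚ.<-≤-trans (C.Bit-bound a) height≤)))
        (λ l → Link⁺ (inj₂ l))
        where
        same : ∀ {γ i b} → Bit c γ i b → decide (One γ i) ≡ b
        same {b = true} a = decide-true (inj₂ (inj₂ a))
        same {b = false} a = decide-false (zero-c a)

      copied : ∀ {i b} → Bit e m i b → Bit built α i b
      copied {i} {b} a = subst (Bit built α i) (same a) (Bit⁺ (Anyₚ.++⁺ʳ E.support (C.Dom⇒ α∈)) (E.Bit-bound a))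
        where
        same : ∀ {b} → Bit e m i b → decide (One α i) ≡ b
        same {true} a = decide-true (inj₂ (inj₁ (≋-refl , a)))
        same {false} a = decide-false (zero-α ≋-refl a)


-- The indices of bad conditions

module Heart (em : ExcludedMiddle (lsuc 0ℓ)) (M : V) (M-transitive : Transitive M) (zfc : ZFC M)
             (κ : V) (κ∊M : κ ∊ M) (ℙ : V) (ℙ∊M : ℙ ∊ M) (poset : IsHechlerPoset κ ℙ)
             (ω⊆κ : ∀ n → num n ∊ κ) where

  open Classical em
  open Model em M M-transitive zfc
  open Constructions em M M-transitive zfc
  open Smallness em M M-transitive zfc κ κ∊M
  open Hechler em M M-transitive zfc κ κ∊M ℙ ℙ∊M poset hiding (ω⊆κ)
  open Extension em κ

  infix 4 _≼_
  _≼_ : V → V → Set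
  e ≼ c = ⟨ e , c ⟩ ∊ Le

  -- `Q` may be any class of `V`. As smallness only asks for a cover in `M`, pigeonhole arguments
  -- can split `Q` by predicates that are not definable in `M`.
  Unbounded : (V → V → Set₁) → Set₁
  Unbounded Q = ¬ Small (λ α → Σ V λ c → Q c α)

  opaque

    avoid : {Q : V → V → Set₁} {P : V → Set₁} → Unbounded Q → Small P →
      Σ V λ α → α ∊ κ × ¬ P α × Σ V λ c → Q c α
    avoid {Q} {P} unbounded small = stable _ λ none → unbounded (Small-⊆
      (λ α α∊κ (c , q) → stable (P α) λ ¬Pα → none (α , α∊κ , ¬Pα , c , q)) small)

    split : {Q P : V → V → Set₁} → Unbounded Q →
      Unbounded (λ c α → Q c α × P c α) ⊎ Unbounded (λ c α → Q c α × ¬ P c α)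
    split {Q} {P} unbounded with dec (Small (λ α → Σ V λ c → Q c α × P c α))
    ... | no ¬small = inj₁ ¬small
    ... | yes small = inj₂ λ small' → unbounded (Small-⊆ cases (Small-⊎ small small'))
      where
      cases : ∀ α → α ∊ κ → (Σ V λ c → Q c α) → (Σ V λ c → Q c α × P c α) ⊎ (Σ V λ c → Q c α × ¬ P c α)
      cases α _ (c , q) with dec (P c α)
      ... | yes p = inj₁ (c , q , p)
      ... | no ¬p = inj₂ (c , q , ¬p)

    Small-list : {P : V → V → Set₁} (xs : List V) → (∀ {γ} → γ ∈ˡ xs → Small (P γ)) → Small (λ x → Any (λ γ → P γ x) xs)
    Small-list List.[] _ = Small-⊆ {Q = λ _ → ⊥} (λ x _ ()) Small-∅
    Small-list {P} (γ List.∷ xs) small = Small-⊆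
      (λ { x _ (here p) → inj₁ p ; x _ (there a) → inj₂ a })
      (Small-⊎ (small (here ≋-refl)) (Small-list {P} xs (λ a → small (there a))))

    fresh : ∀ xs → Σ ℕ λ N → ∀ m → N ≤ⁿ m → ¬ (num m ∈ˡ xs)
    fresh List.[] = 0 , λ m _ ()
    fresh (x List.∷ xs) with fresh xs | dec (Σ ℕ λ n → Lift (lsuc 0ℓ) (num n ≋ x))
    ... | N , p | no ¬n = N , λ { m h (here r) → ¬n (m , lift r) ; m h (there a) → p m h a }
    ... | N , p | yes (n , lift r) = suc n +ⁿ N , λ
          { m h (here s) → ℕₚ.<⇒≢ (ℕₚ.≤-trans (ℕₚ.m≤m+n (suc n) N) h) (num-injective (≋-trans r (≋-sym s)))
          ; m h (there a) → p m (ℕₚ.≤-trans (ℕₚ.m≤n+m N (suc n)) h) a }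

  -- Thinning out as a closure property: `hom-one` makes one predicate constant on an unbounded
  -- subclass, and products and finite families iterate this.
  Homogeneous : (V → V → V → V → Set₁) → Set₂
  Homogeneous K = ∀ Q → Unbounded Q → Σ (V → V → Set₁) λ Q' → (∀ {c α} → Q' c α → Q c α) × Unbounded Q' ×
    (∀ {c α c' α'} → Q' c α → Q' c' α' → K c α c' α')

  opaque

    hom-one : (P : V → V → Set₁) → Homogeneous (λ c α c' α' → P c α → P c' α')
    hom-one P Q unbounded with split {Q} {P} unbounded
    ... | inj₁ u = (λ c α → Q c α × P c α) , proj₁ , u , λ _ (_ , p) _ → p
    ... | inj₂ u = (λ c α → Q c α × ¬ P c α) , proj₁ , u , λ (_ , ¬p) _ p → ⊥-elim (¬p p)

    hom-× : ∀ {K L} → Homogeneous K → Homogeneous L → Homogeneous (λ c α c' α' → K c α c' α' × L c α c' α')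
    hom-× hK hL Q u with hK Q u
    ... | Q' , sub , u' , k with hL Q' u'
    ...   | Q'' , sub' , u'' , l = Q'' , (λ q → sub (sub' q)) , u'' , λ q q' → k (sub' q) (sub' q') , l q q'

    hom-Fin : ∀ {m} {K : Fin m → V → V → V → V → Set₁} → (∀ i → Homogeneous (K i)) →
      Homogeneous (λ c α c' α' → ∀ i → K i c α c' α')
    hom-Fin {zero} h Q u = Q , (λ q → q) , u , λ _ _ ()
    hom-Fin {suc m} {K} h Q u with hom-× (h zero) (hom-Fin {m} (λ i → h (suc i))) Q u
    ... | Q' , sub , u' , k = Q' , sub , u' , λ q q' → λ { zero → proj₁ (k q q') ; (suc i) → proj₂ (k q q') i }

    size-bound : ∀ {c n k} {ρ : Fin k → V} → Size≤ c n → (∀ i → Dom c (ρ i)) → (∀ {i j} → ρ i ≋ ρ j → i ≡ j) → k ≤ⁿ n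
    size-bound {c} {n} {k} {ρ} size d distinct = injective⇒≤ {f = λ i → fromℕ< (proj₂ (place (d i)))} λ {i} {j} eq →
      distinct (place-injective (d i) (d j) (trans (sym (toℕ-fromℕ< (proj₂ (place (d i)))))
        (trans (cong toℕ eq) (toℕ-fromℕ< (proj₂ (place (d j)))))))
      where open Size≤ size

  module _ {B : V} (B∊M : B ∊ M) (B⊆ : ∀ {c α} → ⟨ c , α ⟩ ∊ B → c ∊ ℙ × α ∊ κ)
           (B-open : ∀ {c e α} → ⟨ c , α ⟩ ∊ B → e ≼ c → ⟨ e , α ⟩ ∊ B) where

    -- e forces every real that begins with e(m) into U.
    Good : V → V → Set₁
    Good e m = ∀ α e' → α ∊ κ → e' ∊ ℙ → e' ≼ e → (∀ {i b} → Bit e m i b → Bit e' α i b) → ¬ (⟨ e' , α ⟩ ∊ B)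

    module _ {c₀ : V} (c₀∊ℙ : c₀ ∊ ℙ)
             (good : ∀ m e → e ∊ ℙ → e ≼ c₀ → Σ V λ e' → e' ∊ ℙ × e' ≼ e × Good e' (num m)) where

      Bad : ℕ → V → V → Set₁
      Bad n c α = c ∊ ℙ × c ≼ c₀ × ⟨ c , α ⟩ ∊ B × Dom c α × Size≤ c n

      private
        Covers : ℕ → ∀ {k} → (Fin k → V) → V → V → Set₁
        Covers n ρ c α = Bad n c α × (∀ i → Dom c (ρ i))

        Off : ∀ {k} → V → (Fin k → V) → Set
        Off γ ρ = ∀ i → ¬ (γ ≋ ρ i)

      opaque

        -- The maximal ρ replaces the root of a Δ-system.
        root : ∀ n fuel {k} (ρ : Fin k → V) → (∀ {i j} → ρ i ≋ ρ j → i ≡ j) → Unbounded (Covers n ρ) → n ≤ⁿ k +ⁿ fuel →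
          Σ ℕ λ k' → Σ (Fin k' → V) λ ρ' → Unbounded (Covers n ρ') ×
            (∀ γ → γ ∊ κ → Off γ ρ' → Small (λ α → Σ V λ c → Covers n (γ ∷ ρ') c α))
        root n fuel {k} ρ distinct unbounded n≤ with dec (Σ V λ γ → γ ∊ κ × Off γ ρ × Unbounded (Covers n (γ ∷ ρ)))
        ... | no ¬γ = k , ρ , unbounded , λ γ γ∊κ off → stable _ λ ¬small → ¬γ (γ , γ∊κ , off , ¬small)
        ... | yes (γ , γ∊κ , off , unb) = next fuel n≤
          where
          distinct' : ∀ {i j} → (γ ∷ ρ) i ≋ (γ ∷ ρ) j → i ≡ j
          distinct' {zero} {zero} _ = refl
          distinct' {zero} {suc j} r = ⊥-elim (off j r)
          distinct' {suc i} {zero} r = ⊥-elim (off i (≋-sym r))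
          distinct' {suc i} {suc j} r = cong suc (distinct r)
          next : ∀ fuel → n ≤ⁿ k +ⁿ fuel → Σ ℕ λ k' → Σ (Fin k' → V) λ ρ' → Unbounded (Covers n ρ') ×
            (∀ γ → γ ∊ κ → Off γ ρ' → Small (λ α → Σ V λ c → Covers n (γ ∷ ρ') c α))
          next (suc fuel) h = root n fuel (γ ∷ ρ) distinct' unb (subst (n ≤ⁿ_) (ℕₚ.+-suc k fuel) h)
          -- Without fuel, `γ ∷ ρ` has more than `n` distinct entries in a domain of size at most
          -- `n`.
          next zero h with avoid {P = λ _ → Lift (lsuc 0ℓ) ⊥} unb (Small-⊆ (λ x _ → lower) Small-∅)
          ... | α , _ , _ , c , (_ , _ , _ , _ , size) , doms = ⊥-elim (ℕₚ.<⇒≱ (size-bound size doms distinct')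
                (subst (n ≤ⁿ_) (ℕₚ.+-identityʳ k) h))

      -- The entry 0 of `α ∷ ρ` moves with the condition while the root stays fixed. Only finitely
      -- many predicates are compared, and for conditions of size at most `n` they determine all
      -- bits and links on these rows.
      Same : ℕ → ∀ {k} → (Fin k → V) → V → V → V → V → Set₁
      Same n {k} ρ c α c' α' =
        (∀ (l : Fin (suc k)) (i : Fin n) →
          (Bit c ((α ∷ ρ) l) (toℕ i) true → Bit c' ((α' ∷ ρ) l) (toℕ i) true) ×
          (Bit c ((α ∷ ρ) l) (toℕ i) false → Bit c' ((α' ∷ ρ) l) (toℕ i) false)) ×
        (∀ (l l' : Fin (suc k)) (i : Fin n) →
          Link c ((α ∷ ρ) l) ((α ∷ ρ) l') (toℕ i) → Link c' ((α' ∷ ρ) l) ((α' ∷ ρ) l') (toℕ i))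

      opaque

        same : ∀ n {k} (ρ : Fin k → V) → Homogeneous (Same n ρ)
        same n ρ = hom-×
          (hom-Fin λ l → hom-Fin λ i → hom-× (hom-one (λ c α → Bit c ((α ∷ ρ) l) (toℕ i) true))
                                             (hom-one (λ c α → Bit c ((α ∷ ρ) l) (toℕ i) false)))
          (hom-Fin λ l → hom-Fin λ l' → hom-Fin λ i → hom-one (λ c α → Link c ((α ∷ ρ) l) ((α ∷ ρ) l') (toℕ i)))

        -- The amalgam lies below `c'`, so it inherits that `c'` is bad for `α'`. It also lies below
        -- `e`, and its row at `α'` continues that of `m`, which goodness of `e` excludes.
        amalgamate : ∀ {n k} {ρ : Fin k → V} {c α c' α' e m} → Bad n c α → Bad n c' α' →
          Same n ρ c' α' c α → e ∊ ℙ → e ≼ c → Dom e (num m) →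
          (∀ {i b} → Bit c α i b → Bit e (num m) i b) → (∀ {δ k} → Link c α δ k → Link e (num m) δ k) →
          Good e (num m) → α' ∊ κ → ¬ Dom e α' → (∀ {γ} → Dom e γ → Dom c' γ → Σ (Fin k) λ l → γ ≋ ρ l) → ⊥
        amalgamate {n} {k} {ρ} {c} {α} {c'} {α'} {e} {m} (c∊ℙ , _) (c'∊ℙ , _ , bad , α'∈ , size) (sameᵇ , sameˡ)
          e∊ℙ e≼c m∈ copyᵇ copyˡ gd α'∊κ α'∉ meet =
          gd α' A.built α'∊κ A∊ℙ (Le⁺ A∊ℙ e∊ℙ A.extends-e) A.copied (B-open bad (Le⁺ A∊ℙ c'∊ℙ A.extends-c))
          where
          module C' = View (ℙ-view c'∊ℙ)
          open Extends (proj₂ (proj₂ (Le⁻ e≼c))) renaming (bits to e-bits; links to e-links)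
          i<n : ∀ {γ i b} → Bit c' γ i b → i <ⁿ n
          i<n = Size≤.bits< size
          bitᵗ : ∀ l {i b} → Bit c' ((α' ∷ ρ) l) i b → Bit c ((α ∷ ρ) l) i b
          bitᵗ l {i} {b} x = subst (λ j → Bit c ((α ∷ ρ) l) j b) (toℕ-fromℕ< (i<n x))
              (transfer b (subst (λ j → Bit c' ((α' ∷ ρ) l) j b) (sym (toℕ-fromℕ< (i<n x))) x))
            where
            transfer : ∀ b → Bit c' ((α' ∷ ρ) l) (toℕ (fromℕ< (i<n x))) b → Bit c ((α ∷ ρ) l) (toℕ (fromℕ< (i<n x))) b
            transfer true = proj₁ (sameᵇ l _)
            transfer false = proj₂ (sameᵇ l _)
          -- A link value is below the height, its end has a bit in that column, and columns with
          -- bits are below `n`.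
          k<n : ∀ {γ δ k} → Link c' γ δ k → k <ⁿ n
          k<n l = let d , _ , _ , k<h = C'.Link-dom l in i<n (proj₂ (C'.Bit-total d k<h))
          linkᵗ : ∀ l l' {k} → Link c' ((α' ∷ ρ) l) ((α' ∷ ρ) l') k → Link c ((α ∷ ρ) l) ((α ∷ ρ) l') k
          linkᵗ l l' {k} x = subst (Link c ((α ∷ ρ) l) ((α ∷ ρ) l')) (toℕ-fromℕ< (k<n x))
            (sameˡ l l' _ (subst (Link c' ((α' ∷ ρ) l) ((α' ∷ ρ) l')) (sym (toℕ-fromℕ< (k<n x))) x))
          bitsᵃ : ∀ {γ i b} → Dom e γ → Bit c' γ i b → Bit e γ i b
          bitsᵃ d x = let l , r = meet d (Bit⇒Dom x) in
            Bit-resp ≋-refl (≋-sym r) (e-bits (bitᵗ (suc l) (Bit-resp ≋-refl r x)))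
          linksᵃ : ∀ {γ δ k} → Dom e γ → Dom e δ → Link c' γ δ k → Link e γ δ k
          linksᵃ d d' x = let a , b , _ = C'.Link-dom x ; l , r = meet d a ; l' , r' = meet d' b in
            Link-resp ≋-refl (≋-sym r) (≋-sym r') (e-links (linkᵗ (suc l) (suc l') (Link-resp ≋-refl r r' x)))
          -- A link from `α'` into `dom e` ends in the root; by uniformity `α` has the same link in
          -- `c`, and `m` has received a copy of it.
          linksᵃα : ∀ {δ k} → Dom e δ → Link c' α' δ k → Link e (num m) δ k
          linksᵃα d x = let _ , b , _ = C'.Link-dom x ; l , r = meet d b in
            Link-resp ≋-refl ≋-refl (≋-sym r) (copyˡ (linkᵗ zero (suc l) (Link-resp ≋-refl ≋-refl r x)))
          module A = Amalgam (ℙ-view e∊ℙ) (ℙ-view c'∊ℙ) α'∈ α'∉ m∈ bitsᵃ (λ x → copyᵇ (bitᵗ zero x)) linksᵃ linksᵃα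
          A∊ℙ : A.built ∊ ℙ
          A∊ℙ = built∊ℙ A.blueprint

        bounded : ∀ n → Small (λ α → Σ V λ c → Bad n c α)
        bounded n = stable _ λ unbounded →
          let k , ρ , unb , maximal = root n n {0} [] (λ { {()} })
                (λ small → unbounded (Small-⊆ (λ α _ (c , b) → c , b , λ ()) small)) ℕₚ.≤-refl
              Q , Q⊆ , Q-unb , Q-same = same n ρ (Covers n ρ) unb
          in contradict ρ maximal Q Q⊆ Q-unb Q-same
          where
          contradict : ∀ {k} (ρ : Fin k → V) →
            (∀ γ → γ ∊ κ → Off γ ρ → Small (λ α → Σ V λ c → Covers n (γ ∷ ρ) c α)) →
            (Q : V → V → Set₁) → (∀ {c α} → Q c α → Covers n ρ c α) → Unbounded Q →
            (∀ {c α c' α'} → Q c α → Q c' α' → Same n ρ c α c' α') → ⊥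
          contradict {k} ρ maximal Q Q⊆ Q-unb Q-same
            with α , α∊κ , _ , c , q ← avoid {P = λ _ → Lift (lsuc 0ℓ) ⊥} Q-unb (Small-⊆ (λ x _ → lower) Small-∅)
            with bad@(c∊ℙ , c≼c₀ , _ , α∈ , _) , _ ← Q⊆ q
            with m , m∉ ← fresh (View.support (ℙ-view c∊ℙ))
            = finish
            where
            module C = View (ℙ-view c∊ℙ)
            module C⁺ = Copy (ℙ-view c∊ℙ) α∈ (ω⊆κ m) (λ d → m∉ m ℕₚ.≤-refl (C.Dom⇒ d))
            C⁺∊ℙ : C⁺.built ∊ ℙ
            C⁺∊ℙ = built∊ℙ C⁺.blueprint
            C⁺≼c₀ : C⁺.built ≼ c₀
            C⁺≼c₀ = Le⁺ C⁺∊ℙ c₀∊ℙ (Extends-trans C⁺.copies (proj₂ (proj₂ (Le⁻ c≼c₀))))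
            -- The indices ruled out by an element `γ` of `dom e`: `γ` itself, and, for `γ` off the
            -- root, every index with a bad condition whose domain contains `γ` besides the root.
            -- The second kind is small by maximality of `ρ`.
            Hit : V → V → Set₁
            Hit γ x = x ≋ γ ⊎ (Off γ ρ × Σ V λ c → Covers n (γ ∷ ρ) c x)
            Hit-small : ∀ {γ} → γ ∊ κ → Small (Hit γ)
            Hit-small {γ} γ∊κ = Small-⊎ (Small-singleton (M-trans κ∊M γ∊κ)) rest
              where
              rest : Small (λ x → Off γ ρ × Σ V λ c → Covers n (γ ∷ ρ) c x)
              rest with dec₀ (Off γ ρ)
              ... | yes off = Small-⊆ (λ x _ (_ , p) → p) (maximal γ γ∊κ off)
              ... | no ¬off = Small-⊆ {Q = λ _ → ⊥} (λ x _ (off , _) → ¬off off) Small-∅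
            finish : ⊥
            finish
              with e , e∊ℙ , e≼C⁺ , gd ← good m C⁺.built C⁺∊ℙ C⁺≼c₀
              with α' , α'∊κ , unhit , c' , q' ← avoid Q-unb (Small-list {Hit} (View.support (ℙ-view e∊ℙ))
                     (λ a → Hit-small (View.Dom⊆κ (ℙ-view e∊ℙ) (View.⇒Dom (ℙ-view e∊ℙ) a))))
              = amalgamate bad (proj₁ (Q⊆ q')) (Q-same q' q) e∊ℙ (Le⁺ e∊ℙ c∊ℙ (Extends-trans e⊇ C⁺.copies))
                  (E.doms C⁺.copy-dom) (λ x → E.bits (C⁺.copy-bit x)) (λ x → E.links (C⁺.copy-link x)) gd α'∊κ
                  (λ d → unhit (Any.map inj₁ (View.Dom⇒ (ℙ-view e∊ℙ) d)))
                  (λ {γ} d d' → stable₀ _ λ ¬l → unhit (Any.map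
                    (λ {γ'} r → inj₂ ((λ i s → ¬l (i , ≋-trans r s)) , c' , proj₁ (Q⊆ q') ,
                      λ { zero → Dom-resp ≋-refl r d' ; (suc i) → proj₂ (Q⊆ q') i })) (View.Dom⇒ (ℙ-view e∊ℙ) d)))
              where
              e⊇ : Extends e C⁺.built
              e⊇ = proj₂ (proj₂ (Le⁻ e≼C⁺))
              module E = Extends e⊇

        -- Every bad condition has a size, so the indices are the union over `n` of the classes
        -- treated by `bounded`. The relation `R` must lie in `M` for this union, which is why
        -- domain and size were made into sets of `M`.
        bad-small : Small (λ α → Σ V λ c → c ∊ ℙ × c ≼ c₀ × ⟨ c , α ⟩ ∊ B)
        bad-small
          with Ds , Ds∊M , Ds⁺ , Ds⁻ ← dom-set
          with Sz , Sz∊M , Sz⁺ , Sz⁻ ← size-set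
          with R , R∊M , R⁻ , R⁺ ← separate (⊗∊M ω∊M κ∊M) (∃ᶠ∈ (con ω ω∊M) (∃ᶠ∈ (con κ κ∊M) (x₂ ≈ᶠ ⟨ x₁ , x₀ ⟩ᵗ ∧ᶠ
                 ∃ᶠ∈ (con ℙ ℙ∊M) (⟨ x₀ , con c₀ (M-trans ℙ∊M c₀∊ℙ) ⟩ᵗ ∈ᶠ con Le Le∊M ∧ᶠ ⟨ x₀ , x₁ ⟩ᵗ ∈ᶠ con B B∊M ∧ᶠ
                   ⟨ x₀ , x₁ ⟩ᵗ ∈ᶠ con Ds Ds∊M ∧ᶠ ⟨ x₂ , x₀ ⟩ᵗ ∈ᶠ con Sz Sz∊M))))
          = Small-⊆ covered (countable-union R∊M λ n → Small-⊆ (sized n) (bounded n))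
          where
          sized : ∀ n α → α ∊ κ → ⟨ num n , α ⟩ ∊ R → Σ V λ c → Bad n c α
          sized n α _ a = let _ , n' , _ , α' , _ , r , c , c∊ℙ , c≼c₀ , b , d , s = R⁻ a
                              n≋ , α≋ = ⟨⟩-injective r
                          in c , c∊ℙ , c≼c₀ , ∊-respˡ (⟨⟩-cong ≋-refl (≋-sym α≋)) b ,
                             Dom-resp ≋-refl (≋-sym α≋) (Ds⁻ d) , Sz⁻ (∊-respˡ (⟨⟩-cong (≋-sym n≋) ≋-refl) s)
          covered : ∀ α → α ∊ κ → (Σ V λ c → c ∊ ℙ × c ≼ c₀ × ⟨ c , α ⟩ ∊ B) → Σ ℕ λ n → ⟨ num n , α ⟩ ∊ R
          covered α α∊κ (c , c∊ℙ , c≼c₀ , b) =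
            let n , s = Sz⁺ c⁺∊ℙ in n , R⁺ (∊⊗⁺ (num∊ω n) α∊κ) (num n , num∊ω n , α , α∊κ , ≋-refl , C⁺.built , c⁺∊ℙ ,
              Le⁺ c⁺∊ℙ c₀∊ℙ (Extends-trans C⁺.raises (proj₂ (proj₂ (Le⁻ c≼c₀)))) , B-open b (Le⁺ c⁺∊ℙ c∊ℙ C⁺.raises) ,
              Ds⁺ c⁺∊ℙ (C⁺.new-dom (here ≋-refl)) , s)
            where
            -- The height is unchanged: the extension only brings `α` into the domain, as `Bad`
            -- requires.
            module C⁺ = Raise (ℙ-view c∊ℙ) (α List.∷ List.[]) (∈ˡ-one α∊κ) α
                              (View.height (ℙ-view c∊ℙ)) ℕₚ.≤-refl
            c⁺∊ℙ : C⁺.built ∊ ℙ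
            c⁺∊ℙ = built∊ℙ C⁺.blueprint


-- The generic reals and their names

module Reals (em : ExcludedMiddle (lsuc 0ℓ)) (G : V) where

  open Classical em

  opaque

    real : V → V
    real α = χ (𝕒 G α)

  One : V → ℕ → Set₁
  One α i = Σ V λ c → c ∊ G × Bit c α i true

  opaque
    unfolding Bit real

    private
      𝕩⁺ : ∀ {α i} → One α i → ⟨ num i , num 1 ⟩ ∊ 𝕩 G α
      𝕩⁺ {α} (c , c∊G , p , q , r , y , a , b) =
        let j , p≋j = index (∊dom⁺ (∊-respˡ r c∊G))
        in ∊⋃⁺ {image (_′ α) (dom G)} (∊-index j (′-cong p≋j ≋-refl)) (∊′⁺ a b)

      𝕩⁻ : ∀ {α i} → ⟨ num i , num 1 ⟩ ∊ 𝕩 G α → One α i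
      𝕩⁻ {α} a with ∊⋃⁻ {image (_′ α) (dom G)} a
      ... | w , w∊ , b with index {y = image (_′ α) (dom G)} w∊
      ...   | j , w≋ =
        let p = el (dom G) j
            q , pq∊G = ∊dom⁻ (el∊ (dom G) j)
            y , d , f = ∊′⁻ {p} {α} (∊-respʳ w≋ b)
        in ⟨ p , q ⟩ , pq∊G , p , q , ≋-refl , y , d , f

    𝕒⁺ : ∀ {α i} → One α i → num i ∊ 𝕒 G α
    𝕒⁺ {α} {i} o = ∊-index {y = 𝕒 G α} (i , ∊-out (𝕩⁺ {α} o)) ≋-refl

    𝕒⁻ : ∀ {α i} → num i ∊ 𝕒 G α → One α i
    𝕒⁻ {α} {i} a with index {y = 𝕒 G α} a
    ... | (k , p) , r with num-injective {i} {k} r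
    ...   | refl = 𝕩⁻ {α} (∊-in p)

    real-one : ∀ {α i} → One α i → ⟨ num i , num 1 ⟩ ∊ real α
    real-one {α} {i} o = ∊-index {y = real α} (i , yes (∊-out (𝕒⁺ {α} o))) ≋-refl

    real-zero : ∀ {α i} → ¬ One α i → ⟨ num i , num 0 ⟩ ∊ real α
    real-zero {α} {i} ¬o = ∊-index {y = real α} (i , no (λ a → ¬o (𝕒⁻ {α} (∊-in a)))) ≋-refl

    real⁻ : ∀ {α z} → z ∊ real α → Σ ℕ λ i → (One α i × z ≋ ⟨ num i , num 1 ⟩) ⊎ (¬ One α i × z ≋ ⟨ num i , num 0 ⟩)
    real⁻ {α} a with index {y = real α} a
    ... | (i , yes p) , r = i , inj₁ (𝕒⁻ {α} (∊-in p) , r)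
    ... | (i , no ¬p) , r = i , inj₂ ((λ o → ¬p (∊-out (𝕒⁺ {α} o))) , r)

  opaque

    real-cong : ∀ {α β} → α ≋ β → real α ≋ real β
    real-cong r = ≋-ext (half r) (half (≋-sym r))
      where
      move : ∀ {α β i} → α ≋ β → One α i → One β i
      move r (c , c∊G , b) = c , c∊G , Bit-resp ≋-refl r b
      half : ∀ {α β} → α ≋ β → ∀ z → z ∊ real α → z ∊ real β
      half {α} {β} r z a with real⁻ {α} a
      ... | i , inj₁ (o , s) = ∊-respˡ (≋-sym s) (real-one {β} (move r o))
      ... | i , inj₂ (¬o , s) = ∊-respˡ (≋-sym s) (real-zero {β} (λ o → ¬o (move (≋-sym r) o)))

    real-single : ∀ α → SingleValued (real α)
    real-single α x y y' a b with real⁻ {α} a | real⁻ {α} b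
    ... | i , p | j , q with num-injective (≋-trans (≋-sym (fst p)) (fst q))
      where
      fst : ∀ {x y i} → (One α i × ⟨ x , y ⟩ ≋ ⟨ num i , num 1 ⟩) ⊎ (¬ One α i × ⟨ x , y ⟩ ≋ ⟨ num i , num 0 ⟩) → x ≋ num i
      fst = [ (λ (_ , s) → proj₁ (⟨⟩-injective s)) , (λ (_ , s) → proj₁ (⟨⟩-injective s)) ]′
    real-single α x y y' a b | i , inj₁ (_ , s) | .i , inj₁ (_ , t) | refl = ≋-trans (proj₂ (⟨⟩-injective s)) (≋-sym (proj₂ (⟨⟩-injective t)))
    real-single α x y y' a b | i , inj₂ (_ , s) | .i , inj₂ (_ , t) | refl = ≋-trans (proj₂ (⟨⟩-injective s)) (≋-sym (proj₂ (⟨⟩-injective t)))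
    real-single α x y y' a b | i , inj₁ (o , _) | .i , inj₂ (¬o , _) | refl = ⊥-elim (¬o o)
    real-single α x y y' a b | i , inj₂ (¬o , _) | .i , inj₁ (o , _) | refl = ⊥-elim (¬o o)

    real∈2^ω : ∀ α → 2^ω (real α)
    real∈2^ω α = record
      { graph = λ z a → let i , p = real⁻ {α} (∊-in a) in
          [ (λ (_ , s) → num i , num 1 , ∊-out (num∊ω i) , ∊-out (bit∊2 true) , ≋-out s)
          , (λ (_ , s) → num i , num 0 , ∊-out (num∊ω i) , ∊-out (bit∊2 false) , ≋-out s) ]′ p
      ; total = λ x x∈ω → let i , r = ∊ω⁻ (∊-in x∈ω) in total i r
      ; unique = λ x y y' a b → ≋-out (real-single α x y y' (∊-in a) (∊-in b)) }
      where
      total : ∀ {x} i → x ≋ num i → Σ V λ y → ⟨ x , y ⟩ ∈ real α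
      total i r with dec (One α i)
      ... | yes o = num 1 , ∊-out (∊-respˡ (⟨⟩-cong (≋-sym r) ≋-refl) (real-one {α} o))
      ... | no ¬o = num 0 , ∊-out (∊-respˡ (⟨⟩-cong (≋-sym r) ≋-refl) (real-zero {α} ¬o))

-- Canonical names for numerals, pairs and the generic reals

module CanonicalNames (em : ExcludedMiddle (lsuc 0ℓ)) (M : V) (M-transitive : Transitive M) (zfc : ZFC M)
                      (κ : V) (κ∊M : κ ∊ M) (ℙ : V) (ℙ∊M : ℙ ∊ M) (poset : IsHechlerPoset κ ℙ)
                      (G : V) (gen : Generic M ℙ G) where

  open Classical em
  open Model em M M-transitive zfc
  open Constructions em M M-transitive zfc
  open Recursion em M M-transitive zfc
  open Hechler em M M-transitive zfc κ κ∊M ℙ ℙ∊M poset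
  open Extension em κ
  open Names ℙ G
  open Forcing em M M-transitive zfc ℙ Le G ℙ∊M Le∊M (generic-filter gen)
  open Reals em G

  opaque

    𝟙 : V
    𝟙 = Build.built em trivial

    𝟙∊ℙ : 𝟙 ∊ ℙ
    𝟙∊ℙ = built∊ℙ trivial

    𝟙∊G : 𝟙 ∊ G
    𝟙∊G = let c , c∊G = nonempty in upward c∊G 𝟙∊ℙ (Le⁺ (G⊆ℙ c∊G) 𝟙∊ℙ trivial-max)

  opaque

    upair pair : V → V → V
    upair σ τ = ⁅ ⟨ σ , 𝟙 ⟩ , ⟨ τ , 𝟙 ⟩ ⁆
    pair σ τ = upair (upair σ σ) (upair σ τ)

  𝟙ᶜ : ∀ {n} → Tm n
  𝟙ᶜ = con 𝟙 (M-trans ℙ∊M 𝟙∊ℙ)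

  upairᵗ pairᵗ : ∀ {n} → Tm n → Tm n → Tm n
  upairᵗ s t = ⁅ ⟨ s , 𝟙ᶜ ⟩ᵗ , ⟨ t , 𝟙ᶜ ⟩ᵗ ⁆ᵗ
  pairᵗ s t = upairᵗ (upairᵗ s s) (upairᵗ s t)

  -- The check names of the numerals. The step uses only unions and pairs with a fixed condition, so
  -- `recursion` places the whole sequence in `M`.
  ν : ℕ → V
  ν zero = ∅
  ν (suc n) = ν n ∪ ⁅ ⟨ ν n , 𝟙 ⟩ , ⟨ ν n , 𝟙 ⟩ ⁆

  opaque
    unfolding upair pair

    upair-cong : ∀ {σ σ' τ τ'} → σ ≋ σ' → τ ≋ τ' → upair σ τ ≋ upair σ' τ'
    upair-cong p q = ⁅⁆-cong (⟨⟩-cong p ≋-refl) (⟨⟩-cong q ≋-refl)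

    pair-cong : ∀ {σ σ' τ τ'} → σ ≋ σ' → τ ≋ τ' → pair σ τ ≋ pair σ' τ'
    pair-cong p q = upair-cong (upair-cong p p) (upair-cong p q)

    upair∊M : ∀ {σ τ} → σ ∊ M → τ ∊ M → upair σ τ ∊ M
    upair∊M p q = ⁅⁆∊M (⟨⟩∊M p (M-trans ℙ∊M 𝟙∊ℙ)) (⟨⟩∊M q (M-trans ℙ∊M 𝟙∊ℙ))

    pair∊M : ∀ {σ τ} → σ ∊ M → τ ∊ M → pair σ τ ∊ M
    pair∊M p q = upair∊M (upair∊M p p) (upair∊M p q)

    upair-name : ∀ {σ τ} → IsName ℙ σ → IsName ℙ τ → IsName ℙ (upair σ τ)
    upair-name {σ} {τ} a b = name-intro (upair σ τ) λ z z∊ →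
      [ (λ r → σ , 𝟙 , r , 𝟙∊ℙ , a) , (λ r → τ , 𝟙 , r , 𝟙∊ℙ , b) ]′ (∊⁅⁆⁻ z∊)

    upair-val : ∀ {σ τ} (n : IsName ℙ (upair σ τ)) (a : IsName ℙ σ) (b : IsName ℙ τ) → val G n ≋ ⁅ val G a , val G b ⁆
    upair-val n a b = ≋-ext
      (λ y y∊ → let ρ , c , p , _ , m , r = ∊val⁻ n y∊ in
        [ (λ s → ∊⁅⁆ˡ (≋-trans r (val-cong m a (proj₁ (⟨⟩-injective s)))))
        , (λ s → ∊⁅⁆ʳ (≋-trans r (val-cong m b (proj₁ (⟨⟩-injective s))))) ]′ (∊⁅⁆⁻ p))
      (λ y y∊ → [ (λ r → ∊-respˡ (≋-sym r) (∊val⁺ n a (∊⁅⁆ˡ ≋-refl) 𝟙∊G))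
                , (λ r → ∊-respˡ (≋-sym r) (∊val⁺ n b (∊⁅⁆ʳ ≋-refl) 𝟙∊G)) ]′ (∊⁅⁆⁻ y∊))

    pair-name : ∀ {σ τ} → IsName ℙ σ → IsName ℙ τ → IsName ℙ (pair σ τ)
    pair-name a b = upair-name (upair-name a a) (upair-name a b)

    pair-val : ∀ {σ τ} (n : IsName ℙ (pair σ τ)) (a : IsName ℙ σ) (b : IsName ℙ τ) → val G n ≋ ⟨ val G a , val G b ⟩
    pair-val n a b = ≋-trans (upair-val n (upair-name a a) (upair-name a b))
      (⁅⁆-cong (upair-val (upair-name a a) a a) (upair-val (upair-name a b) a b))

  opaque

    ν∊M : ∀ n → ν n ∊ M
    ν∊M zero = ∅∊M
    ν∊M (suc n) = let p = ⟨⟩∊M (ν∊M n) (M-trans ℙ∊M 𝟙∊ℙ) in ∪∊M (ν∊M n) (⁅⁆∊M p p)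

    ∊ν⁺ : ∀ {k n} → k <ⁿ n → ⟨ ν k , 𝟙 ⟩ ∊ ν n
    ∊ν⁺ {k} {suc n} (s≤s k≤n) with ℕₚ.m≤n⇒m<n∨m≡n k≤n
    ... | inj₁ k<n = ∊∪ˡ (∊ν⁺ k<n)
    ... | inj₂ refl = ∊∪ʳ (∊⁅⁆ˡ ≋-refl)

    ∊ν⁻ : ∀ n {z} → z ∊ ν n → Σ ℕ λ k → k <ⁿ n × z ≋ ⟨ ν k , 𝟙 ⟩
    ∊ν⁻ zero a = ⊥-elim (∅-empty a)
    ∊ν⁻ (suc n) a with ∊∪⁻ a
    ... | inj₁ b = let k , k<n , r = ∊ν⁻ n b in k , ℕₚ.m<n⇒m<1+n k<n , r
    ... | inj₂ b = n , ℕₚ.≤-refl , ∊⁅⁆₁ b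

    private
      ν-names : ∀ N n → n <ⁿ N → IsName ℙ (ν n)
      ν-names (suc N) n (s≤s n≤N) = name-intro (ν n) λ z z∊ → let k , k<n , r = ∊ν⁻ n z∊ in
        ν k , 𝟙 , r , 𝟙∊ℙ , ν-names N k (ℕₚ.<-≤-trans k<n n≤N)

      ν-vals : ∀ N n → n <ⁿ N → (m : IsName ℙ (ν n)) → val G m ≋ num n
      ν-vals (suc N) n (s≤s n≤N) m = ≋-ext
        (λ y y∊ → let ρ , c , p , _ , m' , r = ∊val⁻ m y∊
                      k , k<n , s = ∊ν⁻ n p
                      mk = ν-names (suc k) k ℕₚ.≤-refl
                  in ∊-respˡ (≋-sym (≋-trans r (≋-trans (val-cong m' mk (proj₁ (⟨⟩-injective s)))
                       (ν-vals N k (ℕₚ.<-≤-trans k<n n≤N) mk)))) (∊num k<n))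
        (λ y y∊ → let k , k<n , r = ∊num⁻ {n} y∊
                      mk = ν-names (suc k) k ℕₚ.≤-refl
                  in ∊-respˡ (≋-trans (ν-vals N k (ℕₚ.<-≤-trans k<n n≤N) mk) (≋-sym r)) (∊val⁺ m mk (∊ν⁺ k<n) 𝟙∊G))

    ν-name : ∀ n → IsName ℙ (ν n)
    ν-name n = ν-names (suc n) n ℕₚ.≤-refl

    ν-val : ∀ n (m : IsName ℙ (ν n)) → val G m ≋ num n
    ν-val n = ν-vals (suc n) n ℕₚ.≤-refl

    graph-ν∊M : graph ν ∊ M
    graph-ν∊M = recursion ν ν∊M (λ i j → var j ≈ᶠ var i ∪ᵗ ⁅ ⟨ var i , 𝟙ᶜ ⟩ᵗ , ⟨ var i , 𝟙ᶜ ⟩ᵗ ⁆ᵗ)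
        (λ e i j k p _ q → ≋-trans q (next p)) (λ e i j k p q → ≋-trans q (next (≋-sym p)))
      where
      next : ∀ {x y} → x ≋ y → x ∪ ⁅ ⟨ x , 𝟙 ⟩ , ⟨ x , 𝟙 ⟩ ⁆ ≋ y ∪ ⁅ ⟨ y , 𝟙 ⟩ , ⟨ y , 𝟙 ⟩ ⁆
      next p = Union-cong (⁅⁆-cong p (⁅⁆-cong (⟨⟩-cong p ≋-refl) (⟨⟩-cong p ≋-refl)))

  digit : Bool → ℕ
  digit b = if b then 1 else 0

  bit≋ : ∀ b → bit b ≋ num (digit b)
  bit≋ true = ≋-refl
  bit≋ false = ≋-refl

  opaque

    graph-single : ∀ {u i i' s s'} → i ≋ i' → ⟨ i , s ⟩ ∊ graph u → ⟨ i' , s' ⟩ ∊ graph u → s ≋ s'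
    graph-single i≋ a b with graph-index a
    ... | k , r = let i≋k , s≋ = ⟨⟩-injective r in
      ≋-trans s≋ (≋-sym (∊graph⁻ (∊-respˡ (⟨⟩-cong (≋-trans (≋-sym i≋) i≋k) ≋-refl) b)))

  opaque
    unfolding upair pair

    -- All canonical names of the reals at once: the fibre over `α` pairs the name of each bit of
    -- the `α`-th real with the conditions that decide it. A single set makes the names uniformly
    -- available to formulas.
    rows-set : Σ V λ W → W ∊ M ×
      (∀ {α z} → ⟨ α , z ⟩ ∊ W → Σ V λ c → Σ ℕ λ i → Σ Bool λ b → c ∊ ℙ × Bit c α i b × z ≋ ⟨ pair (ν i) (ν (digit b)) , c ⟩) ×
      (∀ {α c i b} → c ∊ ℙ → Bit c α i b → ⟨ α , ⟨ pair (ν i) (ν (digit b)) , c ⟩ ⟩ ∊ W)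
    rows-set
      with Bs , Bs∊M , Bs⁺ , Bs⁻ ← bit-set
      with W , W∊M , W⁻ , W⁺ ← replace Bs∊M
        (∃ᶠ∈ (con ℙ ℙ∊M) (∃ᶠ∈ (con κ κ∊M) (∃ᶠ (∃ᶠ (∃ᶠ (∃ᶠ (x₆ ≈ᶠ ⟨ ⟨ x₅ , x₄ ⟩ᵗ , ⟨ x₃ , x₂ ⟩ᵗ ⟩ᵗ ∧ᶠ
          ⟨ x₃ , x₁ ⟩ᵗ ∈ᶠ con (graph ν) graph-ν∊M ∧ᶠ ⟨ x₂ , x₀ ⟩ᵗ ∈ᶠ con (graph ν) graph-ν∊M ∧ᶠ
          x₇ ≈ᶠ ⟨ x₄ , ⟨ pairᵗ x₁ x₀ , x₅ ⟩ᵗ ⟩ᵗ)))))))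
        (λ x y y' _ _ _ (c , _ , γ , _ , i , _ , j , _ , s , _ , t , _ , r , a , b , e)
                        (c' , _ , γ' , _ , i' , _ , j' , _ , s' , _ , t' , _ , r' , a' , b' , e') →
          let u , v = ⟨⟩-injective (≋-trans (≋-sym r) r')
              c≋ , γ≋ = ⟨⟩-injective u
              i≋ , j≋ = ⟨⟩-injective v
              s≋ = graph-single i≋ a a'
              t≋ = graph-single j≋ b b'
          in ≋-trans e (≋-trans (⟨⟩-cong γ≋ (⟨⟩-cong (pair-cong s≋ t≋) c≋)) (≋-sym e')))
      = W , W∊M ,
        (λ {α} {z} a → let x , x∊ , c , c∊ℙ , γ , _ , i , _ , j , _ , s , _ , t , _ , r , p , q , e = W⁻ a
                           n , b , i≋ , j≋ , d = Bs⁻ (∊-respˡ r x∊)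
                           α≋ , z≋ = ⟨⟩-injective e
                           s≋ = ∊graph⁻ (∊-respˡ (⟨⟩-cong i≋ ≋-refl) p)
                           t≋ = ∊graph⁻ {n = digit b} (∊-respˡ (⟨⟩-cong (≋-trans j≋ (bit≋ b)) ≋-refl) q)
                       in c , n , b , c∊ℙ , Bit-resp ≋-refl (≋-sym α≋) d , ≋-trans z≋ (⟨⟩-cong (pair-cong s≋ t≋) ≋-refl)) ,
        λ {α} {c} {i} {b} c∊ℙ d →
          let α∊κ = View.Dom⊆κ (ℙ-view c∊ℙ) (Bit⇒Dom d)
          in W⁺ (Bs⁺ c∊ℙ d) (⟨⟩∊M (M-trans κ∊M α∊κ) (⟨⟩∊M (pair∊M (ν∊M i) (ν∊M (digit b))) (M-trans ℙ∊M c∊ℙ)))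
            (c , c∊ℙ , α , α∊κ , num i , num∊M i , bit b , ∊M-resp (bit≋ b) (num∊M (digit b)) , ν i , ν∊M i , ν (digit b) , ν∊M (digit b) ,
             ≋-refl , ∊graph i , ∊-respˡ (⟨⟩-cong (≋-sym (bit≋ b)) ≋-refl) (∊graph (digit b)) , ≋-refl)

  real-name-of : V → V
  real-name-of = fibre (proj₁ rows-set)

  opaque

    coherent : ∀ {c c' α i b b'} → c ∊ G → c' ∊ G → Bit c α i b → Bit c' α i b' → b ≡ b'
    coherent p q a b = let e , e∊G , x , y = directed p q
                       in View.Bit-unique (ℙ-view (G⊆ℙ e∊G)) (Extends.bits (proj₂ (proj₂ (Le⁻ x))) a) (Extends.bits (proj₂ (proj₂ (Le⁻ y))) b)

    real-bit : ∀ {c α i b} → c ∊ G → Bit c α i b → ⟨ num i , bit b ⟩ ∊ real α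
    real-bit {c} {α} {i} {true} c∊G a = real-one {α} (c , c∊G , a)
    real-bit {c} {α} {i} {false} c∊G a = real-zero {α} λ (c' , c'∊G , b) → absurd (coherent c∊G c'∊G a b)
      where
      absurd : ¬ (false ≡ true)
      absurd ()

    fill : ∀ {α c} → α ∊ κ → c ∊ ℙ → ∀ n → Σ V λ d → d ∊ ℙ × d ≼ c × (∀ i → i <ⁿ n → Σ Bool λ b → Bit d α i b)
    fill {α} {c} α∊κ c∊ℙ n = R.built , R∊ℙ , Le⁺ R∊ℙ c∊ℙ R.raises ,
        λ i i<n → R.total (R.new-dom (here ≋-refl)) (ℕₚ.<-≤-trans i<n (ℕₚ.m≤n+m n _))
      where
      module R = Raise (ℙ-view c∊ℙ) (α List.∷ List.[]) (∈ˡ-one α∊κ) α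
                       (View.height (ℙ-view c∊ℙ) +ⁿ n) (ℕₚ.m≤m+n _ _)
      R∊ℙ : R.built ∊ ℙ
      R∊ℙ = built∊ℙ R.blueprint

    -- One new column suffices: at the old height it gets a one in the row of `α` and a zero in that
    -- of `β`.
    distinguish : ∀ {α β c} → α ∊ κ → β ∊ κ → ¬ (α ≋ β) → c ∊ ℙ →
      Σ V λ d → d ∊ ℙ × d ≼ c × Σ ℕ λ i → Bit d α i true × Bit d β i false
    distinguish {α} {β} {c} α∊κ β∊κ α≉β c∊ℙ = R.built , R∊ℙ , Le⁺ R∊ℙ c∊ℙ R.raises , h ,
        R.marked (R.new-dom (here ≋-refl)) ℕₚ.≤-refl ℕₚ.≤-refl ,
        R.unmarked (R.new-dom (there (here ≋-refl))) (λ r → α≉β (≋-sym r)) ℕₚ.≤-refl ℕₚ.≤-refl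
      where
      h : ℕ
      h = View.height (ℙ-view c∊ℙ)
      module R = Raise (ℙ-view c∊ℙ) (α List.∷ β List.∷ List.[])
        (∈ˡ-two α∊κ β∊κ) α (suc h) (ℕₚ.n≤1+n _)
      R∊ℙ : R.built ∊ ℙ
      R∊ℙ = built∊ℙ R.blueprint

    decided : ∀ {α} → α ∊ κ → ∀ i → Σ V λ c → c ∊ G × Σ Bool λ b → Bit c α i b
    decided {α} α∊κ i
      with Bs , Bs∊M , Bs⁺ , Bs⁻ ← bit-set
      with c , c∊G , j , j∊2 , a ← generic (∃ᶠ∈ (con (num 2) (num∊M 2))
             (⟨ ⟨ x₁ , con α (M-trans κ∊M α∊κ) ⟩ᵗ , ⟨ con (num i) (num∊M i) , x₀ ⟩ᵗ ⟩ᵗ ∈ᶠ con Bs Bs∊M))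
             (λ c c∊ℙ → let d , d∊ℙ , d≼c , total = fill α∊κ c∊ℙ (suc i)
                            b , a = total i ℕₚ.≤-refl
                        in d , d∊ℙ , d≼c , bit b , bit∊2 b , Bs⁺ d∊ℙ a)
      with n , b , i≋ , _ , d ← Bs⁻ a
      = c , c∊G , b , subst (λ k → Bit c α k b) (sym (num-injective i≋)) d

    -- This lets the final injection be defined through the index of a real: equal reals have equal
    -- indices and so get equal values.
    real-injective : ∀ {α β} → α ∊ κ → β ∊ κ → real α ≋ real β → α ≋ β
    real-injective {α} {β} α∊κ β∊κ eq = stable₀ (α ≋ β) apart
      where
      apart : ¬ ¬ (α ≋ β)
      apart α≉β
        with Bs , Bs∊M , Bs⁺ , Bs⁻ ← bit-set
        with c , c∊G , i , i∊ω , a , b ← generic (∃ᶠ∈ (con ω ω∊M)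
               (⟨ ⟨ x₁ , con α (M-trans κ∊M α∊κ) ⟩ᵗ , ⟨ x₀ , con (num 1) (num∊M 1) ⟩ᵗ ⟩ᵗ ∈ᶠ con Bs Bs∊M ∧ᶠ
                ⟨ ⟨ x₁ , con β (M-trans κ∊M β∊κ) ⟩ᵗ , ⟨ x₀ , con (num 0) (num∊M 0) ⟩ᵗ ⟩ᵗ ∈ᶠ con Bs Bs∊M))
               (λ c c∊ℙ → let d , d∊ℙ , d≼c , i , a , b = distinguish α∊κ β∊κ α≉β c∊ℙ
                          in d , d∊ℙ , d≼c , num i , num∊ω i , Bs⁺ d∊ℙ a , Bs⁺ d∊ℙ b)
        with n , v , i≋ , v≋ , d ← Bs⁻ a
        with n' , v' , i≋' , v'≋ , d' ← Bs⁻ b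
        with num-injective {1} {0} (real-single β i (num 1) (num 0)
               (∊-resp (⟨⟩-cong (≋-sym i≋) (≋-sym v≋)) eq (real-bit c∊G d))
               (∊-respˡ (⟨⟩-cong (≋-sym i≋') (≋-sym v'≋)) (real-bit c∊G d')))
      ... | ()

    real-name : ∀ α → IsName ℙ (real-name-of α)
    real-name α = name-intro _ λ z z∊ →
      let c , i , b , c∊ℙ , _ , r = proj₁ (proj₂ (proj₂ rows-set)) (∊fibre⁻ z∊)
      in pair (ν i) (ν (digit b)) , c , r , c∊ℙ , pair-name (ν-name i) (ν-name (digit b))

    real-val : ∀ {α} → α ∊ κ → (n : IsName ℙ (real-name-of α)) → val G n ≋ real α
    real-val {α} α∊κ n = ≋-ext
      (λ y y∊ → let ρ , c , p , c∊G , m , r = ∊val⁻ n y∊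
                    c' , i , b , c'∊ℙ , a , s = proj₁ (proj₂ (proj₂ rows-set)) (∊fibre⁻ p)
                    ρ≋ , c≋ = ⟨⟩-injective s
                in ∊-respˡ (≋-sym (≋-trans r (≋-trans (val-cong m (pn i b) ρ≋) (pv i b)))) (real-bit (∊-respˡ c≋ c∊G) a))
      (λ y y∊ → let i , p = real⁻ {α} y∊ in [ (λ ((c , c∊G , a) , r) → member c∊G a r) , (λ (¬o , r) → zero-case i ¬o r) ]′ p)
      where
      pn : ∀ i b → IsName ℙ (pair (ν i) (ν (digit b)))
      pn i b = pair-name (ν-name i) (ν-name (digit b))
      pv : ∀ i b → val G (pn i b) ≋ ⟨ num i , bit b ⟩
      pv i b = ≋-trans (pair-val (pn i b) (ν-name i) (ν-name (digit b)))
        (⟨⟩-cong (ν-val i _) (≋-trans (ν-val (digit b) _) (≋-sym (bit≋ b))))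
      member : ∀ {c i b y} → c ∊ G → Bit c α i b → y ≋ ⟨ num i , bit b ⟩ → y ∊ val G n
      member {c} {i} {b} c∊G a r = ∊-respˡ (≋-trans (pv i b) (≋-sym r))
        (∊val⁺ n (pn i b) (∊fibre⁺ (proj₂ (proj₂ (proj₂ rows-set)) (G⊆ℙ c∊G) a)) c∊G)
      zero-case : ∀ i {y} → ¬ One α i → y ≋ ⟨ num i , num 0 ⟩ → y ∊ val G n
      -- A zero of the real means that no condition in `G` has a one there, whereas the name records
      -- only explicit bits; genericity supplies a condition that has the zero explicitly.
      zero-case i ¬o r with decided α∊κ i
      ... | c , c∊G , true , a = ⊥-elim (¬o (c , c∊G , a))
      ... | c , c∊G , false , a = member c∊G a r


-- Concentration

module Concentration (em : ExcludedMiddle (lsuc 0ℓ)) (M : V) (M-transitive : Transitive M) (zfc : ZFC M)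
                     (κ : V) (κ∊M : κ ∊ M) (ω⊆κ : ∀ n → num n ∊ κ)
                     (ℙ : V) (ℙ∊M : ℙ ∊ M) (poset : IsHechlerPoset κ ℙ) (G : V) (gen : Generic M ℙ G)
                     (U : V) (U-open : OpenIn (extension M ℙ G) U) (Q⊆U : family G ω ⊆ U)
                     (τ : V) (τ∊M : τ ∊ M) (τ-name : IsName ℙ τ) (U≋ : U ≋ val G τ-name) where

  open Classical em
  open Model em M M-transitive zfc
  open Constructions em M M-transitive zfc
  open Recursion em M M-transitive zfc
  open Smallness em M M-transitive zfc κ κ∊M
  open Hechler em M M-transitive zfc κ κ∊M ℙ ℙ∊M poset hiding (ω⊆κ)
  open Names ℙ G
  open Forcing em M M-transitive zfc ℙ Le G ℙ∊M Le∊M (generic-filter gen)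
  open Reals em G
  open CanonicalNames em M M-transitive zfc κ κ∊M ℙ ℙ∊M poset G gen
  open Heart em M M-transitive zfc κ κ∊M ℙ ℙ∊M poset ω⊆κ using (Good; bad-small)

  names : V
  names = fibres (proj₁ rows-set) κ

  opaque

    names∊M : names ∊ M
    names∊M = fibres∊M (proj₁ (proj₂ rows-set)) κ∊M

    -- Equality is forced between names from one transitive set. It has to contain `τ`, hence all
    -- names inside `τ`, and the names of all reals, which lie in `names`.
    hull : Σ V λ T → T ∊ M × (∀ {x y} → y ∊ T → x ∊ y → x ∊ T) × (∀ {x} → x ∊ ⁅ τ , names ⁆ → x ∊ T)
    hull = transitive-closure (⁅⁆∊M τ∊M names∊M)

  open Equality (proj₁ hull) (proj₁ (proj₂ hull)) (proj₁ (proj₂ (proj₂ hull)))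

  -- c forces that the real of α is not in U.
  Avoids : V → V → Set₁
  Avoids c α = ∀ {σ d e} → ⟨ σ , d ⟩ ∊ τ → d ∊ ℙ → e ∊ ℙ → e ≼ c → e ≼ d → ¬ (e ⊩ real-name-of α ≐ σ)

  opaque

    τ∊T : τ ∊ proj₁ hull
    τ∊T = proj₂ (proj₂ (proj₂ hull)) (∊⁅⁆ˡ ≋-refl)

    real-name∊T : ∀ {α} → α ∊ κ → real-name-of α ∊ proj₁ hull
    real-name∊T α∊κ = T-trans (T-trans (T-trans (proj₂ (proj₂ (proj₂ hull)) (∊⁅⁆ʳ ≋-refl)) (∊fibres⁺ α∊κ)) (∊⁅⁆ʳ ≋-refl)) (∊⁅⁆ʳ ≋-refl)
      where
      T-trans : ∀ {x y} → y ∊ proj₁ hull → x ∊ y → x ∊ proj₁ hull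
      T-trans = proj₁ (proj₂ (proj₂ hull))

    real-name∊M : ∀ {α} → α ∊ κ → real-name-of α ∊ M
    real-name∊M α∊κ = M-trans (proj₁ (proj₂ hull)) (real-name∊T α∊κ)

    real∊extension : ∀ {α} → α ∊ κ → real α ∊ extension M ℙ G
    real∊extension {α} α∊κ = ∊-respˡ (real-val α∊κ (real-name α)) (∊extension⁺ (real-name∊M α∊κ) (real-name α))

    -- `real-name-of` is no term of the formula language; the formula reaches its value through the
    -- set `names`.
    bad-set : Σ V λ B → B ∊ M × (∀ {c α} → ⟨ c , α ⟩ ∊ B → c ∊ ℙ × α ∊ κ × Avoids c α) ×
      (∀ {c α} → c ∊ ℙ → α ∊ κ → Avoids c α → ⟨ c , α ⟩ ∊ B)
    bad-set with B , B∊M , B⁻ , B⁺ ← separate (⊗∊M ℙ∊M κ∊M) (∃ᶠ∈ ℙᶜ (∃ᶠ∈ (con κ κ∊M) (x₂ ≈ᶠ ⟨ x₁ , x₀ ⟩ᵗ ∧ᶠ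
        ∀ᶠ∈ Tᶜ (∀ᶠ∈ ℙᶜ (⟨ x₁ , x₀ ⟩ᵗ ∈ᶠ con τ τ∊M ⇒ᶠ ∀ᶠ∈ ℙᶜ (x₀ ≼ᶠ x₄ ⇒ᶠ x₀ ≼ᶠ x₁ ⇒ᶠ
          ∀ᶠ∈ Tᶜ (⟨ x₄ , x₀ ⟩ᵗ ∈ᶠ con names names∊M ⇒ᶠ ¬ᶠ (⟨ x₁ , ⟨ x₀ , x₃ ⟩ᵗ ⟩ᵗ ∈ᶠ con Eq Eq∊M))))))))
      = B , B∊M ,
        (λ {c} {α} a → let _ , c' , c'∊ℙ , α' , α'∊κ , r , av = B⁻ a
                           c≋ , α≋ = ⟨⟩-injective r
                       in ∊-respˡ (≋-sym c≋) c'∊ℙ , ∊-respˡ (≋-sym α≋) α'∊κ ,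
                          λ {σ} {d} {e} p d∊ℙ e∊ℙ e≼c e≼d q → av σ (subname τ∊T p) d d∊ℙ p e e∊ℙ
                            (∊-respˡ (⟨⟩-cong ≋-refl c≋) e≼c) e≼d (real-name-of α') (real-name∊T α'∊κ) (∊fibres⁺ α'∊κ)
                            (∊-respˡ (⟨⟩-cong ≋-refl (⟨⟩-cong (fibre-cong ≋-refl α≋) ≋-refl)) q)) ,
        λ {c} {α} c∊ℙ α∊κ av → B⁺ (∊⊗⁺ c∊ℙ α∊κ) (c , c∊ℙ , α , α∊κ , ≋-refl ,
          λ σ _ d d∊ℙ p e e∊ℙ e≼c e≼d x _ x∊ q → av p d∊ℙ e∊ℙ e≼c e≼d
            (∊-respˡ (⟨⟩-cong ≋-refl (⟨⟩-cong (proj₂ (∊fibres⁻ x∊)) ≋-refl)) q))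

  B : V
  B = proj₁ bad-set

  opaque

    B∊M : B ∊ M
    B∊M = proj₁ (proj₂ bad-set)

    B⊆ : ∀ {c α} → ⟨ c , α ⟩ ∊ B → c ∊ ℙ × α ∊ κ
    B⊆ a = let p , q , _ = proj₁ (proj₂ (proj₂ bad-set)) a in p , q

    B-avoids : ∀ {c α} → ⟨ c , α ⟩ ∊ B → Avoids c α
    B-avoids a = proj₂ (proj₂ (proj₁ (proj₂ (proj₂ bad-set)) a))

    B-intro : ∀ {c α} → c ∊ ℙ → α ∊ κ → Avoids c α → ⟨ c , α ⟩ ∊ B
    B-intro = proj₂ (proj₂ (proj₂ bad-set))

    B-open : ∀ {c e α} → ⟨ c , α ⟩ ∊ B → e ≼ c → ⟨ e , α ⟩ ∊ B
    B-open a e≼c = B-intro (proj₁ (Le⁻ e≼c)) (proj₂ (B⊆ a)) λ p d∊ℙ x∊ℙ x≼e → B-avoids a p d∊ℙ x∊ℙ (≼-trans x≼e e≼c)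

    -- If the real were in U, it would be the value of some name in `τ`, and this equality would be
    -- forced by a condition in `G`; a common extension with `c` contradicts `Avoids`.
    B-sound : ∀ {c α} → c ∊ G → ⟨ c , α ⟩ ∊ B → ¬ (real α ∊ U)
    B-sound {c} {α} c∊G a u
      with _ , α∊κ ← B⊆ a
      with σ , d , p , d∊G , m , r ← ∊val⁻ τ-name (∊-respʳ U≋ u)
      with e , e∊G , q ← ⊩-complete (real-name-of α) (real-name α) m (real-name∊T α∊κ) (subname τ∊T p)
             (≋-trans (real-val α∊κ (real-name α)) r)
      with x , x∊G , x≼c , x≼d ← directed c∊G d∊G
      with y , y∊G , y≼x , y≼e ← directed x∊G e∊G
      = B-avoids a p (G⊆ℙ d∊G) (G⊆ℙ y∊G) (≼-trans y≼x x≼c) (≼-trans y≼x x≼d) (⊩-resp (G⊆ℙ y∊G) y≼e q)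

    -- The conditions that avoid U at `α`, or force the name of the real to equal an element of `τ`
    -- already present, are dense. One of the second kind in `G` would put the real into U.
    B-complete : ∀ {α} → α ∊ κ → ¬ (real α ∊ U) → Σ V λ c → c ∊ G × ⟨ c , α ⟩ ∊ B
    B-complete {α} α∊κ α∉U = conclude (generic (⟨ x₀ , con α (M-trans κ∊M α∊κ) ⟩ᵗ ∈ᶠ con B B∊M ∨ᶠ
        ∃ᶠ∈ Tᶜ (∃ᶠ∈ ℙᶜ (⟨ x₁ , x₀ ⟩ᵗ ∈ᶠ con τ τ∊M ∧ᶠ x₂ ≼ᶠ x₀ ∧ᶠ
          ⟨ x₂ , ⟨ con (real-name-of α) (real-name∊M α∊κ) , x₁ ⟩ᵗ ⟩ᵗ ∈ᶠ con Eq Eq∊M))) dense)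
      where
      Equal : V → Set₁
      Equal c = Σ V λ σ → σ ∊ proj₁ hull × Σ V λ d → d ∊ ℙ × ⟨ σ , d ⟩ ∊ τ × c ≼ d × c ⊩ real-name-of α ≐ σ
      dense : ∀ c → c ∊ ℙ → Σ V λ d → d ∊ ℙ × d ≼ c × (⟨ d , α ⟩ ∊ B ⊎ Equal d)
      dense c c∊ℙ with dec (Σ V λ e → e ∊ ℙ × e ≼ c × Equal e)
      ... | yes (e , e∊ℙ , e≼c , p) = e , e∊ℙ , e≼c , inj₂ p
      ... | no ¬p = c , c∊ℙ , ≼-refl c∊ℙ , inj₁ (B-intro c∊ℙ α∊κ λ {σ} {d} {e} p d∊ℙ e∊ℙ e≼c e≼d q →
              ¬p (e , e∊ℙ , e≼c , σ , subname τ∊T p , d , d∊ℙ , p , e≼d , q))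
      conclude : (Σ V λ c → c ∊ G × (⟨ c , α ⟩ ∊ B ⊎ Equal c)) → Σ V λ c → c ∊ G × ⟨ c , α ⟩ ∊ B
      conclude (c , c∊G , inj₁ p) = c , c∊G , p
      conclude (c , c∊G , inj₂ (σ , _ , d , d∊ℙ , p , c≼d , q)) =
        let m = proj₂ (name-elim τ-name p) in
        ⊥-elim (α∉U (∊-resp (≋-trans (≋-sym (⊩-sound (real-name-of α) (real-name α) m c∊G q)) (real-val α∊κ (real-name α)))
          (≋-sym U≋) (∊val⁺ τ-name m p (upward c∊G d∊ℙ c≼d))))

  GoodB : V → V → Set₁
  GoodB = Good B∊M B⊆ B-open

  opaque

    GoodB-open : ∀ {e c m} → e ≼ c → GoodB c m → GoodB e m
    GoodB-open e≼c g α x α∊κ x∊ℙ x≼e bits = g α x α∊κ x∊ℙ (≼-trans x≼e e≼c) λ b → bits (Extends.bits (proj₂ (proj₂ (Le⁻ e≼c))) b)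

    good-set : Σ V λ D → D ∊ M × (∀ {e m} → e ∊ ℙ → GoodB e (num m) → ⟨ e , num m ⟩ ∊ D) ×
      (∀ {e m} → ⟨ e , num m ⟩ ∊ D → GoodB e (num m))
    good-set
      with Bs , Bs∊M , Bs⁺ , Bs⁻ ← bit-set
      with D , D∊M , D⁻ , D⁺ ← separate (⊗∊M ℙ∊M ω∊M) (∃ᶠ∈ ℙᶜ (∃ᶠ∈ (con ω ω∊M) (x₂ ≈ᶠ ⟨ x₁ , x₀ ⟩ᵗ ∧ᶠ
        ∀ᶠ∈ (con κ κ∊M) (∀ᶠ∈ ℙᶜ (x₀ ≼ᶠ x₃ ⇒ᶠ
          ∀ᶠ∈ (con ω ω∊M) (∀ᶠ∈ (con (num 2) (num∊M 2)) (⟨ ⟨ x₅ , x₄ ⟩ᵗ , ⟨ x₁ , x₀ ⟩ᵗ ⟩ᵗ ∈ᶠ con Bs Bs∊M ⇒ᶠ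
            ⟨ ⟨ x₂ , x₃ ⟩ᵗ , ⟨ x₁ , x₀ ⟩ᵗ ⟩ᵗ ∈ᶠ con Bs Bs∊M)) ⇒ᶠ
          ¬ᶠ (⟨ x₀ , x₁ ⟩ᵗ ∈ᶠ con B B∊M))))))
      = D , D∊M ,
        (λ {e} {m} e∊ℙ g → D⁺ (∊⊗⁺ e∊ℙ (num∊ω m)) (e , e∊ℙ , num m , num∊ω m , ≋-refl , λ α α∊κ x x∊ℙ x≼e bits →
          g α x α∊κ x∊ℙ x≼e λ {i} {b} a → bit-back Bs⁻ (bits (num i) (num∊ω i) (bit b) (bit∊2 b) (Bs⁺ e∊ℙ a)))) ,
        λ {e} {m} a α x α∊κ x∊ℙ x≼e bits →
          let _ , e' , e'∊ℙ , m' , _ , r , g = D⁻ a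
              e≋ , m≋ = ⟨⟩-injective r
          in g α α∊κ x x∊ℙ (∊-respˡ (⟨⟩-cong ≋-refl e≋) x≼e) λ i i∊ω j j∊2 p →
               let n , b , i≋ , j≋ , d = Bs⁻ p
               in ∊-respˡ (⟨⟩-cong ≋-refl (⟨⟩-cong (≋-sym i≋) (≋-sym j≋))) (Bs⁺ x∊ℙ (bits (Bit-resp (≋-sym e≋) (≋-sym m≋) d)))
      where
      bit-back : ∀ {Bs c γ i b} → (∀ {c γ i j} → ⟨ ⟨ c , γ ⟩ , ⟨ i , j ⟩ ⟩ ∊ Bs → Σ ℕ λ n → Σ Bool λ b → i ≋ num n × j ≋ bit b × Bit c γ n b) →
        ⟨ ⟨ c , γ ⟩ , ⟨ num i , bit b ⟩ ⟩ ∊ Bs → Bit c γ i b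
      bit-back Bs⁻ a with Bs⁻ a
      ... | n , b , i≋ , j≋ , d with num-injective i≋ | bit-injective j≋
      ...   | refl | refl = d

  opaque
    unfolding real

    Q∊U : ∀ k → real (num k) ∊ U
    Q∊U k = ∊-in (Q⊆U k)

  opaque

    -- A failure of goodness at `d` is itself a condition `e ≼ d`, bad for some `α` whose row
    -- continues `d(k)`.
    dense : ∀ {k d} → d ∊ ℙ → Σ V λ e → e ∊ ℙ × e ≼ d × (GoodB e (num k) ⊎
      Σ V λ α → α ∊ κ × ⟨ e , α ⟩ ∊ B × (∀ {i b} → Bit d (num k) i b → Bit e α i b))
    dense {k} {d} d∊ℙ with dec (Σ V λ α → Σ V λ e → α ∊ κ × e ∊ ℙ × e ≼ d × (∀ {i b} → Bit d (num k) i b → Bit e α i b) × ⟨ e , α ⟩ ∊ B)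
    ... | yes (α , e , α∊κ , e∊ℙ , e≼d , copy , a) = e , e∊ℙ , e≼d , inj₂ (α , α∊κ , a , copy)
    ... | no none = d , d∊ℙ , ≼-refl d∊ℙ , inj₁ λ α e α∊κ e∊ℙ e≼d copy a → none (α , e , α∊κ , e∊ℙ , e≼d , copy , a)

    dense₀ : ∀ D {c} → c ∊ ℙ → Σ V λ d → d ∊ ℙ × d ≼ c ×
      ((∀ m → m ∊ ω → ∀ e → e ∊ ℙ → e ≼ d → Σ V λ e' → e' ∊ ℙ × e' ≼ e × ⟨ e' , m ⟩ ∊ D) ⊎
       (Σ V λ m → m ∊ ω × (∀ e → e ∊ ℙ → e ≼ d → ¬ (⟨ e , m ⟩ ∊ D))))
    dense₀ D {c} c∊ℙ with dec (Σ V λ m → m ∊ ω × Σ V λ e → e ∊ ℙ × e ≼ c × (∀ e' → e' ∊ ℙ → e' ≼ e → ¬ (⟨ e' , m ⟩ ∊ D)))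
    ... | yes (m , m∊ω , e , e∊ℙ , e≼c , p) = e , e∊ℙ , e≼c , inj₂ (m , m∊ω , p)
    ... | no none = c , c∊ℙ , ≼-refl c∊ℙ , inj₁ λ m m∊ω e e∊ℙ e≼c → stable _ λ ¬e' →
          none (m , m∊ω , e , e∊ℙ , e≼c , λ e' e'∊ℙ e'≼e a → ¬e' (e' , e'∊ℙ , e'≼e , a))

    -- U is a neighbourhood of the k-th real, so some condition in G decides enough of it.
    good-in-G : ∀ k → Σ V λ c → c ∊ G × GoodB c (num k)
    good-in-G k
      with n₀ , n₀∈ω , near ← OpenIn.open′ U-open (real (num k)) (∊-out (Q∊U k))
      with n , n₀≋n ← ∊ω⁻ (∊-in n₀∈ω)
      with Bs , Bs∊M , Bs⁺ , Bs⁻ ← bit-set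
      with Gd , Gd∊M , Gd⁺ , Gd⁻ ← good-set
      with generic (⟨ x₀ , con (num k) (num∊M k) ⟩ᵗ ∈ᶠ con Gd Gd∊M ∨ᶠ
             ∃ᶠ∈ (con κ κ∊M) (⟨ x₁ , x₀ ⟩ᵗ ∈ᶠ con B B∊M ∧ᶠ ∀ᶠ∈ (con (num n) (num∊M n)) (∃ᶠ∈ (con (num 2) (num∊M 2))
               (⟨ ⟨ x₃ , con (num k) (num∊M k) ⟩ᵗ , ⟨ x₁ , x₀ ⟩ᵗ ⟩ᵗ ∈ᶠ con Bs Bs∊M ∧ᶠ
                ⟨ ⟨ x₃ , x₂ ⟩ᵗ , ⟨ x₁ , x₀ ⟩ᵗ ⟩ᵗ ∈ᶠ con Bs Bs∊M))))
             -- `n` is the length of an initial segment of the `k`-th real that guarantees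
             -- membership in U. With the row filled that far, a row that continues it belongs to a
             -- real in the neighbourhood.
             (λ c c∊ℙ → let d , d∊ℙ , d≼c , total = fill (ω⊆κ k) c∊ℙ n
                            e , e∊ℙ , e≼d , p = dense {k} {d} d∊ℙ
                        in e , e∊ℙ , ≼-trans e≼d d≼c ,
                           [ (λ g → inj₁ (Gd⁺ e∊ℙ g))
                           , (λ (α , α∊κ , a , copy) → inj₂ (α , α∊κ , a , λ i i∊n →
                               let j , j<n , i≋j = ∊num⁻ {n} i∊n
                                   b , x = total j j<n
                               in bit b , bit∊2 b ,
                                  ∊-respˡ (⟨⟩-cong ≋-refl (⟨⟩-cong (≋-sym i≋j) ≋-refl)) (Bs⁺ e∊ℙ (Extends.bits (proj₂ (proj₂ (Le⁻ e≼d))) x)) ,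
                                  ∊-respˡ (⟨⟩-cong ≋-refl (⟨⟩-cong (≋-sym i≋j) ≋-refl)) (Bs⁺ e∊ℙ (copy x)))) ]′ p)
    ... | c , c∊G , inj₁ g = c , c∊G , Gd⁻ g
    ... | c , c∊G , inj₂ (α , α∊κ , a , agree) = ⊥-elim (B-sound c∊G a
          (∊-in (near (real α) (∊-out (real∊extension α∊κ)) (real∈2^ω α) λ i i∈n₀ → ≋-out
            (let j , _ , x , y = agree i (∊-respʳ n₀≋n (∊-in i∈n₀))
                 u , b , i≋ , j≋ , d = Bs⁻ x
                 u' , b' , i≋' , j≋' , d' = Bs⁻ y
             in ≋-trans (′-value {real (num k)} (real-single (num k)) (∊-respˡ (⟨⟩-cong (≋-sym i≋) (≋-sym j≋)) (real-bit c∊G d)))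
                  (≋-sym (′-value {real α} (real-single α) (∊-respˡ (⟨⟩-cong (≋-sym i≋') (≋-sym j≋')) (real-bit c∊G d'))))))))

    -- Otherwise some condition in `G` would have no good extension for a certain `m`, although `G`
    -- contains a good condition for that `m`; directedness gives a contradiction.
    c₀-exists : Σ V λ c → c ∊ G × (∀ m e → e ∊ ℙ → e ≼ c → Σ V λ e' → e' ∊ ℙ × e' ≼ e × GoodB e' (num m))
    c₀-exists
      with Gd , Gd∊M , Gd⁺ , Gd⁻ ← good-set
      with generic (∀ᶠ∈ (con ω ω∊M) (∀ᶠ∈ ℙᶜ (x₀ ≼ᶠ x₂ ⇒ᶠ ∃ᶠ∈ ℙᶜ (x₀ ≼ᶠ x₁ ∧ᶠ ⟨ x₀ , x₂ ⟩ᵗ ∈ᶠ con Gd Gd∊M))) ∨ᶠ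
                    ∃ᶠ∈ (con ω ω∊M) (∀ᶠ∈ ℙᶜ (x₀ ≼ᶠ x₂ ⇒ᶠ ¬ᶠ (⟨ x₀ , x₁ ⟩ᵗ ∈ᶠ con Gd Gd∊M))))
             (λ c c∊ℙ → dense₀ Gd c∊ℙ)
    ... | c , c∊G , inj₁ p = c , c∊G , λ m e e∊ℙ e≼c → let e' , e'∊ℙ , e'≼e , g = p (num m) (num∊ω m) e e∊ℙ e≼c in e' , e'∊ℙ , e'≼e , Gd⁻ g
    ... | c , c∊G , inj₂ (m , m∊ω , p) =
          let k , m≋k = ∊ω⁻ m∊ω
              d , d∊G , g = good-in-G k
              e , e∊G , e≼c , e≼d = directed c∊G d∊G
          in ⊥-elim (p e (G⊆ℙ e∊G) e≼c (∊-respˡ (⟨⟩-cong ≋-refl (≋-sym m≋k)) (Gd⁺ (G⊆ℙ e∊G) (GoodB-open e≼d g))))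

    bad-indices : Small (λ α → Lift (lsuc 0ℓ) (¬ (real α ∊ U)))
    bad-indices with c₀ , c₀∊G , good ← c₀-exists =
      Small-⊆ (λ α α∊κ (lift α∉U) → let c , c∊G , a = B-complete α∊κ α∉U
                                        e , e∊G , e≼c , e≼c₀ = directed c∊G c₀∊G
                                    in e , G⊆ℙ e∊G , e≼c₀ , B-open a e≼c)
        (bad-small B∊M B⊆ B-open (G⊆ℙ c₀∊G) good)

  -- The injection and its name

  opaque

    least : (P : ℕ → Set) → ∀ n → P n → Σ ℕ λ m → P m × (∀ k → k <ⁿ m → ¬ P k)
    least P n p with search (suc n)
      where
      search : ∀ n → (Σ ℕ λ m → P m × (∀ k → k <ⁿ m → ¬ P k)) ⊎ (∀ k → k <ⁿ n → ¬ P k)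
      search zero = inj₂ λ k ()
      search (suc n) with search n
      ... | inj₁ found = inj₁ found
      ... | inj₂ none with dec₀ (P n)
      ...   | yes p = inj₁ (n , p , none)
      ...   | no ¬p = inj₂ λ { k (s≤s k≤n) q → [ (λ k<n → none k k<n q) , (λ { refl → ¬p q }) ]′ (ℕₚ.m≤n⇒m<n∨m≡n k≤n) }
    ... | inj₁ found = found
    ... | inj₂ none = ⊥-elim (none n ℕₚ.≤-refl p)

  opaque
    unfolding real

    outside⁻ : ∀ {x} → x ∊ family G κ ∖ U → Σ V λ α → α ∊ κ × ¬ (real α ∊ U) × x ≋ real α
    outside⁻ (∊-in ((i , ∉U) , r)) = el κ i , el∊ κ i , (λ u → ∉U (∊-out u)) , ≋-in r

    outside⁺ : ∀ {x α} → α ∊ κ → ¬ (real α ∊ U) → x ≋ real α → x ∊ family G κ ∖ U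
    outside⁺ α∊κ α∉U r = let i , s = index α∊κ in
      ∊-index {y = family G κ ∖ U} (i , λ u → α∉U (∊-respˡ (real-cong (≋-sym s)) (∊-in u))) (≋-trans r (real-cong s))

  -- The enumeration `h` may list an index repeatedly; its first position makes the assignment of
  -- numbers single-valued.
  Least : V → V → ℕ → Set
  Least h α l = ⟨ num l , α ⟩ ∊ h × (∀ k → k <ⁿ l → ¬ (⟨ num k , α ⟩ ∊ h))

  opaque

    Least-unique : ∀ {h α l l'} → Least h α l → Least h α l' → l ≡ l'
    Least-unique {l = l} {l'} (p , q) (p' , q') with ℕₚ.<-cmp l l'
    ... | tri< l<l' _ _ = ⊥-elim (q' l l<l' p)
    ... | tri≈ _ l≡l' _ = l≡l'
    ... | tri> _ _ l'<l = ⊥-elim (q l' l'<l p')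

  opaque
    unfolding upair pair

    -- Each entry carries a condition bad for `α`. By `B-sound` and `B-complete` it survives in the
    -- value exactly when the real is outside U, although `M` cannot tell which reals those are.
    enumeration-name : ∀ {h} → h ∊ M → Σ V λ f → f ∊ M ×
      (∀ {z} → z ∊ f → Σ V λ c → Σ V λ α → Σ ℕ λ l → ⟨ c , α ⟩ ∊ B × Least h α l × z ≋ ⟨ pair (real-name-of α) (ν l) , c ⟩) ×
      (∀ {c α l} → ⟨ c , α ⟩ ∊ B → Least h α l → ⟨ pair (real-name-of α) (ν l) , c ⟩ ∊ f)
    enumeration-name {h} h∊M
      with f , f∊M , f⁻ , f⁺ ← replace (⊗∊M B∊M ω∊M)
        (∃ᶠ∈ ℙᶜ (∃ᶠ∈ (con κ κ∊M) (∃ᶠ∈ (con ω ω∊M) (∃ᶠ (∃ᶠ (x₅ ≈ᶠ ⟨ ⟨ x₄ , x₃ ⟩ᵗ , x₂ ⟩ᵗ ∧ᶠ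
          ⟨ x₃ , x₁ ⟩ᵗ ∈ᶠ con names names∊M ∧ᶠ ⟨ x₂ , x₀ ⟩ᵗ ∈ᶠ con (graph ν) graph-ν∊M ∧ᶠ
          ⟨ x₂ , x₃ ⟩ᵗ ∈ᶠ con h h∊M ∧ᶠ ∀ᶠ∈ x₂ (¬ᶠ (⟨ x₀ , x₄ ⟩ᵗ ∈ᶠ con h h∊M)) ∧ᶠ
          x₆ ≈ᶠ ⟨ pairᵗ x₁ x₀ , x₄ ⟩ᵗ))))))
        (λ x y y' _ _ _ (c , _ , α , _ , l , _ , s , _ , t , _ , r , a , b , _ , _ , e)
                        (c' , _ , α' , _ , l' , _ , s' , _ , t' , _ , r' , a' , b' , _ , _ , e') →
          let u , l≋ = ⟨⟩-injective (≋-trans (≋-sym r) r')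
              c≋ , α≋ = ⟨⟩-injective u
              s≋ = ≋-trans (proj₂ (∊fibres⁻ a)) (≋-trans (fibre-cong ≋-refl α≋) (≋-sym (proj₂ (∊fibres⁻ a'))))
          in ≋-trans e (≋-trans (⟨⟩-cong (pair-cong s≋ (graph-single l≋ b b')) c≋) (≋-sym e')))
      = f , f∊M ,
        (λ z∊f → let x , x∊ , c , _ , α , α∊κ , l , l∊ω , s , _ , t , _ , r , a , b , d , small , e = f⁻ z∊f
                     n , l≋n = ∊ω⁻ l∊ω
                 in c , α , n , ∊⊗⁻ˡ (∊-respˡ r x∊) ,
                    (∊-respˡ (⟨⟩-cong l≋n ≋-refl) d , λ k k<n → small (num k) (∊-respʳ (≋-sym l≋n) (∊num k<n))) ,
                    ≋-trans e (⟨⟩-cong (pair-cong (proj₂ (∊fibres⁻ a)) (∊graph⁻ (∊-respˡ (⟨⟩-cong l≋n ≋-refl) b))) ≋-refl)) ,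
        λ {c} {α} {l} a (p , q) → let c∊ℙ , α∊κ = B⊆ a in
          f⁺ (∊⊗⁺ a (num∊ω l)) (⟨⟩∊M (pair∊M (real-name∊M α∊κ) (ν∊M l)) (M-trans ℙ∊M c∊ℙ))
            (c , c∊ℙ , α , α∊κ , num l , num∊ω l , real-name-of α , real-name∊M α∊κ , ν l , ν∊M l , ≋-refl ,
             ∊fibres⁺ α∊κ , ∊graph l , p ,
             (λ k k∊l r → let j , j<l , k≋j = ∊num⁻ {l} k∊l in q j j<l (∊-respˡ (⟨⟩-cong k≋j ≋-refl) r)) , ≋-refl)


  module Enumerating {h f : V} (h-single : SingleValued h)
    (h-cover : ∀ α → α ∊ κ → Lift (lsuc 0ℓ) (¬ (real α ∊ U)) → Σ ℕ λ n → ⟨ num n , α ⟩ ∊ h) (f∊M : f ∊ M)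
    (f⁻ : ∀ {z} → z ∊ f → Σ V λ c → Σ V λ α → Σ ℕ λ l → ⟨ c , α ⟩ ∊ B × Least h α l × z ≋ ⟨ pair (real-name-of α) (ν l) , c ⟩)
    (f⁺ : ∀ {c α l} → ⟨ c , α ⟩ ∊ B → Least h α l → ⟨ pair (real-name-of α) (ν l) , c ⟩ ∊ f) where

    opaque

      entry-name : ∀ α l → IsName ℙ (pair (real-name-of α) (ν l))
      entry-name α l = pair-name (real-name α) (ν-name l)

      entry-val : ∀ {α} l → α ∊ κ → val G (entry-name α l) ≋ ⟨ real α , num l ⟩
      entry-val {α} l α∊κ = ≋-trans (pair-val (entry-name α l) (real-name α) (ν-name l))
        (⟨⟩-cong (real-val α∊κ (real-name α)) (ν-val l (ν-name l)))

      f-name : IsName ℙ f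
      f-name = name-intro f λ z z∊f → let c , α , l , a , _ , r = f⁻ z∊f in
        pair (real-name-of α) (ν l) , c , r , proj₁ (B⊆ a) , entry-name α l

      F : V
      F = val G f-name

    opaque
      unfolding F

      F∊extension : F ∊ extension M ℙ G
      F∊extension = ∊extension⁺ f∊M f-name

      F⁻ : ∀ {z} → z ∊ F → Σ V λ α → Σ ℕ λ l → α ∊ κ × ¬ (real α ∊ U) × Least h α l × z ≋ ⟨ real α , num l ⟩
      F⁻ z∊F with σ , c , p , c∊G , m , r ← ∊val⁻ f-name z∊F
        with c' , α , l , a , least-l , s ← f⁻ p
        with σ≋ , c≋ ← ⟨⟩-injective s
        = α , l , proj₂ (B⊆ a) , B-sound (∊-respˡ c≋ c∊G) a , least-l ,
          ≋-trans r (≋-trans (val-cong m (entry-name α l) σ≋) (entry-val l (proj₂ (B⊆ a))))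

      F⁺ : ∀ {α l} → α ∊ κ → ¬ (real α ∊ U) → Least h α l → ⟨ real α , num l ⟩ ∊ F
      F⁺ {α} {l} α∊κ α∉U least-l with c , c∊G , a ← B-complete α∊κ α∉U =
        ∊-respˡ (entry-val l α∊κ) (∊val⁺ f-name (entry-name α l) (f⁺ a least-l) c∊G)

    opaque

      F-total : ∀ {x} → x ∊ family G κ ∖ U → Σ V λ y → ⟨ x , y ⟩ ∊ F
      F-total x∊ with α , α∊κ , α∉U , x≋ ← outside⁻ x∊
        with n , p ← h-cover α α∊κ (lift α∉U)
        with l , least-l ← least (λ n → ⟨ num n , α ⟩ ∊ h) n p
        = num l , ∊-respˡ (⟨⟩-cong (≋-sym x≋) ≋-refl) (F⁺ α∊κ α∉U least-l)

      F-unique : ∀ {x y y'} → ⟨ x , y ⟩ ∊ F → ⟨ x , y' ⟩ ∊ F → y ≋ y'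
      F-unique a b with α , l , α∊κ , _ , p , r ← F⁻ a
        with α' , l' , α'∊κ , _ , (p' , q') , r' ← F⁻ b
        with x≋ , y≋ ← ⟨⟩-injective r
        with x≋' , y'≋ ← ⟨⟩-injective r'
        with α≋ ← real-injective α∊κ α'∊κ (≋-trans (≋-sym x≋) x≋')
        = ≋-trans y≋ (≋-trans (≡⇒≋ (cong num (Least-unique {h} {α} p
            (∊-respˡ (⟨⟩-cong ≋-refl (≋-sym α≋)) p' , λ k k<l s → q' k k<l (∊-respˡ (⟨⟩-cong ≋-refl α≋) s))))) (≋-sym y'≋))

      F-injective : ∀ {x x' y} → ⟨ x , y ⟩ ∊ F → ⟨ x' , y ⟩ ∊ F → x ≋ x'
      F-injective a b with α , l , _ , _ , (p , _) , r ← F⁻ a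
        with α' , l' , _ , _ , (p' , _) , r' ← F⁻ b
        with x≋ , y≋ ← ⟨⟩-injective r
        with x'≋ , y≋' ← ⟨⟩-injective r'
        = ≋-trans x≋ (≋-trans (real-cong (h-single (num l) α α' p
            (∊-respˡ (⟨⟩-cong (≋-trans (≋-sym y≋') y≋) ≋-refl) p'))) (≋-sym x'≋))

      F-injection : F IsInjection (family G κ ∖ U) ⟶ω
      F-injection = record
        { function = record
          { graph = λ z a → let α , l , α∊κ , α∉U , _ , r = F⁻ (∊-in a) in
              real α , num l , ∊-out (outside⁺ α∊κ α∉U ≋-refl) , ∊-out (num∊ω l) , ≋-out r
          ; total = λ x a → let y , b = F-total (∊-in a) in y , ∊-out b
          ; unique = λ x y y' a b → ≋-out (F-unique (∊-in a) (∊-in b)) }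
        ; injective = λ x x' y a b → ≋-out (F-injective (∊-in a) (∊-in b)) }

  opaque

    countable-outside : CountableIn (extension M ℙ G) (family G κ ∖ U)
    countable-outside
      with h , h∊M , h-single , h-cover ← bad-indices
      with f , f∊M , f⁻ , f⁺ ← enumeration-name h∊M
      = F , ∊-out F∊extension , F-injection
      where open Enumerating h-single h-cover f∊M f⁻ f⁺

theorem3 : ExcludedMiddle (lsuc 0ℓ) →
    ∀ M → CountableTransitiveModel M →
    ∀ κ → IsOmega₁ M κ →
    ∀ ℙ → ℙ ∈ M → IsHechlerPoset κ ℙ →
    ∀ G → Generic M ℙ G →
    ConcentratedIn (extension M ℙ G) (family G κ) (family G ω)
theorem3 em M ctm κ κ-ω₁ ℙ ℙ∈M poset G gen U U-open Q⊆U =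
  let τ , τ∊M , τ-name , U≋ = Names.∊extension⁻ ℙ G {M} (∊-in (OpenIn.inModel U-open)) in
  Concentration.countable-outside em M transitive zfc κ κ∊M
    (Hechler.ω⊆κ em M transitive zfc κ κ∊M ℙ (∊-in ℙ∈M) poset ordinal uncountable)
    ℙ (∊-in ℙ∈M) poset G gen U U-open Q⊆U τ τ∊M τ-name U≋
  where
  open CountableTransitiveModel ctm
  open IsOmega₁ κ-ω₁
  κ∊M : κ ∊ M
  κ∊M = ∊-in inModel
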